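{- Let $t$ be a positive integer. If a graph $G$ has a circular drawing whose crossing graph has no topological $K_t$-minor, then $G$ has treewidth at most $6t^2+6t+1$.
   Context: A circular drawing of a graph $G$ places the vertices at distinct points on a circle and draws each edge as the straight line segment between its endpoints. Two edges cross if their segments intersect at a point that is not an endpoint of either. The crossing graph of the drawing has vertex set $E(G)$, two edges adjacent iff they cross. A graph has a topological $K_t$-minor if a subgraph of it is isomorphic to a subdivision of $K_t$. -}

module Defs where

open import Data.Nat as ℕ using (ℕ; suc; _+_; _*_)
open import Data.Bool using (Bool; T)
open import Data.Fin using (Fin; toℕ)
open import Data.Fin.Subset using (Subset; _∈_; ∣_∣)
open import Data.Product using (Σ; ∃; ∃-syntax; _×_; _,_; proj₁; proj₂)
open import Data.Sum using (_⊎_)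
open import Data.Unit using (⊤)
open import Data.List using (List; []; _∷_; _++_; [_]; length)
open import Data.List.Relation.Unary.Linked using (Linked)
open import Data.List.Relation.Unary.Unique.Propositional using (Unique)
import Data.List.Membership.Propositional as LM
open import Function.Definitions using (Injective)
open import Relation.Binary.PropositionalEquality using (_≡_; _≢_)
open import Relation.Nullary using (¬_)

record FinGraph : Set where
  field
    n     : ℕ
    adj   : Fin n → Fin n → Bool
    sym   : ∀ u v → adj u v ≡ adj v u
    irref : ∀ v → adj v v ≡ Data.Bool.false

open FinGraph public

Adj : (G : FinGraph) → Fin (n G) → Fin (n G) → Set
Adj G u v = T (adj G u v)

-- Edges of G: unordered pairs {u,v}, represented by the ordered pair
-- (u , v) with u < v.
Edge : FinGraph → Set
Edge G = Σ (Fin (n G) × Fin (n G)) λ p →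
  (toℕ (proj₁ p) ℕ.< toℕ (proj₂ p)) × Adj G (proj₁ p) (proj₂ p)

record Graph : Set₁ where
  field
    V   : Set
    _~_ : V → V → Set

-- Circular drawings.  A circular drawing places the vertices at distinct
-- points of a circle; which pairs of straight-line edges cross depends only
-- on the cyclic order of the points, so a drawing is recorded by an
-- injective position map pos : Fin n → Fin n (the points read in order
-- around the circle).

CircularDrawing : FinGraph → Set
CircularDrawing G = Σ (Fin (n G) → Fin (n G)) Injective′
  where
  Injective′ : (Fin (n G) → Fin (n G)) → Set
  Injective′ f = Injective _≡_ _≡_ f

module _ (G : FinGraph) (D : CircularDrawing G) where
  private
    pos : Fin (n G) → ℕ
    pos v = toℕ (proj₁ D v)

  StrictlyBetween : Fin (n G) → Fin (n G) → Fin (n G) → Set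
  StrictlyBetween a b x =
    (pos a ℕ.< pos x × pos x ℕ.< pos b) ⊎ (pos b ℕ.< pos x × pos x ℕ.< pos a)

  -- chords ab and cd cross (at a point that is not an endpoint) iff the
  -- four endpoints are distinct and they interleave around the circle
  Cross : Edge G → Edge G → Set
  Cross ((a , b) , _) ((c , d) , _) =
    a ≢ c × a ≢ d × b ≢ c × b ≢ d ×
    ((StrictlyBetween a b c × ¬ StrictlyBetween a b d) ⊎
     (¬ StrictlyBetween a b c × StrictlyBetween a b d))

  CrossingGraph : Graph
  CrossingGraph = record { V = Edge G ; _~_ = Cross }

-- Topological K_t-minor: a subgraph isomorphic to a subdivision of K_t,
-- i.e. t distinct branch vertices b i and, for every pair i < j, a path
-- b i , mid i j , b j whose internal vertices avoid all branch vertices,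
-- the internal vertex sets of different paths being disjoint.

module _ (H : Graph) where
  open Graph H
  open LM using (_∉_) renaming (_∈_ to _∈ₗ_)

  HasTopologicalMinor : ℕ → Set
  HasTopologicalMinor t =
    Σ (Fin t → V) λ b →
    Σ (Fin t → Fin t → List V) λ mid →
      Injective _≡_ _≡_ b ×
      (∀ i j → toℕ i ℕ.< toℕ j →
         Linked _~_ (b i ∷ mid i j ++ [ b j ]) ×
         Unique (b i ∷ mid i j ++ [ b j ]) ×
         (∀ k → b k ∉ mid i j)) ×
      (∀ i j i′ j′ → toℕ i ℕ.< toℕ j → toℕ i′ ℕ.< toℕ j′ →
         (i , j) ≢ (i′ , j′) → ∀ x → x ∈ₗ mid i j → x ∉ mid i′ j′)

data WalkIn {A : Set} (R : A → A → Set) (P : A → Set) : A → A → Set where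
  here : ∀ {x} → P x → WalkIn R P x x
  step : ∀ {x y z} → P x → R x y → WalkIn R P y z → WalkIn R P x z

record Tree : Set₁ where
  field
    m      : ℕ
    _~ₜ_   : Fin m → Fin m → Set
    symₜ   : ∀ {x y} → x ~ₜ y → y ~ₜ x
    irrefₜ : ∀ x → ¬ (x ~ₜ x)
    connected : ∀ x y → WalkIn _~ₜ_ (λ _ → ⊤) x y
    acyclic : ∀ x ys → 2 ℕ.≤ length ys → Unique (x ∷ ys) →
              ¬ Linked _~ₜ_ (x ∷ ys ++ [ x ])

record TreeDecomposition (G : FinGraph) : Set₁ where
  field
    tree : Tree
  open Tree tree public
  field
    bag       : Fin m → Subset (n G)
    covers-vertices : ∀ v → ∃[ x ] v ∈ bag x
    covers-edges    : ∀ u v → Adj G u v → ∃[ x ] (u ∈ bag x × v ∈ bag x)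
    subtree   : ∀ v x y → v ∈ bag x → v ∈ bag y →
                WalkIn _~ₜ_ (λ z → v ∈ bag z) x y

TreewidthAtMost : FinGraph → ℕ → Set₁
TreewidthAtMost G k = Σ (TreeDecomposition G) λ D →
  ∀ x → ∣ TreeDecomposition.bag D x ∣ ℕ.≤ suc k

{-# OPTIONS --safe #-}
module Submission where

open import Defs hiding (sym)

open import Data.Bool using (Bool; true; false; T; T?; not; _∧_; _∨_; _xor_; if_then_else_)
open import Data.Bool.Properties using (∨-comm; ∧-zeroʳ; xor-same; T-≡; T-irrelevant)
open import Data.Bool.Solver using (module xor-∧-Solver)
open import Data.Empty using (⊥; ⊥-elim)
open import Data.Fin as Fin using (Fin; zero; suc; toℕ; fromℕ<; _↑ˡ_; _↑ʳ_)
open import Data.Fin.Properties using (suc-injective; toℕ<n; toℕ-↑ˡ; toℕ-↑ʳ; toℕ-fromℕ<; toℕ-injective)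
open import Data.Fin.Subset using (∣_∣) renaming (_∈_ to _∈ₛ_)
open import Data.List using (List; []; _∷_; _++_; [_]; length; map; filter; cartesianProduct; allFin)
import Data.List as List
open import Data.List.Membership.Propositional using (_∈_; _∉_)
open import Data.List.Membership.Propositional.Properties using (∈-filter⁺; ∈-filter⁻; ∈-++⁻; ∈-++⁺ˡ; ∈-++⁺ʳ; ∈-∃++; ∈-map⁺; ∈-tabulate⁺; ∈-tabulate⁻; ∈-cartesianProduct⁺; ∈-allFin)
import Data.List.Membership.DecPropositional as DecMembership
open import Data.List.Properties using (length-map; map-++; ++-assoc)
open import Data.List.Relation.Unary.All as All using (All; []; _∷_)
open import Data.List.Relation.Unary.AllPairs using ([]; _∷_)
open import Data.List.Relation.Unary.Any using (here; there)
open import Data.List.Relation.Unary.Linked as Linked using (Linked; []; [-]; _∷_)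
open import Data.List.Relation.Unary.Unique.Propositional using (Unique)
import Data.List.Relation.Unary.Unique.Propositional.Properties as Uniq
open import Data.Nat using (ℕ; zero; suc; _+_; _*_; _≤_; _<_; _<ᵇ_; _≡ᵇ_; z≤n; s≤s; _≤?_; _<?_)
open import Data.Nat.Properties hiding (suc-injective)
open import Algebra.Properties.CommutativeSemigroup +-commutativeSemigroup using (interchange)
open import Data.Nat.Solver using (module +-*-Solver)
open import Data.Product using (Σ; ∃-syntax; _×_; _,_; proj₁; proj₂)
open import Data.Product.Properties using (≡-dec)
open import Data.Sum using (_⊎_; inj₁; inj₂; [_,_]′) renaming (map₂ to ⊎-map₂)
open import Data.Unit using (⊤; tt)
open import Data.Vec using (Vec; []; _∷_; lookup; tabulate)
open import Data.Vec.Properties using (lookup∘tabulate; []=⇒lookup; lookup⇒[]=)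
open import Function using (_∘_; id; case_of_)
open import Function.Bundles using (module Equivalence)
open import Relation.Binary.Definitions using (DecidableEquality; tri<; tri≈; tri>)
open import Relation.Binary.PropositionalEquality using (_≡_; _≢_; refl; sym; trans; cong; cong₂; subst; subst₂)
open import Relation.Nullary using (¬_; Dec; yes; no)
open import Relation.Nullary.Decidable using (⌊_⌋; toWitness; fromWitness; ¬?; _×-dec_)

-- Cut the circle at a point and orient every chord relative to a cell c of the
-- drawing: the cap of a chord is the side not containing c.  Suppose that every
-- vertex lies in at least 2N − 1 caps.  A minimal cover of the vertices by
-- maximal caps is a cyclic chain of chords, consecutive ones crossing, and it
-- contains each vertex in at most two caps; so N disjoint such layers can be
-- peeled off, and every chord of a layer crosses all later layers.  With
-- N = t + t(t−1)/2, branch chords from the first t layers are joined pairwise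
-- through private later layers, which gives a topological K_t-minor.
--
-- Otherwise every cell c is near a vertex: at most 2N − 2 chords separate them.
-- Given a vertex set W, a discrete Stokes argument over all cells finds three
-- vertices near a common cell such that each of the three arcs between them
-- contains at most half of W: otherwise, passing between near vertices of
-- neighbouring cells along the lighter arc would be a cocycle on a disk whose
-- boundary winds once around the circle.  The ends of the chords between the
-- cell and two of these vertices separate one arc from the rest of the graph.
-- Applying this to the boundary of the part not yet decomposed yields a tree
-- decomposition with bags of size at most 6(t² + t) + 1.

-- No planar geometry is needed for the cells. Redraw every chord as an L-shaped path with corner
-- `(lo , hi)` in the triangle `0 ≤ y ≤ x ≤ n`, whose diagonal is the cut circle: chords without a
-- common end cross exactly when they interleave, and the grid points of the triangle represent the
-- cells. The layers use only that any two chords are oriented coherently. The obstacle in the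
-- Stokes argument is that the vertices it compares are near neighbouring cells rather than one
-- cell. Neighbouring cells disagree only on chords with an end at one position, so a tripod exempts
-- the chords at two positions and pays for this with two extra vertices. The constants: a leg has
-- at most 2N - 2 chords and its foot, so with ℓ = 2N = t² + t, two legs and the two exempt vertices
-- make at most 2ℓ. A boundary of 4ℓ vertices and one new vertex leave at most 2ℓ of them in each
-- arc; adding 2ℓ gives 4ℓ again, so the bound on boundaries reproduces itself. The largest bag has
-- (4ℓ + 1) + 2ℓ vertices.

-- Booleans and cardinalities of finite sets

∧-intro : ∀ {a b} → T a → T b → T (a ∧ b)
∧-intro {true} {true} _ _ = tt

∧-elim : ∀ {a b} → T (a ∧ b) → T a × T b
∧-elim {true} {true} _ = tt , tt

∨-introˡ : ∀ {a b} → T a → T (a ∨ b)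
∨-introˡ {true} _ = tt

∨-introʳ : ∀ {a b} → T b → T (a ∨ b)
∨-introʳ {true}  _ = tt
∨-introʳ {false} p = p

∨-elim : ∀ {a b} → T (a ∨ b) → T a ⊎ T b
∨-elim {true}  _ = inj₁ tt
∨-elim {false} p = inj₂ p

not-intro : ∀ {a} → ¬ T a → T (not a)
not-intro {true}  p = p tt
not-intro {false} _ = tt

not-elim : ∀ {a} → T (not a) → ¬ T a
not-elim {false} _ ()

T-dec : ∀ b → T b ⊎ T (not b)
T-dec true  = inj₁ tt
T-dec false = inj₂ tt

T-ext : ∀ {a b} → (T a → T b) → (T b → T a) → a ≡ b
T-ext {true}  {true}  _ _ = refl
T-ext {true}  {false} f _ = ⊥-elim (f tt)
T-ext {false} {true}  _ g = ⊥-elim (g tt)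
T-ext {false} {false} _ _ = refl

𝟙 : Bool → ℕ
𝟙 true  = 1
𝟙 false = 0

𝟙-mono : ∀ {a b} → (T a → T b) → 𝟙 a ≤ 𝟙 b
𝟙-mono {false}         _ = z≤n
𝟙-mono {true}  {true}  _ = ≤-refl
𝟙-mono {true}  {false} f = ⊥-elim (f tt)

𝟙-∨ : ∀ a b → 𝟙 (a ∨ b) ≤ 𝟙 a + 𝟙 b
𝟙-∨ true  b = s≤s z≤n
𝟙-∨ false b = ≤-refl

𝟙-disjoint : ∀ {a b c} → (T a → T c) → (T b → T c) → (T a → ¬ T b) → 𝟙 a + 𝟙 b ≤ 𝟙 c
𝟙-disjoint {true}  {true}  _ _ d = ⊥-elim (d tt tt)
𝟙-disjoint {true}  {false} f _ _ = 𝟙-mono f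
𝟙-disjoint {false}         _ g _ = 𝟙-mono g

∣_∣ᵇ : ∀ {n} → (Fin n → Bool) → ℕ
∣_∣ᵇ {zero}  f = 0
∣_∣ᵇ {suc n} f = 𝟙 (f zero) + ∣ f ∘ suc ∣ᵇ

∣∣-mono : ∀ {n} {f g : Fin n → Bool} → (∀ x → T (f x) → T (g x)) → ∣ f ∣ᵇ ≤ ∣ g ∣ᵇ
∣∣-mono {zero}  h = z≤n
∣∣-mono {suc n} h = +-mono-≤ (𝟙-mono (h zero)) (∣∣-mono (h ∘ suc))

∣∣-strict : ∀ {n} {f g : Fin n → Bool} → (∀ x → T (f x) → T (g x)) →
            ∀ x → T (g x) → ¬ T (f x) → ∣ f ∣ᵇ < ∣ g ∣ᵇ
∣∣-strict {suc n} {f} {g} h zero gx ¬fx with f zero | g zero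
... | true  | _    = ⊥-elim (¬fx tt)
... | false | true = s≤s (∣∣-mono (h ∘ suc))
∣∣-strict {suc n} h (suc x) gx ¬fx =
  +-mono-≤-< (𝟙-mono (h zero)) (∣∣-strict (h ∘ suc) x gx ¬fx)

∣∣-cong : ∀ {n} {f g : Fin n → Bool} → (∀ x → f x ≡ g x) → ∣ f ∣ᵇ ≡ ∣ g ∣ᵇ
∣∣-cong {zero}  h = refl
∣∣-cong {suc n} h = cong₂ _+_ (cong 𝟙 (h zero)) (∣∣-cong (h ∘ suc))

∣∣-∪ : ∀ {n} (f g : Fin n → Bool) → ∣ (λ x → f x ∨ g x) ∣ᵇ ≤ ∣ f ∣ᵇ + ∣ g ∣ᵇ
∣∣-∪ {zero}  f g = z≤n
∣∣-∪ {suc n} f g = ≤-trans (+-mono-≤ (𝟙-∨ (f zero) (g zero)) (∣∣-∪ (f ∘ suc) (g ∘ suc)))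
  (≤-reflexive (interchange (𝟙 (f zero)) (𝟙 (g zero)) _ _))

∣∣-disjoint : ∀ {n} {f g h : Fin n → Bool} → (∀ x → T (f x) → T (h x)) → (∀ x → T (g x) → T (h x)) →
              (∀ x → T (f x) → ¬ T (g x)) → ∣ f ∣ᵇ + ∣ g ∣ᵇ ≤ ∣ h ∣ᵇ
∣∣-disjoint {zero}  _ _ _ = z≤n
∣∣-disjoint {suc n} {f} {g} p q d = ≤-trans (≤-reflexive (interchange (𝟙 (f zero)) _ (𝟙 (g zero)) _))
  (+-mono-≤ (𝟙-disjoint (p zero) (q zero) (d zero)) (∣∣-disjoint (p ∘ suc) (q ∘ suc) (d ∘ suc)))

∣∣-empty : ∀ {n} {f : Fin n → Bool} → (∀ x → ¬ T (f x)) → ∣ f ∣ᵇ ≡ 0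
∣∣-empty {zero}  h = refl
∣∣-empty {suc n} {f} h with f zero | h zero
... | true  | ¬t = ⊥-elim (¬t tt)
... | false | _  = ∣∣-empty (h ∘ suc)

∣∣-subsingleton : ∀ {n} {f : Fin n → Bool} → (∀ x y → T (f x) → T (f y) → x ≡ y) → ∣ f ∣ᵇ ≤ 1
∣∣-subsingleton {zero}  h = z≤n
∣∣-subsingleton {suc n} {f} h with f zero | h zero
... | false | _  = ∣∣-subsingleton λ x y p q → suc-injective (h (suc x) (suc y) p q)
... | true  | h₀ = ≤-reflexive (cong suc (∣∣-empty λ x p → case h₀ (suc x) tt p of λ ()))

∣∣-≤ : ∀ {n} (f : Fin n → Bool) → ∣ f ∣ᵇ ≤ n
∣∣-≤ {zero}  f = z≤n
∣∣-≤ {suc n} f with f zero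
... | true  = s≤s (∣∣-≤ (f ∘ suc))
... | false = m≤n⇒m≤1+n (∣∣-≤ (f ∘ suc))

∣∣-full : ∀ {n} → ∣ (λ (_ : Fin n) → true) ∣ᵇ ≡ n
∣∣-full {zero}  = refl
∣∣-full {suc n} = cong suc ∣∣-full

search : ∀ {n} {P Q : Fin n → Set} → (∀ x → P x ⊎ Q x) → (∃[ x ] P x) ⊎ (∀ x → Q x)
search {zero}  h = inj₂ λ ()
search {suc n} h with h zero | search (h ∘ suc)
... | inj₁ p | _            = inj₁ (zero , p)
... | inj₂ _ | inj₁ (x , p) = inj₁ (suc x , p)
... | inj₂ q | inj₂ g       = inj₂ λ where
  zero    → q
  (suc x) → g x

-- Deciding statements about linear order

-- A propositional combination of comparisons between k numbers only depends
-- on their ranks, which are smaller than k, so it suffices to test all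
-- k-tuples of numbers below k.

data Formula (k : ℕ) : Set where
  _≺_         : Fin k → Fin k → Formula k
  _∧ᶠ_ _∨ᶠ_ : Formula k → Formula k → Formula k
  ¬ᶠ_         : Formula k → Formula k
  ⊤ᶠ          : Formula k

infix  9 _≺_
infix  8 ¬ᶠ_
infixr 7 _∧ᶠ_
infixr 6 _∨ᶠ_

eval : ∀ {k} → Vec ℕ k → Formula k → Bool
eval ρ (i ≺ j)  = lookup ρ i <ᵇ lookup ρ j
eval ρ (φ ∧ᶠ ψ) = eval ρ φ ∧ eval ρ ψ
eval ρ (φ ∨ᶠ ψ) = eval ρ φ ∨ eval ρ ψ
eval ρ (¬ᶠ φ)   = not (eval ρ φ)
eval ρ ⊤ᶠ       = true

allBelow : ℕ → (ℕ → Bool) → Bool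
allBelow zero    f = true
allBelow (suc b) f = f b ∧ allBelow b f

allTuples : ∀ m → ℕ → (Vec ℕ m → Bool) → Bool
allTuples zero    b f = f []
allTuples (suc m) b f = allBelow b λ i → allTuples m b λ ρ → f (i ∷ ρ)

allBelow-sound : ∀ b f → T (allBelow b f) → ∀ {i} → i < b → T (f i)
allBelow-sound (suc b) f p {i} i<1+b with m≤n⇒m<n∨m≡n i<1+b
... | inj₁ (s≤s i<b) = allBelow-sound b f (proj₂ (∧-elim {f b} p)) i<b
... | inj₂ refl      = proj₁ (∧-elim p)

allTuples-sound : ∀ m b f → T (allTuples m b f) → ∀ ρ → (∀ i → lookup ρ i < b) → T (f ρ)
allTuples-sound zero    b f p []      _ = p
allTuples-sound (suc m) b f p (i ∷ ρ) h = allTuples-sound m b (λ ρ → f (i ∷ ρ))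
  (allBelow-sound b (λ i → allTuples m b λ ρ → f (i ∷ ρ)) p (h zero)) ρ (h ∘ suc)

rank : ∀ {k} → Vec ℕ k → Fin k → ℕ
rank ρ i = ∣ (λ j → lookup ρ j <ᵇ lookup ρ i) ∣ᵇ

-- Whatever lies below the smaller entry lies below the larger one, and the smaller entry itself
-- makes the second count strictly bigger; if `i` is not below `j`, the inclusion runs the other
-- way.
rank-<ᵇ : ∀ {k} (ρ : Vec ℕ k) i j → (rank ρ i <ᵇ rank ρ j) ≡ (lookup ρ i <ᵇ lookup ρ j)
rank-<ᵇ ρ i j = T-ext to from
  where
  ρᵢ = lookup ρ i
  ρⱼ = lookup ρ j
  from : T (ρᵢ <ᵇ ρⱼ) → T (rank ρ i <ᵇ rank ρ j)
  from p = <⇒<ᵇ (∣∣-strict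
    (λ x q → <⇒<ᵇ (<-trans (<ᵇ⇒< (lookup ρ x) ρᵢ q) (<ᵇ⇒< ρᵢ ρⱼ p))) i p
    (λ q → <-irrefl refl (<ᵇ⇒< ρᵢ ρᵢ q)))
  to : T (rank ρ i <ᵇ rank ρ j) → T (ρᵢ <ᵇ ρⱼ)
  to p with T-dec (ρᵢ <ᵇ ρⱼ)
  ... | inj₁ q = q
  ... | inj₂ q = ⊥-elim (<⇒≱ (<ᵇ⇒< (rank ρ i) (rank ρ j) p) (∣∣-mono λ x r →
    <⇒<ᵇ (<-≤-trans (<ᵇ⇒< (lookup ρ x) ρⱼ r) (≮⇒≥ {ρᵢ} {ρⱼ} (λ i<j → not-elim q (<⇒<ᵇ i<j))))))

rank-< : ∀ {k} (ρ : Vec ℕ k) i → rank ρ i < k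
rank-< {k} ρ i = subst (rank ρ i <_) ∣∣-full
  (∣∣-strict (λ _ _ → tt) i tt (λ q → <-irrefl refl (<ᵇ⇒< (lookup ρ i) _ q)))

eval-rank : ∀ {k} (ρ : Vec ℕ k) φ → eval (tabulate (rank ρ)) φ ≡ eval ρ φ
eval-rank ρ (i ≺ j)  = trans
  (cong₂ _<ᵇ_ (lookup∘tabulate (rank ρ) i) (lookup∘tabulate (rank ρ) j)) (rank-<ᵇ ρ i j)
eval-rank ρ (φ ∧ᶠ ψ) = cong₂ _∧_ (eval-rank ρ φ) (eval-rank ρ ψ)
eval-rank ρ (φ ∨ᶠ ψ) = cong₂ _∨_ (eval-rank ρ φ) (eval-rank ρ ψ)
eval-rank ρ (¬ᶠ φ)   = cong not (eval-rank ρ φ)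
eval-rank ρ ⊤ᶠ       = refl

Entails : ∀ {k} → Vec ℕ k → List (Formula k) → Formula k → Set
Entails ρ []       ψ = T (eval ρ ψ)
Entails ρ (φ ∷ φs) ψ = T (eval ρ φ) → Entails ρ φs ψ

implication : ∀ {k} → List (Formula k) → Formula k → Formula k
implication []       ψ = ψ
implication (φ ∷ φs) ψ = ¬ᶠ φ ∨ᶠ implication φs ψ

entails : ∀ {k} (ρ : Vec ℕ k) φs ψ → T (eval ρ (implication φs ψ)) → Entails ρ φs ψ
entails ρ []       ψ p   = p
entails ρ (φ ∷ φs) ψ p q with ∨-elim p
... | inj₁ ¬q = ⊥-elim (not-elim ¬q q)
... | inj₂ r  = entails ρ φs ψ r

-- For closed formulas the implicit argument evaluates to `⊤` and is filled in by eta. Flags and arc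
-- indices therefore have to be split into cases before each use.
by-order : ∀ {k} (φs : List (Formula k)) (ψ : Formula k)
           {_ : T (allTuples k k λ ρ → eval ρ (implication φs ψ))} →
           ∀ ρ → Entails ρ φs ψ
by-order {k} φs ψ {p} ρ = entails ρ φs ψ (subst T (eval-rank ρ (implication φs ψ))
  (allTuples-sound k k (λ ρ → eval ρ (implication φs ψ)) p (tabulate (rank ρ))
    λ i → subst (_< k) (sym (lookup∘tabulate (rank ρ) i)) (rank-< ρ i)))

pattern ⟨0⟩ = zero
pattern ⟨1⟩ = suc zero
pattern ⟨2⟩ = suc (suc zero)
pattern ⟨3⟩ = suc (suc (suc zero))
pattern ⟨4⟩ = suc (suc (suc (suc zero)))
pattern ⟨5⟩ = suc (suc (suc (suc (suc zero))))

-- Caps, arcs and cyclic order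

between : ℕ → ℕ → ℕ → Bool
between p q z = ((p <ᵇ z) ∧ (z <ᵇ q)) ∨ ((q <ᵇ z) ∧ (z <ᵇ p))

betweenᶠ : ∀ {k} → Fin k → Fin k → Fin k → Formula k
betweenᶠ p q z = (p ≺ z ∧ᶠ z ≺ q) ∨ᶠ (q ≺ z ∧ᶠ z ≺ p)

-- The chord with ends lo < hi cuts off the cap of positions strictly
-- between lo and hi (flag false) or strictly outside them (flag true).

cap : Bool → ℕ → ℕ → ℕ → Bool
cap true  lo hi v = (v <ᵇ lo) ∨ (hi <ᵇ v)
cap false lo hi v = (lo <ᵇ v) ∧ (v <ᵇ hi)

capᶠ : ∀ {k} → Bool → Fin k → Fin k → Fin k → Formula k
capᶠ true  lo hi v = v ≺ lo ∨ᶠ hi ≺ v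
capᶠ false lo hi v = lo ≺ v ∧ᶠ v ≺ hi

-- The end at which the cap stops when the circle is traversed upwards.

endOf : ∀ {a} {A : Set a} → Bool → A → A → A
endOf true  lo hi = lo
endOf false lo hi = hi

interleave : ℕ → ℕ → ℕ → ℕ → Bool
interleave l h l′ h′ = ((l <ᵇ l′) ∧ (l′ <ᵇ h) ∧ (h <ᵇ h′)) ∨ ((l′ <ᵇ l) ∧ (l <ᵇ h′) ∧ (h′ <ᵇ h))

interleaveᶠ : ∀ {k} → Fin k → Fin k → Fin k → Fin k → Formula k
interleaveᶠ l h l′ h′ = (l ≺ l′ ∧ᶠ l′ ≺ h ∧ᶠ h ≺ h′) ∨ᶠ (l′ ≺ l ∧ᶠ l ≺ h′ ∧ᶠ h′ ≺ h)

-- The two sides that are not cut off have more than a vertex in common.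

coherent : Bool → Bool → ℕ → ℕ → ℕ → ℕ → Bool
coherent true  true  l h l′ h′ = (l′ <ᵇ h) ∧ (l <ᵇ h′)
coherent true  false l h l′ h′ = (l <ᵇ l′) ∨ (h′ <ᵇ h)
coherent false true  l h l′ h′ = (l′ <ᵇ l) ∨ (h <ᵇ h′)
coherent false false l h l′ h′ = true

coherentᶠ : ∀ {k} → Bool → Bool → Fin k → Fin k → Fin k → Fin k → Formula k
coherentᶠ true  true  l h l′ h′ = l′ ≺ h ∧ᶠ l ≺ h′
coherentᶠ true  false l h l′ h′ = l ≺ l′ ∨ᶠ h′ ≺ h
coherentᶠ false true  l h l′ h′ = l′ ≺ l ∨ᶠ h ≺ h′
coherentᶠ false false l h l′ h′ = ⊤ᶠ

cyclic : ℕ → ℕ → ℕ → Bool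
cyclic a b c = ((a <ᵇ b) ∧ (b <ᵇ c)) ∨ ((b <ᵇ c) ∧ (c <ᵇ a)) ∨ ((c <ᵇ a) ∧ (a <ᵇ b))

cyclicᶠ : ∀ {k} → Fin k → Fin k → Fin k → Formula k
cyclicᶠ a b c = (a ≺ b ∧ᶠ b ≺ c) ∨ᶠ (b ≺ c ∧ᶠ c ≺ a) ∨ᶠ (c ≺ a ∧ᶠ a ≺ b)

-- Membership of z in the half-open arc from r upwards to v, empty if r = v.

arc : ℕ → ℕ → ℕ → Bool
arc r v z = ((r <ᵇ v) ∧ not (z <ᵇ r) ∧ (z <ᵇ v)) ∨ ((v <ᵇ r) ∧ (not (z <ᵇ r) ∨ (z <ᵇ v)))

arcᶠ : ∀ {k} → Fin k → Fin k → Fin k → Formula k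
arcᶠ r v z = (r ≺ v ∧ᶠ ¬ᶠ (z ≺ r) ∧ᶠ z ≺ v) ∨ᶠ (v ≺ r ∧ᶠ (¬ᶠ (z ≺ r) ∨ᶠ z ≺ v))

end∉cap : ∀ o lo hi → T (lo <ᵇ hi) → T (not (cap o lo hi (endOf o lo hi)))
end∉cap true  lo hi = by-order (⟨0⟩ ≺ ⟨1⟩ ∷ []) (¬ᶠ capᶠ true ⟨0⟩ ⟨1⟩ ⟨0⟩) (lo ∷ hi ∷ [])
end∉cap false lo hi = by-order (⟨0⟩ ≺ ⟨1⟩ ∷ []) (¬ᶠ capᶠ false ⟨0⟩ ⟨1⟩ ⟨1⟩) (lo ∷ hi ∷ [])

-- The first chord does not cross the second and has an end strictly inside the second cap, so one
-- of its two sides is contained in that cap. If this were the side of the cell, the two sides that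
-- are not cut off would share at most a vertex, against coherence.
cap-⊆ : ∀ o o′ lo hi lo′ hi′ z → T (lo <ᵇ hi) → T (lo′ <ᵇ hi′) → T (coherent o o′ lo hi lo′ hi′) →
        T (cap o′ lo′ hi′ (endOf o lo hi)) → T (not (interleave lo hi lo′ hi′)) →
        T (cap o lo hi z) → T (cap o′ lo′ hi′ z)
cap-⊆ o o′ lo hi lo′ hi′ z = go o o′
  where
  hyps : Bool → Bool → List (Formula 5)
  hyps o o′ = ⟨0⟩ ≺ ⟨1⟩ ∷ ⟨2⟩ ≺ ⟨3⟩ ∷ coherentᶠ o o′ ⟨0⟩ ⟨1⟩ ⟨2⟩ ⟨3⟩ ∷
    capᶠ o′ ⟨2⟩ ⟨3⟩ (endOf o ⟨0⟩ ⟨1⟩) ∷ ¬ᶠ interleaveᶠ ⟨0⟩ ⟨1⟩ ⟨2⟩ ⟨3⟩ ∷ capᶠ o ⟨0⟩ ⟨1⟩ ⟨4⟩ ∷ []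
  ρ : Vec ℕ 5
  ρ = lo ∷ hi ∷ lo′ ∷ hi′ ∷ z ∷ []
  go : ∀ o o′ → T (lo <ᵇ hi) → T (lo′ <ᵇ hi′) → T (coherent o o′ lo hi lo′ hi′) →
       T (cap o′ lo′ hi′ (endOf o lo hi)) → T (not (interleave lo hi lo′ hi′)) →
       T (cap o lo hi z) → T (cap o′ lo′ hi′ z)
  go true  true  = by-order (hyps true true)  (capᶠ true ⟨2⟩ ⟨3⟩ ⟨4⟩) ρ
  go true  false = by-order (hyps true false) (capᶠ false ⟨2⟩ ⟨3⟩ ⟨4⟩) ρ
  go false true  = by-order (hyps false true) (capᶠ true ⟨2⟩ ⟨3⟩ ⟨4⟩) ρ
  go false false = by-order (hyps false false) (capᶠ false ⟨2⟩ ⟨3⟩ ⟨4⟩) ρ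

-- A cap is an arc that stops at `endOf`. If `v′` is met before that end on the way up from `v`, the
-- way to `v′` stays in the cap.
cap-arcʳ : ∀ o lo hi v v′ z → T (lo <ᵇ hi) → T (cap o lo hi v) → T (cap o lo hi v′) →
           T (cyclic v v′ (endOf o lo hi)) → T (cyclic v z v′) → T (cap o lo hi z)
cap-arcʳ o lo hi v v′ z = go o
  where
  hyps : Bool → List (Formula 5)
  hyps o = ⟨0⟩ ≺ ⟨1⟩ ∷ capᶠ o ⟨0⟩ ⟨1⟩ ⟨2⟩ ∷ capᶠ o ⟨0⟩ ⟨1⟩ ⟨3⟩ ∷
    cyclicᶠ ⟨2⟩ ⟨3⟩ (endOf o ⟨0⟩ ⟨1⟩) ∷ cyclicᶠ ⟨2⟩ ⟨4⟩ ⟨3⟩ ∷ []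
  ρ : Vec ℕ 5
  ρ = lo ∷ hi ∷ v ∷ v′ ∷ z ∷ []
  go : ∀ o → T (lo <ᵇ hi) → T (cap o lo hi v) → T (cap o lo hi v′) →
       T (cyclic v v′ (endOf o lo hi)) → T (cyclic v z v′) → T (cap o lo hi z)
  go true  = by-order (hyps true)  (capᶠ true  ⟨0⟩ ⟨1⟩ ⟨4⟩) ρ
  go false = by-order (hyps false) (capᶠ false ⟨0⟩ ⟨1⟩ ⟨4⟩) ρ

≢⇒≶ : ∀ {a b} → a ≢ b → T ((a <ᵇ b) ∨ (b <ᵇ a))
≢⇒≶ {a} {b} a≢b with <-cmp a b
... | tri< a<b _ _ = ∨-introˡ (<⇒<ᵇ a<b)
... | tri≈ _ a≡b _ = ⊥-elim (a≢b a≡b)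
... | tri> _ _ b<a = ∨-introʳ {a <ᵇ b} (<⇒<ᵇ b<a)

cyclic-or : ∀ a b c → a ≢ b → b ≢ c → a ≢ c → T (cyclic a b c ∨ cyclic b a c)
cyclic-or a b c a≢b b≢c a≢c = by-order
  (⟨0⟩ ≺ ⟨1⟩ ∨ᶠ ⟨1⟩ ≺ ⟨0⟩ ∷ ⟨1⟩ ≺ ⟨2⟩ ∨ᶠ ⟨2⟩ ≺ ⟨1⟩ ∷ ⟨0⟩ ≺ ⟨2⟩ ∨ᶠ ⟨2⟩ ≺ ⟨0⟩ ∷ [])
  (cyclicᶠ ⟨0⟩ ⟨1⟩ ⟨2⟩ ∨ᶠ cyclicᶠ ⟨1⟩ ⟨0⟩ ⟨2⟩) (a ∷ b ∷ c ∷ []) (≢⇒≶ a≢b) (≢⇒≶ b≢c) (≢⇒≶ a≢c)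

cyclic-rotate : ∀ a b c → T (cyclic a b c) → T (cyclic b c a)
cyclic-rotate a b c = by-order (cyclicᶠ ⟨0⟩ ⟨1⟩ ⟨2⟩ ∷ []) (cyclicᶠ ⟨1⟩ ⟨2⟩ ⟨0⟩) (a ∷ b ∷ c ∷ [])

-- On the way up from `r` to `v` the cap must be left, and this happens at its end. Together with
-- `arc-∌` this makes the remaining arc strictly shorter when `r` is replaced by the end.
arc-⊆ : ∀ o lo hi r v z → T (lo <ᵇ hi) → T (cap o lo hi r) → T (not (cap o lo hi v)) →
        T (arc (endOf o lo hi) v z) → T (arc r v z)
arc-⊆ o lo hi r v z = go o
  where
  hyps : Bool → List (Formula 5)
  hyps o = ⟨0⟩ ≺ ⟨1⟩ ∷ capᶠ o ⟨0⟩ ⟨1⟩ ⟨2⟩ ∷ ¬ᶠ capᶠ o ⟨0⟩ ⟨1⟩ ⟨3⟩ ∷ arcᶠ (endOf o ⟨0⟩ ⟨1⟩) ⟨3⟩ ⟨4⟩ ∷ []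
  ρ : Vec ℕ 5
  ρ = lo ∷ hi ∷ r ∷ v ∷ z ∷ []
  go : ∀ o → T (lo <ᵇ hi) → T (cap o lo hi r) → T (not (cap o lo hi v)) →
       T (arc (endOf o lo hi) v z) → T (arc r v z)
  go true  = by-order (hyps true)  (arcᶠ ⟨2⟩ ⟨3⟩ ⟨4⟩) ρ
  go false = by-order (hyps false) (arcᶠ ⟨2⟩ ⟨3⟩ ⟨4⟩) ρ

arc-∌ : ∀ o lo hi r v → T (lo <ᵇ hi) → T (cap o lo hi r) → T (not (cap o lo hi v)) →
        T (arc r v r ∧ not (arc (endOf o lo hi) v r))
arc-∌ o lo hi r v = go o
  where
  hyps : Bool → List (Formula 4)
  hyps o = ⟨0⟩ ≺ ⟨1⟩ ∷ capᶠ o ⟨0⟩ ⟨1⟩ ⟨2⟩ ∷ ¬ᶠ capᶠ o ⟨0⟩ ⟨1⟩ ⟨3⟩ ∷ []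
  concl : Bool → Formula 4
  concl o = arcᶠ ⟨2⟩ ⟨3⟩ ⟨2⟩ ∧ᶠ ¬ᶠ arcᶠ (endOf o ⟨0⟩ ⟨1⟩) ⟨3⟩ ⟨2⟩
  ρ : Vec ℕ 4
  ρ = lo ∷ hi ∷ r ∷ v ∷ []
  go : ∀ o → T (lo <ᵇ hi) → T (cap o lo hi r) → T (not (cap o lo hi v)) →
       T (arc r v r ∧ not (arc (endOf o lo hi) v r))
  go true  = by-order (hyps true)  (concl true) ρ
  go false = by-order (hyps false) (concl false) ρ

-- Counting and selecting in lists

module _ {A : Set} where

  count : (A → Bool) → List A → ℕ
  count q []       = 0
  count q (x ∷ xs) = 𝟙 (q x) + count q xs

  count-∈ : ∀ q xs → 1 ≤ count q xs → ∃[ x ] x ∈ xs × T (q x)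
  count-∈ q (x ∷ xs) h with q x in eq
  ... | true  = x , here refl , subst T (sym eq) tt
  ... | false with count-∈ q xs h
  ...   | y , y∈ , qy = y , there y∈ , qy

  count-pick : ∀ {q xs k} → Unique xs → suc k ≤ count q xs →
    ∃[ x ] ∃[ ys ] x ∈ xs × T (q x) × Unique ys × (∀ {y} → y ∈ ys → y ∈ xs × x ≢ y) × k ≤ count q ys
  count-pick {q} {x ∷ xs} (x∉ ∷ u) h with q x in eq
  ... | true  = x , xs , here refl , subst T (sym eq) tt , u , (λ y∈ → there y∈ , All.lookup x∉ y∈) , ≤-pred h
  ... | false with count-pick {q} u h
  ...   | y , ys , y∈ , qy , v , sub , k≤ =
    y , ys , there y∈ , qy , v , (λ z∈ → there (proj₁ (sub z∈)) , proj₂ (sub z∈)) , k≤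

  count-three : ∀ {q xs} → Unique xs → 3 ≤ count q xs →
    ∃[ x ] ∃[ y ] ∃[ z ] (x ∈ xs × T (q x)) × (y ∈ xs × T (q y)) × (z ∈ xs × T (q z)) ×
      x ≢ y × y ≢ z × x ≢ z
  count-three {q} {xs} u h with count-pick {q} u h
  ... | x , ys , x∈ , qx , v , sub , h₁ with count-pick {q} v h₁
  ...   | y , zs , y∈ , qy , w , sub₁ , h₂ with count-∈ q zs h₂
  ...     | z , z∈ , qz = x , y , z , (x∈ , qx) , (proj₁ (sub y∈) , qy) ,
    (proj₁ (sub (proj₁ (sub₁ z∈))) , qz) , proj₂ (sub y∈) , proj₂ (sub₁ z∈) , proj₂ (sub (proj₁ (sub₁ z∈)))

  maximal : ∀ (size : A → ℕ) (q : A → Bool) xs → (∀ {y} → y ∈ xs → ¬ T (q y)) ⊎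
    (∃[ x ] x ∈ xs × T (q x) × (∀ {y} → y ∈ xs → T (q y) → size y ≤ size x))
  maximal size q []       = inj₁ λ ()
  maximal size q (x ∷ xs) with T-dec (q x) | maximal size q xs
  ... | inj₂ ¬qx | inj₁ none = inj₁ λ where
    (here refl) → not-elim ¬qx
    (there y∈)  → none y∈
  ... | inj₂ ¬qx | inj₂ (m , m∈ , qm , max) = inj₂ (m , there m∈ , qm , λ where
    (here refl) qy → ⊥-elim (not-elim ¬qx qy)
    (there y∈)  qy → max y∈ qy)
  ... | inj₁ qx  | inj₁ none = inj₂ (x , here refl , qx , λ where
    (here refl) _  → ≤-refl
    (there y∈)  qy → ⊥-elim (none y∈ qy))
  ... | inj₁ qx  | inj₂ (m , m∈ , qm , max) with ≤-total (size x) (size m)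
  ...   | inj₁ x≤m = inj₂ (m , there m∈ , qm , λ where
    (here refl) _  → x≤m
    (there y∈)  qy → max y∈ qy)
  ...   | inj₂ m≤x = inj₂ (x , here refl , qx , λ where
    (here refl) _  → ≤-refl
    (there y∈)  qy → ≤-trans (max y∈ qy) m≤x)

  any-dec : ∀ (q : A → Bool) xs → (∃[ x ] x ∈ xs × T (q x)) ⊎ (∀ {x} → x ∈ xs → ¬ T (q x))
  any-dec q xs with maximal (λ _ → 0) q xs
  ... | inj₁ none             = inj₂ none
  ... | inj₂ (x , x∈ , qx , _) = inj₁ (x , x∈ , qx)

-- Numbering of pairs

tri : ℕ → ℕ
tri zero    = 0
tri (suc j) = j + tri j

pairIndex : ℕ → ℕ → ℕ
pairIndex i j = i + tri j

tri-mono : ∀ {i j} → i ≤ j → tri i ≤ tri j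
tri-mono z≤n       = z≤n
tri-mono (s≤s i≤j) = +-mono-≤ i≤j (tri-mono i≤j)

pairIndex-< : ∀ {i j k} → i < j → j < k → pairIndex i j < tri k
pairIndex-< {j = j} i<j j<k = <-≤-trans (+-monoˡ-< (tri j) i<j) (tri-mono j<k)

-- The pairs with larger entry `j` occupy the block from `tri j` up to but excluding `tri (suc j)`,
-- so equal indices lie in the same block.
pairIndex-injective : ∀ {i j i′ j′} → i < j → i′ < j′ → pairIndex i j ≡ pairIndex i′ j′ → i ≡ i′ × j ≡ j′
pairIndex-injective {i} {j} {i′} {j′} i<j i′<j′ eq with <-cmp j j′
... | tri< j<j′ _ _ = ⊥-elim (<⇒≢ (<-≤-trans (pairIndex-< i<j j<j′) (m≤n+m (tri j′) i′)) eq)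
... | tri≈ _ refl _ = +-cancelʳ-≡ (tri j) i i′ eq , refl
... | tri> _ _ j′<j = ⊥-elim (<⇒≢ (<-≤-trans (pairIndex-< i′<j′ j′<j) (m≤n+m (tri j) i)) (sym eq))

-- Nested layers of chords around a cell

module Layers
  {n : ℕ} {A : Set} (_≟_ : DecidableEquality A) (pos : Fin n → ℕ)
  (loᵥ hiᵥ : A → Fin n) (flag : A → Bool)
  (lo<hi : ∀ e → T (pos (loᵥ e) <ᵇ pos (hiᵥ e)))
  (coh : ∀ e f → T (coherent (flag e) (flag f) (pos (loᵥ e)) (pos (hiᵥ e)) (pos (loᵥ f)) (pos (hiᵥ f))))
  where

  open DecMembership _≟_ using (_∈?_)

  lo hi : A → ℕ
  lo e = pos (loᵥ e)
  hi e = pos (hiᵥ e)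

  covers : A → Fin n → Bool
  covers e z = cap (flag e) (lo e) (hi e) (pos z)

  end : A → Fin n
  end e = endOf (flag e) (loᵥ e) (hiᵥ e)

  pos-end : ∀ e → pos (end e) ≡ endOf (flag e) (lo e) (hi e)
  pos-end e with flag e
  ... | true  = refl
  ... | false = refl

  Crosses : A → A → Set
  Crosses e f = T (interleave (lo e) (hi e) (lo f) (hi f))

  Covering : List A → Set
  Covering C = ∀ z → ∃[ e ] e ∈ C × T (covers e z)

  Private : (A → Set) → A → Set
  Private C f = ∃[ z ] T (covers f z) × (∀ {e} → C e → T (covers e z) → e ≡ f)

  -- `crossing` ranges over all of `F` and not only over `C`: it provides the consecutive crossings
  -- within the layer as well as crossings with every layer that is taken from the rest of `F`.
  record Layer (F C : List A) : Set where
    field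
      ⊆F       : ∀ {e} → e ∈ C → e ∈ F
      covering : Covering C
      crossing : ∀ {e f} → e ∈ C → f ∈ F → T (covers f (end e)) → Crosses e f
      owns : ∀ {f} → f ∈ C → Private (_∈ C) f

  size : A → ℕ
  size e = ∣ covers e ∣ᵇ

  end∉ : ∀ e → ¬ T (covers e (end e))
  end∉ e p = not-elim (end∉cap (flag e) (lo e) (hi e) (lo<hi e))
    (subst (λ v → T (cap (flag e) (lo e) (hi e) v)) (pos-end e) p)

  cross-or-⊆ : ∀ e f → T (covers f (end e)) → Crosses e f ⊎ (∀ z → T (covers e z) → T (covers f z))
  cross-or-⊆ e f p with T-dec (interleave (lo e) (hi e) (lo f) (hi f))
  ... | inj₁ c  = inj₁ c
  ... | inj₂ ¬c = inj₂ λ z → cap-⊆ (flag e) (flag f) (lo e) (hi e) (lo f) (hi f) (pos z) (lo<hi e) (lo<hi f)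
    (coh e f) (subst (λ v → T (cap (flag f) (lo f) (hi f) v)) (pos-end e) p) ¬c

  -- If the chords did not cross, the cap of `f` would contain that of `e` and also the end of `e`,
  -- hence would be a larger cap at `z`.
  maximal-crosses : ∀ {F e} z → T (covers e z) → (∀ {f} → f ∈ F → T (covers f z) → size f ≤ size e) →
                    ∀ {f} → f ∈ F → T (covers f (end e)) → Crosses e f
  maximal-crosses {e = e} z ez max {f} f∈ p with cross-or-⊆ e f p
  ... | inj₁ c = c
  ... | inj₂ e⊆f = ⊥-elim (<⇒≱ (∣∣-strict e⊆f (end e) p (end∉ e)) (max f∈ (e⊆f z ez)))

  -- Greedy passage to a minimal cover: the head of `rest` is dropped if the others still cover
  -- everything, and otherwise a vertex they miss becomes private to it. Privacy is stated relative
  -- to `kept` and `rest` together, so it survives because this union never grows.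
  minimise : ∀ kept rest →
    (∀ z → ∃[ e ] (e ∈ kept ⊎ e ∈ rest) × T (covers e z)) →
    (∀ {f} → f ∈ kept → Private (λ e → e ∈ kept ⊎ e ∈ rest) f) →
    ∃[ C ] (∀ {e} → e ∈ C → e ∈ kept ⊎ e ∈ rest) × Covering C × (∀ {f} → f ∈ C → Private (_∈ C) f)
  minimise kept [] cov priv = kept , inj₁ ,
    (λ z → case cov z of λ { (e , inj₁ e∈ , p) → e , e∈ , p }) ,
    (λ f∈ → let z , p , h = priv f∈ in z , p , λ e∈ → h (inj₁ e∈))
  minimise kept (e ∷ rest) cov priv with search covered?
    where
    covered? : ∀ z → (∀ {f} → f ∈ kept ⊎ f ∈ rest → ¬ T (covers f z)) ⊎
                     (∃[ f ] (f ∈ kept ⊎ f ∈ rest) × T (covers f z))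
    covered? z with any-dec (λ f → covers f z) kept | any-dec (λ f → covers f z) rest
    ... | inj₁ (f , f∈ , p) | _                 = inj₂ (f , inj₁ f∈ , p)
    ... | inj₂ _            | inj₁ (f , f∈ , p) = inj₂ (f , inj₂ f∈ , p)
    ... | inj₂ ¬k           | inj₂ ¬r           = inj₁ [ ¬k , ¬r ]′
  ... | inj₂ cov′ = let C , sub , rest′ = minimise kept rest cov′ priv′ in
    C , (λ f∈ → weaken (sub f∈)) , rest′
    where
    weaken : ∀ {f} → f ∈ kept ⊎ f ∈ rest → f ∈ kept ⊎ f ∈ e ∷ rest
    weaken (inj₁ f∈) = inj₁ f∈
    weaken (inj₂ f∈) = inj₂ (there f∈)
    priv′ : ∀ {f} → f ∈ kept → Private (λ e → e ∈ kept ⊎ e ∈ rest) f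
    priv′ f∈ = let z , p , h = priv f∈ in z , p , λ g∈ → h (weaken g∈)
  ... | inj₁ (z , ¬cov) = let C , sub , rest′ = minimise (e ∷ kept) rest cov′ priv′ in
    C , (λ f∈ → shift (sub f∈)) , rest′
    where
    shift : ∀ {f} → f ∈ e ∷ kept ⊎ f ∈ rest → f ∈ kept ⊎ f ∈ e ∷ rest
    shift (inj₁ (here refl)) = inj₂ (here refl)
    shift (inj₁ (there f∈))  = inj₁ f∈
    shift (inj₂ f∈)          = inj₂ (there f∈)
    unshift : ∀ {f} → f ∈ kept ⊎ f ∈ e ∷ rest → f ∈ e ∷ kept ⊎ f ∈ rest
    unshift (inj₁ f∈)          = inj₁ (there f∈)
    unshift (inj₂ (here refl)) = inj₁ (here refl)
    unshift (inj₂ (there f∈))  = inj₂ f∈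
    cov′ : ∀ z → ∃[ f ] (f ∈ e ∷ kept ⊎ f ∈ rest) × T (covers f z)
    cov′ z = let f , f∈ , p = cov z in f , unshift f∈ , p
    only : ∀ {f} → f ∈ e ∷ kept ⊎ f ∈ rest → T (covers f z) → f ≡ e
    only (inj₁ (here refl)) _ = refl
    only (inj₁ (there f∈))  p = ⊥-elim (¬cov (inj₁ f∈) p)
    only (inj₂ f∈)          p = ⊥-elim (¬cov (inj₂ f∈) p)
    ez : T (covers e z)
    ez = let f , f∈ , p = cov z in subst (λ f → T (covers f z)) (only (unshift f∈) p) p
    priv′ : ∀ {f} → f ∈ e ∷ kept → Private (λ g → g ∈ e ∷ kept ⊎ g ∈ rest) f
    priv′ (here refl) = z , ez , only
    priv′ (there f∈)  = let z , p , h = priv f∈ in z , p , λ g∈ → h (shift g∈)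

  largest : ∀ F → Covering F → ∀ z →
    ∃[ e ] e ∈ F × T (covers e z) × (∀ {f} → f ∈ F → T (covers f z) → size f ≤ size e)
  largest F cov z with maximal size (λ e → covers e z) F
  ... | inj₁ none = let e , e∈ , p = cov z in ⊥-elim (none e∈ p)
  ... | inj₂ m    = m

  layer : ∀ F → Covering F → ∃[ C ] Layer F C
  layer F cov = C , record
    { ⊆F       = λ e∈ → proj₁ (chosen (sub e∈))
    ; covering = covC
    ; crossing = λ e∈ → proj₂ (chosen (sub e∈))
    ; owns = priv }
    where
    best : Fin n → A
    best z = proj₁ (largest F cov z)
    minimal = minimise [] (List.tabulate best)
      (λ z → best z , inj₂ (∈-tabulate⁺ z) , proj₁ (proj₂ (proj₂ (largest F cov z)))) (λ ())
    C    = proj₁ minimal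
    sub  = proj₁ (proj₂ minimal)
    covC = proj₁ (proj₂ (proj₂ minimal))
    priv = proj₂ (proj₂ (proj₂ minimal))
    chosen : ∀ {e} → e ∈ [] ⊎ e ∈ List.tabulate best →
             e ∈ F × (∀ {f} → f ∈ F → T (covers f (end e)) → Crosses e f)
    chosen (inj₂ e∈) with ∈-tabulate⁻ e∈
    ... | z , refl = let e , e∈F , p , max = largest F cov z in e∈F , maximal-crosses z p max

  module _ {F C : List A} (L : Layer F C) where
    open Layer L

    capOf : A → ℕ → Bool
    capOf e = cap (flag e) (lo e) (hi e)

    endPos : A → ℕ
    endPos e = endOf (flag e) (lo e) (hi e)

    own : ∀ {e} → e ∈ C → ℕ
    own m = pos (proj₁ (owns m))

    own∈ : ∀ {e} (m : e ∈ C) → T (capOf e (own m))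
    own∈ m = proj₁ (proj₂ (owns m))

    own∉ : ∀ {e f} (m : e ∈ C) → f ∈ C → f ≢ e → ¬ T (capOf f (own m))
    own∉ m k f≢e p = f≢e (proj₂ (proj₂ (owns m)) k p)

    own≢ : ∀ {e f v} (m : e ∈ C) → f ∈ C → f ≢ e → T (capOf f v) → own m ≢ v
    own≢ {f = f} m k f≢e p eq = own∉ m k f≢e (subst (T ∘ capOf f) (sym eq) p)

    module _ {z : Fin n} where

      RightOf LeftOf : ∀ {e} → e ∈ C → Set
      RightOf {e} m = T (cyclic (pos z) (own m) (endPos e))
      LeftOf  {e} m = T (cyclic (own m) (pos z) (endPos e))

      side : ∀ {e f} (m : e ∈ C) → f ∈ C → f ≢ e → T (covers e z) → T (covers f z) → RightOf m ⊎ LeftOf m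
      side {e} m k f≢e ez fz = ∨-elim (cyclic-or (pos z) (own m) (endPos e)
        (own≢ m k f≢e fz ∘ sym) (≢end (own∈ m)) (≢end ez))
        where
        ≢end : ∀ {v} → T (capOf e v) → v ≢ endPos e
        ≢end p eq = not-elim (end∉cap (flag e) (lo e) (hi e) (lo<hi e)) (subst (T ∘ capOf e) eq p)

      order : ∀ {e f} (m : e ∈ C) (k : f ∈ C) → f ≢ e → T (covers e z) → T (covers f z) →
              T (cyclic (own m) (own k) (pos z)) ⊎ T (cyclic (own k) (own m) (pos z))
      order m k f≢e ez fz = ∨-elim (cyclic-or (own m) (own k) (pos z)
        (own≢ m k f≢e (own∈ k)) (own≢ k m (f≢e ∘ sym) ez) (own≢ m k f≢e fz))

      -- Of two private vertices that are reached upwards from `z` inside their caps, the nearer one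
      -- lies on the way to the farther one, hence in the cap of the other chord.
      not-both-right : ∀ {e f} (m : e ∈ C) (k : f ∈ C) → f ≢ e → T (covers e z) → T (covers f z) →
                       RightOf m → ¬ RightOf k
      not-both-right {e} {f} m k f≢e ez fz r r′ with order m k f≢e ez fz
      ... | inj₁ c = own∉ m k f≢e (cap-arcʳ (flag f) (lo f) (hi f) (pos z) (own k) (own m)
        (lo<hi f) fz (own∈ k) r′ (cyclic-rotate (own k) (pos z) (own m) (cyclic-rotate (own m) (own k) (pos z) c)))
      ... | inj₂ c = own∉ k m (f≢e ∘ sym) (cap-arcʳ (flag e) (lo e) (hi e) (pos z) (own m) (own k)
        (lo<hi e) ez (own∈ m) r (cyclic-rotate (own m) (pos z) (own k) (cyclic-rotate (own k) (own m) (pos z) c)))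

      not-both-left : ∀ {e f} (m : e ∈ C) (k : f ∈ C) → f ≢ e → T (covers e z) → T (covers f z) →
                      LeftOf m → ¬ LeftOf k
      not-both-left {e} {f} m k f≢e ez fz l l′ with order m k f≢e ez fz
      ... | inj₁ c = own∉ k m (f≢e ∘ sym) (cap-arcʳ (flag e) (lo e) (hi e) (own m) (pos z) (own k)
        (lo<hi e) (own∈ m) ez l c)
      ... | inj₂ c = own∉ m k f≢e (cap-arcʳ (flag f) (lo f) (hi f) (own k) (pos z) (own m)
        (lo<hi f) (own∈ k) fz l′ c)

      -- Seen from a common point of three caps, two of the private vertices
      -- lie on the same side.

      at-most-two : ∀ {e f g} → e ∈ C → f ∈ C → g ∈ C → e ≢ f → f ≢ g → e ≢ g →
                    T (covers e z) → T (covers f z) → ¬ T (covers g z)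
      at-most-two m k l e≢f f≢g e≢g ez fz gz
        with side m k (e≢f ∘ sym) ez fz | side k m e≢f fz ez | side l m e≢g gz ez
      ... | inj₁ a | inj₁ b | _      = not-both-right m k (e≢f ∘ sym) ez fz a b
      ... | inj₁ a | inj₂ _ | inj₁ c = not-both-right m l (e≢g ∘ sym) ez gz a c
      ... | inj₁ _ | inj₂ b | inj₂ c = not-both-left k l (f≢g ∘ sym) fz gz b c
      ... | inj₂ _ | inj₁ b | inj₁ c = not-both-right k l (f≢g ∘ sym) fz gz b c
      ... | inj₂ a | inj₁ _ | inj₂ c = not-both-left m l (e≢g ∘ sym) ez gz a c
      ... | inj₂ a | inj₂ b | _      = not-both-left m k (e≢f ∘ sym) ez fz a b

    distance : ∀ {f} → f ∈ C → A → ℕ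
    distance m e = ∣ (λ z → arc (endPos e) (own m) (pos z)) ∣ᵇ

    closer : ∀ {f} (m : f ∈ C) e e′ → T (covers e′ (end e)) → T (not (capOf e′ (own m))) →
             distance m e′ < distance m e
    closer m e e′ p ¬q = ∣∣-strict
      (λ z → arc-⊆ (flag e′) (lo e′) (hi e′) (endPos e) (own m) (pos z) (lo<hi e′) p′ ¬q)
      (end e) (subst (λ v → T (arc (endPos e) (own m) v)) (sym (pos-end e)) (proj₁ both))
      (subst (λ v → ¬ T (arc (endPos e′) (own m) v)) (sym (pos-end e)) (not-elim (proj₂ both)))
      where
      p′ : T (capOf e′ (endPos e))
      p′ = subst (T ∘ capOf e′) (pos-end e) p
      both = ∧-elim {arc (endPos e) (own m) (endPos e)}
        (arc-∌ (flag e′) (lo e′) (hi e′) (endPos e) (own m) (lo<hi e′) p′ ¬q)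

    -- Walking upwards from cap to cap, the distance to the private vertex
    -- of the target decreases until the target is reached.

    path : ∀ {f} (m : f ∈ C) {g} → Crosses f g → ∀ d {e} → e ∈ C → distance m e < d →
      ∃[ l ] Linked Crosses (e ∷ l ++ [ g ]) × Unique (e ∷ l) × All (_∈ C) (e ∷ l) ×
        All (λ h → h ≡ f ⊎ distance m h ≤ distance m e) (e ∷ l)
    path {f} m {g} fg (suc d) {e} k (s≤s h) with e ≟ f
    ... | yes refl = [] , fg ∷ [-] , [] ∷ [] , k ∷ [] , inj₁ refl ∷ []
    ... | no e≢f with covering (end e)
    ...   | e′ , k′ , p with T-dec (capOf e′ (own m))
    -- A cap of the layer that contains the private vertex of `f` is the cap of `f` itself, so the
    -- target is reached.
    ...     | inj₁ q with proj₂ (proj₂ (owns m)) k′ q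
    ...       | refl = f ∷ [] , crossing k (⊆F k′) p ∷ fg ∷ [-] , (e≢f ∷ []) ∷ [] ∷ [] ,
      k ∷ k′ ∷ [] , inj₂ ≤-refl ∷ inj₁ refl ∷ []
    path {f} m {g} fg (suc d) {e} k (s≤s h) | no e≢f | e′ , k′ , p | inj₂ ¬q
      with path m fg d k′ (<-≤-trans (closer m e e′ p ¬q) h)
    ... | l , link , u , all , near = e′ ∷ l , crossing k (⊆F k′) p ∷ link ,
      All.map fresh near ∷ u , k ∷ all , inj₂ ≤-refl ∷ All.map later near
      where
      -- The last list in the result of `path` serves this purpose: everything after `e` is the
      -- target or at most as far as `e′`, which is strictly closer than `e`, so `e` cannot recur.
      fresh : ∀ {x} → x ≡ f ⊎ distance m x ≤ distance m e′ → e ≢ x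
      fresh (inj₁ refl) eq   = e≢f eq
      fresh (inj₂ x≤e′) refl = <⇒≱ (closer m e e′ p ¬q) x≤e′
      later : ∀ {x} → x ≡ f ⊎ distance m x ≤ distance m e′ → x ≡ f ⊎ distance m x ≤ distance m e
      later (inj₁ eq)   = inj₁ eq
      later (inj₂ x≤e′) = inj₂ (≤-trans x≤e′ (<⇒≤ (closer m e e′ p ¬q)))

  -- Peeling off layers

  remove : List A → List A → List A
  remove C F = filter (λ e → ¬? (e ∈? C)) F

  keep : List A → List A → List A
  keep C F = filter (λ e → e ∈? C) F

  count-remove : ∀ q C F → count q F ≡ count q (remove C F) + count q (keep C F)
  count-remove q C []      = refl
  count-remove q C (e ∷ F) with e ∈? C
  ... | yes _ = trans (cong (𝟙 (q e) +_) (trans (count-remove q C F) (+-comm (count q (remove C F)) _)))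
    (trans (sym (+-assoc (𝟙 (q e)) _ _)) (+-comm (𝟙 (q e) + count q (keep C F)) _))
  ... | no _  = trans (cong (𝟙 (q e) +_) (count-remove q C F)) (sym (+-assoc (𝟙 (q e)) _ _))

  -- What is lost at `z` is counted in `keep C F`, which inherits from `F` that it has no
  -- repetitions; three counted chords would be distinct members of `C` and contradict
  -- `at-most-two`.
  layer-thin : ∀ {F C} → Unique F → Layer F C → ∀ z →
               count (λ e → covers e z) F ≤ count (λ e → covers e z) (remove C F) + 2
  layer-thin {F} {C} u L z with 3 ≤? count (λ e → covers e z) (keep C F)
  ... | no ¬3 = ≤-trans (≤-reflexive (count-remove (λ e → covers e z) C F))
    (+-monoʳ-≤ (count (λ e → covers e z) (remove C F)) (≤-pred (≰⇒> ¬3)))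
  ... | yes 3≤ with count-three (Uniq.filter⁺ (λ e → e ∈? C) u) 3≤
  ...   | e , f , g , (e∈ , ez) , (f∈ , fz) , (g∈ , gz) , e≢f , f≢g , e≢g =
    ⊥-elim (at-most-two L (inC e∈) (inC f∈) (inC g∈) e≢f f≢g e≢g ez fz gz)
    where
    inC : ∀ {e} → e ∈ keep C F → e ∈ C
    inC e∈ = proj₂ (∈-filter⁻ (λ e → e ∈? C) {xs = F} e∈)

  record Nested (N : ℕ) (F : List A) : Set where
    field
      layerAt  : Fin N → List A
      ⊆F       : ∀ i {e} → e ∈ layerAt i → e ∈ F
      isLayer  : ∀ i → ∃[ F′ ] Layer F′ (layerAt i)
      disjoint : ∀ i j → toℕ i < toℕ j → ∀ {e} → e ∈ layerAt i → e ∉ layerAt j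
      meets    : ∀ i j → toℕ i < toℕ j → ∀ {e} → e ∈ layerAt i → ∃[ f ] f ∈ layerAt j × Crosses e f

  none : ∀ {F} → Nested 0 F
  none = record { layerAt = λ () ; ⊆F = λ () ; isLayer = λ () ; disjoint = λ () ; meets = λ () }

  add-layer : ∀ {N F C} → Layer F C → Nested N (remove C F) → Nested (suc N) F
  add-layer {N} {F} {C} L R = record
    { layerAt = at ; ⊆F = sub ; isLayer = isL ; disjoint = disj ; meets = meet }
    where
    open Nested R
    at : Fin (suc N) → List A
    at zero    = C
    at (suc i) = layerAt i
    removed : ∀ i {e} → e ∈ layerAt i → e ∈ F × e ∉ C
    removed i e∈ = ∈-filter⁻ (λ e → ¬? (e ∈? C)) {xs = F} (⊆F i e∈)
    sub : ∀ i {e} → e ∈ at i → e ∈ F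
    sub zero    = Layer.⊆F L
    sub (suc i) = proj₁ ∘ removed i
    isL : ∀ i → ∃[ F′ ] Layer F′ (at i)
    isL zero    = F , L
    isL (suc i) = isLayer i
    disj : ∀ i j → toℕ i < toℕ j → ∀ {e} → e ∈ at i → e ∉ at j
    disj zero    (suc j) _         e∈ e∈′ = proj₂ (removed j e∈′) e∈
    disj (suc i) (suc j) (s≤s i<j) = disjoint i j i<j
    meet : ∀ i j → toℕ i < toℕ j → ∀ {e} → e ∈ at i → ∃[ f ] f ∈ at j × Crosses e f
    -- A later layer covers every vertex, in particular the end of `e`, and the chord that covers it
    -- there still belongs to `F`.
    meet zero    (suc j) _ {e} e∈ =
      let f , f∈ , p = Layer.covering (proj₂ (isLayer j)) (end e)
      in f , f∈ , Layer.crossing L e∈ (proj₁ (removed j f∈)) p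
    meet (suc i) (suc j) (s≤s i<j) = meets i j i<j

  -- Every layer costs a vertex at most two caps, but the last one only needs a single cap to exist:
  -- `suc M` layers require `2 (suc M) − 1` caps.
  nested : ∀ M F → Unique F → (∀ z → suc (M + M) ≤ count (λ e → covers e z) F) → Nested (suc M) F
  nested M F u h with layer F (λ z → count-∈ (λ e → covers e z) F (≤-trans (s≤s z≤n) (h z)))
  nested zero    F u h | C , L = add-layer L none
  nested (suc M) F u h | C , L = add-layer L (nested M (remove C F)
    (Uniq.filter⁺ (λ e → ¬? (e ∈? C)) u)
    λ z → +-cancelʳ-≤ 2 _ _ (≤-trans (≤-reflexive (arith M)) (≤-trans (h z) (layer-thin u L z))))
    where
    arith : ∀ M → suc (M + M) + 2 ≡ suc (suc M + suc M)
    arith M = cong suc (trans (+-comm (M + M) 2) (cong suc (sym (+-suc M M))))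

  -- The topological minor

  interleave-sym : ∀ {e f} → Crosses e f → Crosses f e
  interleave-sym {e} {f} = by-order (interleaveᶠ ⟨0⟩ ⟨1⟩ ⟨2⟩ ⟨3⟩ ∷ [])
    (interleaveᶠ ⟨2⟩ ⟨3⟩ ⟨0⟩ ⟨1⟩) (lo e ∷ hi e ∷ lo f ∷ hi f ∷ [])

  -- Branch edges are taken from the first t layers, and the pair i < j is
  -- routed through the layer with index t + pairIndex i j.

  module Minor (_~_ : A → A → Set) (cross⇒~ : ∀ {e f} → Crosses e f → e ~ f)
               {t : ℕ} {F : List A} (S : Nested (t + tri t) F) (z₀ : Fin n) where
    open Nested S

    inner : Fin t → Fin (t + tri t)
    inner i = i ↑ˡ tri t

    outer : ∀ {i j : Fin t} → toℕ i < toℕ j → Fin (t + tri t)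
    outer {i} {j} i<j = t ↑ʳ fromℕ< (pairIndex-< i<j (toℕ<n j))

    inner<outer : ∀ k {i j : Fin t} (i<j : toℕ i < toℕ j) → toℕ (inner k) < toℕ (outer {i} {j} i<j)
    inner<outer k i<j = subst₂ _<_ (sym (toℕ-↑ˡ k (tri t))) (sym (toℕ-↑ʳ t _))
      (<-≤-trans (toℕ<n k) (m≤m+n t _))

    -- The vertex `z₀` guarantees that the layer, which covers it, has a member.
    branch : Fin t → A
    branch i = proj₁ (Layer.covering (proj₂ (isLayer (inner i))) z₀)

    branch∈ : ∀ i → branch i ∈ layerAt (inner i)
    branch∈ i = proj₁ (proj₂ (Layer.covering (proj₂ (isLayer (inner i))) z₀))

    distinct-layers : ∀ {i j e} → toℕ i ≢ toℕ j → e ∈ layerAt i → e ∉ layerAt j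
    distinct-layers {i} {j} i≢j e∈ e∈′ with <-cmp (toℕ i) (toℕ j)
    ... | tri< i<j _ _ = disjoint i j i<j e∈ e∈′
    ... | tri≈ _ i≡j _ = i≢j i≡j
    ... | tri> _ _ j<i = disjoint j i j<i e∈′ e∈

    branch-injective : ∀ {i j} → branch i ≡ branch j → i ≡ j
    branch-injective {i} {j} eq with i Fin.≟ j
    ... | yes i≡j = i≡j
    ... | no i≢j  = ⊥-elim (distinct-layers
      (λ eq′ → i≢j (toℕ-injective (trans (sym (toℕ-↑ˡ i (tri t))) (trans eq′ (toℕ-↑ˡ j (tri t))))))
      (branch∈ i) (subst (_∈ layerAt (inner j)) (sym eq) (branch∈ j)))

    route : ∀ {i j : Fin t} (i<j : toℕ i < toℕ j) → ∃[ p ]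
      Linked _~_ (branch i ∷ p ++ [ branch j ]) × Unique (branch i ∷ p ++ [ branch j ]) ×
      All (_∈ layerAt (outer {i} {j} i<j)) p
    route {i} {j} i<j =
      let f , f∈ , if = meets (inner i) k (inner<outer i {i} {j} i<j) (branch∈ i)
          g , g∈ , jg = meets (inner j) k (inner<outer j {i} {j} i<j) (branch∈ j)
          L           = proj₂ (isLayer k)
          l , link , uniq , all , _ = path L g∈ (interleave-sym {branch j} {g} jg) _ f∈ ≤-refl
      in f ∷ l , Linked.map (λ {e} {f} → cross⇒~ {e} {f}) (if ∷ link) ,
         All.tabulate (away i<j (f ∷ l) all) ∷
           Uniq.++⁺ uniq ([] ∷ []) (λ { (x∈ , here refl) → off j (All.lookup all x∈) }) ,
         all
      where
      k = outer {i} {j} i<j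
      off : ∀ m → branch m ∉ layerAt k
      off m = disjoint (inner m) k (inner<outer m {i} {j} i<j) (branch∈ m)
      away : toℕ i < toℕ j → ∀ p → All (_∈ layerAt k) p → ∀ {x} → x ∈ p ++ [ branch j ] → branch i ≢ x
      away i<j p all x∈ eq with ∈-++⁻ p x∈
      ... | inj₁ x∈p         = off i (subst (_∈ layerAt k) (sym eq) (All.lookup all x∈p))
      ... | inj₂ (here refl) = <⇒≢ i<j (cong toℕ (branch-injective eq))

    mid : ∀ i j → Dec (toℕ i < toℕ j) → List A
    mid i j (yes i<j) = proj₁ (route {i} {j} i<j)
    mid i j (no _)    = []

    mid∈ : ∀ {i j} d (i<j : toℕ i < toℕ j) {x} → x ∈ mid i j d →
           ∃[ k ] toℕ k ≡ t + pairIndex (toℕ i) (toℕ j) × x ∈ layerAt k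
    mid∈ {i} {j} (yes i<j) _ x∈ = outer {i} {j} i<j ,
      trans (toℕ-↑ʳ t _) (cong (t +_) (toℕ-fromℕ< _)) ,
      All.lookup (proj₂ (proj₂ (proj₂ (route {i} {j} i<j)))) x∈
    mid∈ (no ¬i<j) i<j _ = ⊥-elim (¬i<j i<j)

    minor : HasTopologicalMinor (record { V = A ; _~_ = _~_ }) t
    minor = branch , (λ i j → mid i j (toℕ i <? toℕ j)) , branch-injective ,
      (λ i j → joins i j (toℕ i <? toℕ j)) ,
      λ i j i′ j′ i<j i′<j′ ne x x∈ x∈′ →
        let k  , eq  , x∈k  = mid∈ (toℕ i <? toℕ j) i<j x∈
            k′ , eq′ , x∈k′ = mid∈ (toℕ i′ <? toℕ j′) i′<j′ x∈′
        in distinct-layers (λ e → ne (pairs e eq eq′ i<j i′<j′)) x∈k x∈k′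
      where
      joins : ∀ i j d → toℕ i < toℕ j →
        Linked _~_ (branch i ∷ mid i j d ++ [ branch j ]) ×
        Unique (branch i ∷ mid i j d ++ [ branch j ]) × (∀ k → branch k ∉ mid i j d)
      joins i j (no ¬i<j) i<j = ⊥-elim (¬i<j i<j)
      joins i j (yes i<j) _   = let p , link , uniq , all = route {i} {j} i<j in
        link , uniq , λ k k∈ → disjoint (inner k) _ (inner<outer k {i} {j} i<j) (branch∈ k) (All.lookup all k∈)
      pairs : ∀ {i j i′ j′ : Fin t} {k k′ : Fin (t + tri t)} → toℕ k ≡ toℕ k′ →
        toℕ k ≡ t + pairIndex (toℕ i) (toℕ j) → toℕ k′ ≡ t + pairIndex (toℕ i′) (toℕ j′) →
        toℕ i < toℕ j → toℕ i′ < toℕ j′ → (i , j) ≡ (i′ , j′)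
      pairs e eq eq′ i<j i′<j′ =
        let ei , ej = pairIndex-injective i<j i′<j′ (+-cancelˡ-≡ t _ _ (trans (sym eq) (trans e eq′)))
        in cong₂ _,_ (toℕ-injective ei) (toℕ-injective ej)

-- Tripods and the three arcs between their feet

_∩_ : ∀ {n} → (Fin n → Bool) → (Fin n → Bool) → Fin n → Bool
(f ∩ g) z = f z ∧ g z

-- Three arcs of the circle together with three legs leading from a common
-- cell to the three points between them; the leg S i ends opposite to the
-- arc A i.

record Tripod {n : ℕ} (R : Fin n → Fin n → Set) (s : ℕ) (W : Fin n → Bool) : Set where
  field
    A S       : Fin 3 → Fin n → Bool
    X         : Fin n → Bool
    ∣S∣≤      : ∀ i → ∣ S i ∣ᵇ ≤ s
    ∣X∣≤      : ∣ X ∣ᵇ ≤ 2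
    balanced  : ∀ i → ∣ W ∩ A i ∣ᵇ + ∣ W ∩ A i ∣ᵇ ≤ ∣ W ∣ᵇ
    disjoint  : ∀ {i j} → i ≢ j → ∀ z → T (A i z) → ¬ T (A j z)
    opposite  : ∀ i z → T (A i z) → ¬ T (S i z)
    exhaust   : ∀ z → (∃[ i ] T (A i z)) ⊎ (∃[ i ] T (S i z))
    separates : ∀ i {x y} → T (A i x) → ¬ T (A i y) → R x y →
                (∃[ j ] j ≢ i × (T (S j x) ⊎ T (S j y))) ⊎ (T (X x) ⊎ T (X y))

elem : ∀ {n} → Fin n → List (Fin n) → Bool
elem z []      = false
elem z (x ∷ l) = ⌊ z Fin.≟ x ⌋ ∨ elem z l

elem-∈ : ∀ {n} {z : Fin n} {l} → z ∈ l → T (elem z l)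
elem-∈ {z = z} (here refl) = ∨-introˡ {⌊ z Fin.≟ z ⌋} (fromWitness {a? = z Fin.≟ z} refl)
elem-∈ {z = z} {x ∷ _} (there z∈) = ∨-introʳ {⌊ z Fin.≟ x ⌋} (elem-∈ z∈)

∣elem∣≤length : ∀ {n} (l : List (Fin n)) → ∣ (λ z → elem z l) ∣ᵇ ≤ length l
∣elem∣≤length {n} []  = ≤-reflexive (∣∣-empty {n} {λ z → elem z []} λ _ ())
∣elem∣≤length (x ∷ l) = ≤-trans (∣∣-∪ (λ z → ⌊ z Fin.≟ x ⌋) (λ z → elem z l))
  (+-mono-≤ (∣∣-subsingleton {f = λ z → ⌊ z Fin.≟ x ⌋}
    λ y z p q → trans (toWitness {a? = y Fin.≟ x} p) (sym (toWitness {a? = z Fin.≟ x} q))) (∣elem∣≤length l))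

-- Meant for `u < v < w`: arc `i` joins the two points other than `point i`, so arc `⟨1⟩` is the one
-- that passes the cut of the circle.
arcOf : Fin 3 → ℕ → ℕ → ℕ → ℕ → Bool
arcOf ⟨0⟩ u v w z = (v <ᵇ z) ∧ (z <ᵇ w)
arcOf ⟨1⟩ u v w z = (z <ᵇ u) ∨ (w <ᵇ z)
arcOf ⟨2⟩ u v w z = (u <ᵇ z) ∧ (z <ᵇ v)

point : Fin 3 → ℕ → ℕ → ℕ → ℕ
point ⟨0⟩ u v w = u
point ⟨1⟩ u v w = v
point ⟨2⟩ u v w = w

arcOfᶠ : ∀ {k} → Fin 3 → Fin k → Fin k → Fin k → Fin k → Formula k
arcOfᶠ ⟨0⟩ u v w z = v ≺ z ∧ᶠ z ≺ w
arcOfᶠ ⟨1⟩ u v w z = z ≺ u ∨ᶠ w ≺ z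
arcOfᶠ ⟨2⟩ u v w z = u ≺ z ∧ᶠ z ≺ v

arc-disjoint : ∀ i j u v w z → T (u <ᵇ v) → T (v <ᵇ w) → i ≢ j → T (arcOf i u v w z) → ¬ T (arcOf j u v w z)
arc-disjoint i j u v w z p q i≢j a b = go i j i≢j a b
  where
  ρ = u ∷ v ∷ w ∷ z ∷ []
  go : ∀ i j → i ≢ j → T (arcOf i u v w z) → ¬ T (arcOf j u v w z)
  go ⟨0⟩ ⟨0⟩ ne = ⊥-elim (ne refl)
  go ⟨1⟩ ⟨1⟩ ne = ⊥-elim (ne refl)
  go ⟨2⟩ ⟨2⟩ ne = ⊥-elim (ne refl)
  go ⟨0⟩ ⟨1⟩ _ a = not-elim (by-order (⟨0⟩ ≺ ⟨1⟩ ∷ ⟨1⟩ ≺ ⟨2⟩ ∷ arcOfᶠ ⟨0⟩ ⟨0⟩ ⟨1⟩ ⟨2⟩ ⟨3⟩ ∷ [])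
    (¬ᶠ arcOfᶠ ⟨1⟩ ⟨0⟩ ⟨1⟩ ⟨2⟩ ⟨3⟩) ρ p q a)
  go ⟨0⟩ ⟨2⟩ _ a = not-elim (by-order (⟨0⟩ ≺ ⟨1⟩ ∷ ⟨1⟩ ≺ ⟨2⟩ ∷ arcOfᶠ ⟨0⟩ ⟨0⟩ ⟨1⟩ ⟨2⟩ ⟨3⟩ ∷ [])
    (¬ᶠ arcOfᶠ ⟨2⟩ ⟨0⟩ ⟨1⟩ ⟨2⟩ ⟨3⟩) ρ p q a)
  go ⟨1⟩ ⟨2⟩ _ a = not-elim (by-order (⟨0⟩ ≺ ⟨1⟩ ∷ ⟨1⟩ ≺ ⟨2⟩ ∷ arcOfᶠ ⟨1⟩ ⟨0⟩ ⟨1⟩ ⟨2⟩ ⟨3⟩ ∷ [])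
    (¬ᶠ arcOfᶠ ⟨2⟩ ⟨0⟩ ⟨1⟩ ⟨2⟩ ⟨3⟩) ρ p q a)
  go ⟨1⟩ ⟨0⟩ _ a b = go ⟨0⟩ ⟨1⟩ (λ ()) b a
  go ⟨2⟩ ⟨0⟩ _ a b = go ⟨0⟩ ⟨2⟩ (λ ()) b a
  go ⟨2⟩ ⟨1⟩ _ a b = go ⟨1⟩ ⟨2⟩ (λ ()) b a

point∉arc : ∀ i u v w → T (u <ᵇ v) → T (v <ᵇ w) → T (not (arcOf i u v w (point i u v w)))
point∉arc ⟨0⟩ u v w = by-order (⟨0⟩ ≺ ⟨1⟩ ∷ ⟨1⟩ ≺ ⟨2⟩ ∷ []) (¬ᶠ arcOfᶠ ⟨0⟩ ⟨0⟩ ⟨1⟩ ⟨2⟩ ⟨0⟩) (u ∷ v ∷ w ∷ [])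
point∉arc ⟨1⟩ u v w = by-order (⟨0⟩ ≺ ⟨1⟩ ∷ ⟨1⟩ ≺ ⟨2⟩ ∷ []) (¬ᶠ arcOfᶠ ⟨1⟩ ⟨0⟩ ⟨1⟩ ⟨2⟩ ⟨1⟩) (u ∷ v ∷ w ∷ [])
point∉arc ⟨2⟩ u v w = by-order (⟨0⟩ ≺ ⟨1⟩ ∷ ⟨1⟩ ≺ ⟨2⟩ ∷ []) (¬ᶠ arcOfᶠ ⟨2⟩ ⟨0⟩ ⟨1⟩ ⟨2⟩ ⟨2⟩) (u ∷ v ∷ w ∷ [])

arc-or-point : ∀ u v w z → (∃[ i ] T (arcOf i u v w z)) ⊎ (∃[ i ] z ≡ point i u v w)
arc-or-point u v w z with <-cmp z u | <-cmp z v | <-cmp z w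
... | tri< z<u _ _ | _ | _ = inj₁ (⟨1⟩ , ∨-introˡ (<⇒<ᵇ z<u))
... | tri≈ _ z≡u _ | _ | _ = inj₂ (⟨0⟩ , z≡u)
... | tri> _ _ u<z | tri< z<v _ _ | _ = inj₁ (⟨2⟩ , ∧-intro (<⇒<ᵇ u<z) (<⇒<ᵇ z<v))
... | tri> _ _ _ | tri≈ _ z≡v _ | _ = inj₂ (⟨1⟩ , z≡v)
... | tri> _ _ _ | tri> _ _ v<z | tri< z<w _ _ = inj₁ (⟨0⟩ , ∧-intro (<⇒<ᵇ v<z) (<⇒<ᵇ z<w))
... | tri> _ _ _ | tri> _ _ _ | tri≈ _ z≡w _ = inj₂ (⟨2⟩ , z≡w)
... | tri> _ _ _ | tri> _ _ _ | tri> _ _ w<z = inj₁ (⟨1⟩ , ∨-introʳ {z <ᵇ u} (<⇒<ᵇ w<z))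

-- A chord that joins different arcs separates two of the three points, so
-- its cap contains one of them.

next : Fin 3 → Fin 3
next ⟨0⟩ = ⟨1⟩
next ⟨1⟩ = ⟨2⟩
next ⟨2⟩ = ⟨0⟩

leaves : Fin 3 → ℕ → ℕ → ℕ → ℕ → ℕ → Bool
leaves i u v w x y = arcOf i u v w x ∧ not (arcOf i u v w y) ∧
  ((y <ᵇ p) ∨ (p <ᵇ y)) ∧ ((y <ᵇ q) ∨ (q <ᵇ y))
  where
  p = point (next i) u v w
  q = point (next (next i)) u v w

leavesᶠ : ∀ {k} → Fin 3 → Fin k → Fin k → Fin k → Fin k → Fin k → Formula k
leavesᶠ i u v w x y = arcOfᶠ i u v w x ∧ᶠ ¬ᶠ arcOfᶠ i u v w y ∧ᶠ
  (y ≺ p i ∨ᶠ p i ≺ y) ∧ᶠ (y ≺ q i ∨ᶠ q i ≺ y)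
  where
  p q : Fin 3 → _
  p ⟨0⟩ = v
  p ⟨1⟩ = w
  p ⟨2⟩ = u
  q ⟨0⟩ = w
  q ⟨1⟩ = u
  q ⟨2⟩ = v

leaves⇒cap : ∀ i o u v w lo hi → T (u <ᵇ v) → T (v <ᵇ w) → T (lo <ᵇ hi) →
  T (leaves i u v w lo hi ∨ leaves i u v w hi lo) →
  T (cap o lo hi (point (next i) u v w) ∨ cap o lo hi (point (next (next i)) u v w))
leaves⇒cap i o u v w lo hi = go i o
  where
  ρ = u ∷ v ∷ w ∷ lo ∷ hi ∷ []
  hyps : Fin 3 → List (Formula 5)
  hyps i = ⟨0⟩ ≺ ⟨1⟩ ∷ ⟨1⟩ ≺ ⟨2⟩ ∷ ⟨3⟩ ≺ ⟨4⟩ ∷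
    leavesᶠ i ⟨0⟩ ⟨1⟩ ⟨2⟩ ⟨3⟩ ⟨4⟩ ∨ᶠ leavesᶠ i ⟨0⟩ ⟨1⟩ ⟨2⟩ ⟨4⟩ ⟨3⟩ ∷ []
  go : ∀ i o → T (u <ᵇ v) → T (v <ᵇ w) → T (lo <ᵇ hi) →
    T (leaves i u v w lo hi ∨ leaves i u v w hi lo) →
    T (cap o lo hi (point (next i) u v w) ∨ cap o lo hi (point (next (next i)) u v w))
  go ⟨0⟩ true  = by-order (hyps ⟨0⟩) (capᶠ true  ⟨3⟩ ⟨4⟩ ⟨1⟩ ∨ᶠ capᶠ true  ⟨3⟩ ⟨4⟩ ⟨2⟩) ρ
  go ⟨0⟩ false = by-order (hyps ⟨0⟩) (capᶠ false ⟨3⟩ ⟨4⟩ ⟨1⟩ ∨ᶠ capᶠ false ⟨3⟩ ⟨4⟩ ⟨2⟩) ρ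
  go ⟨1⟩ true  = by-order (hyps ⟨1⟩) (capᶠ true  ⟨3⟩ ⟨4⟩ ⟨2⟩ ∨ᶠ capᶠ true  ⟨3⟩ ⟨4⟩ ⟨0⟩) ρ
  go ⟨1⟩ false = by-order (hyps ⟨1⟩) (capᶠ false ⟨3⟩ ⟨4⟩ ⟨2⟩ ∨ᶠ capᶠ false ⟨3⟩ ⟨4⟩ ⟨0⟩) ρ
  go ⟨2⟩ true  = by-order (hyps ⟨2⟩) (capᶠ true  ⟨3⟩ ⟨4⟩ ⟨0⟩ ∨ᶠ capᶠ true  ⟨3⟩ ⟨4⟩ ⟨1⟩) ρ
  go ⟨2⟩ false = by-order (hyps ⟨2⟩) (capᶠ false ⟨3⟩ ⟨4⟩ ⟨0⟩ ∨ᶠ capᶠ false ⟨3⟩ ⟨4⟩ ⟨1⟩) ρ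

next≢ : ∀ i → next i ≢ i
next≢ ⟨0⟩ ()
next≢ ⟨1⟩ ()
next≢ ⟨2⟩ ()

next²≢ : ∀ i → next (next i) ≢ i
next²≢ ⟨0⟩ ()
next²≢ ⟨1⟩ ()
next²≢ ⟨2⟩ ()

if-true : ∀ {A : Set} {c} {x y : A} → T c → (if c then x else y) ≡ x
if-true {c = true} _ = refl

if-false : ∀ {A : Set} {c} {x y : A} → T (not c) → (if c then x else y) ≡ y
if-false {c = false} _ = refl

even⇒xor : ∀ a b {c} → a xor b xor c ≡ false → a xor b ≡ c
even⇒xor true  true  {false} _ = refl
even⇒xor true  false {true}  _ = refl
even⇒xor false true  {true}  _ = refl
even⇒xor false false {false} _ = refl

-- Balanced tripods

module Drawn
  {n : ℕ} {E : Set} (pos : Fin n → ℕ) (pos-injective : ∀ {x y} → pos x ≡ pos y → x ≡ y) (pos<n : ∀ x → pos x < n)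
  (loᵥ hiᵥ : E → Fin n) (lo<hi : ∀ e → T (pos (loᵥ e) <ᵇ pos (hiᵥ e)))
  (R : Fin n → Fin n → Set)
  (edge : ∀ {x y} → R x y → ∃[ e ] ((loᵥ e ≡ x × hiᵥ e ≡ y) ⊎ (loᵥ e ≡ y × hiᵥ e ≡ x)))
  (ℓ : ℕ)
  where

  lo hi : E → ℕ
  lo e = pos (loᵥ e)
  hi e = pos (hiᵥ e)

  Touches : E → ℕ → Set
  Touches e a = lo e ≡ a ⊎ hi e ≡ a

  -- Chords with an end at a or b are exempt: neighbouring cells differ
  -- only on the chords at one vertex.

  Leg : (E → Bool) → ℕ → ℕ → ℕ → Set
  Leg flag a b p = ∃[ F ] length F ≤ ℓ ×
    (∀ e → T (cap (flag e) (lo e) (hi e) p) → e ∈ F ⊎ (Touches e a ⊎ Touches e b))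

  at : ℕ → Fin n → Bool
  at p z = pos z ≡ᵇ p

  ∣at∣≤1 : ∀ p → ∣ at p ∣ᵇ ≤ 1
  ∣at∣≤1 p = ∣∣-subsingleton {f = at p} λ x y px py →
    pos-injective (trans (≡ᵇ⇒≡ (pos x) p px) (sym (≡ᵇ⇒≡ (pos y) p py)))

  module _ (W : Fin n → Bool) (flag : E → Bool) (a b u v w : ℕ) (u<v : T (u <ᵇ v)) (v<w : T (v <ᵇ w))
           (legs : ∀ i → Leg flag a b (point i u v w))
           (bal : ∀ i → ∣ W ∩ (arcOf i u v w ∘ pos) ∣ᵇ + ∣ W ∩ (arcOf i u v w ∘ pos) ∣ᵇ ≤ ∣ W ∣ᵇ) where

    private
      arcs : Fin 3 → Fin n → Bool
      arcs i = arcOf i u v w ∘ pos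

      -- A leg has to avoid its opposite arc, so each of its chords contributes an end outside that
      -- arc. If both ends lie in the arc, the end picked is discarded in `leg`.
      pick : Fin 3 → E → Fin n
      pick i e = if arcs i (loᵥ e) then hiᵥ e else loᵥ e

      picks : Fin 3 → Fin n → Bool
      picks i z = elem z (map (pick i) (proj₁ (legs i)))

      leg : Fin 3 → Fin n → Bool
      leg i z = (at (point i u v w) z ∨ picks i z) ∧ not (arcs i z)

      exceptions : Fin n → Bool
      exceptions z = at a z ∨ at b z

      disj : ∀ {i j} → i ≢ j → ∀ z → T (arcs i z) → ¬ T (arcs j z)
      disj {i} {j} i≢j z = arc-disjoint i j u v w (pos z) u<v v<w i≢j

      at-leg : ∀ i z → pos z ≡ point i u v w → T (leg i z)
      at-leg i z eq = ∧-intro (∨-introˡ (≡⇒≡ᵇ (pos z) _ eq))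
        (subst (λ p → T (not (arcOf i u v w p))) (sym eq) (point∉arc i u v w u<v v<w))

      picked : ∀ i {e x} → e ∈ proj₁ (legs i) → pick i e ≡ x → T (at (point i u v w) x ∨ picks i x)
      picked i {x = x} e∈ eq = ∨-introʳ {at (point i u v w) x}
        (elem-∈ (subst (_∈ map (pick i) (proj₁ (legs i))) eq (∈-map⁺ (pick i) e∈)))

      pick-leg : ∀ i e → e ∈ proj₁ (legs i) → ¬ T (arcs i (loᵥ e)) ⊎ ¬ T (arcs i (hiᵥ e)) →
                 T (leg i (loᵥ e)) ⊎ T (leg i (hiᵥ e))
      pick-leg i e e∈ h with T-dec (arcs i (loᵥ e))
      ... | inj₂ ¬l = inj₁ (∧-intro (picked i e∈ (if-false ¬l)) ¬l)
      ... | inj₁ l  = inj₂ (∧-intro (picked i e∈ (if-true l)) (not-intro ([ (λ ¬l → ⊥-elim (¬l l)) , id ]′ h)))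

      leaving : ∀ i {x y} e → (loᵥ e ≡ x × hiᵥ e ≡ y) ⊎ (loᵥ e ≡ y × hiᵥ e ≡ x) →
        T (arcs i x) → T (leaves i u v w (pos x) (pos y)) →
        (∃[ j ] j ≢ i × (T (leg j (loᵥ e)) ⊎ T (leg j (hiᵥ e)))) ⊎
        (T (exceptions (loᵥ e)) ⊎ T (exceptions (hiᵥ e)))
      leaving i {x} {y} e ends ax lv with ∨-elim (leaves⇒cap i (flag e) u v w (lo e) (hi e) u<v v<w (lo<hi e) (lv′ ends))
        where
        lv′ : (loᵥ e ≡ x × hiᵥ e ≡ y) ⊎ (loᵥ e ≡ y × hiᵥ e ≡ x) →
          T (leaves i u v w (lo e) (hi e) ∨ leaves i u v w (hi e) (lo e))
        lv′ (inj₁ (refl , refl)) = ∨-introˡ lv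
        lv′ (inj₂ (refl , refl)) = ∨-introʳ {leaves i u v w (lo e) (hi e)} lv
      ... | c = [ through (next i) (next≢ i) , through (next (next i)) (next²≢ i) ]′ c
        where
        -- The end `x` lies in arc `i`, hence outside arc `j`; so a chord on leg `j` does contribute
        -- one of its ends.
        off : ∀ j → j ≢ i → (loᵥ e ≡ x × hiᵥ e ≡ y) ⊎ (loᵥ e ≡ y × hiᵥ e ≡ x) →
              ¬ T (arcs j (loᵥ e)) ⊎ ¬ T (arcs j (hiᵥ e))
        off j j≢i (inj₁ (refl , refl)) = inj₁ (disj (j≢i ∘ sym) x ax)
        off j j≢i (inj₂ (refl , refl)) = inj₂ (disj (j≢i ∘ sym) x ax)
        exceptional : ∀ {p} (q : Fin n → Bool) → (∀ z → pos z ≡ p → T (q z)) → Touches e p →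
                      T (q (loᵥ e)) ⊎ T (q (hiᵥ e))
        exceptional q h (inj₁ eq) = inj₁ (h _ eq)
        exceptional q h (inj₂ eq) = inj₂ (h _ eq)
        through : ∀ j → j ≢ i → T (cap (flag e) (lo e) (hi e) (point j u v w)) →
          (∃[ j ] j ≢ i × (T (leg j (loᵥ e)) ⊎ T (leg j (hiᵥ e)))) ⊎
          (T (exceptions (loᵥ e)) ⊎ T (exceptions (hiᵥ e)))
        through j j≢i c with proj₂ (proj₂ (legs j)) e c
        ... | inj₁ e∈ = inj₁ (j , j≢i , pick-leg j e e∈ (off j j≢i ends))
        ... | inj₂ (inj₁ t) = inj₂ (exceptional exceptions (λ z eq → ∨-introˡ (≡⇒≡ᵇ (pos z) a eq)) t)
        ... | inj₂ (inj₂ t) = inj₂ (exceptional exceptions (λ z eq → ∨-introʳ {at a z} (≡⇒≡ᵇ (pos z) b eq)) t)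

      sep : ∀ i {x y} → T (arcs i x) → ¬ T (arcs i y) → R x y →
            (∃[ j ] j ≢ i × (T (leg j x) ⊎ T (leg j y))) ⊎ (T (exceptions x) ⊎ T (exceptions y))
      sep i {x} {y} ax ¬ay r with pos y ≟ point (next i) u v w | pos y ≟ point (next (next i)) u v w
      ... | yes eq | _ = inj₁ (next i , next≢ i , inj₂ (at-leg (next i) y eq))
      ... | no _ | yes eq = inj₁ (next (next i) , next²≢ i , inj₂ (at-leg (next (next i)) y eq))
      ... | no ne | no ne′ with edge r
      ...   | e , ends with ends | leaving i e ends ax (∧-intro ax (∧-intro (not-intro ¬ay) (∧-intro (≢⇒≶ ne) (≢⇒≶ ne′))))
      ...     | inj₁ (refl , refl) | res = res
      ...     | inj₂ (refl , refl) | inj₁ (j , j≢i , inj₁ p) = inj₁ (j , j≢i , inj₂ p)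
      ...     | inj₂ (refl , refl) | inj₁ (j , j≢i , inj₂ p) = inj₁ (j , j≢i , inj₁ p)
      ...     | inj₂ (refl , refl) | inj₂ (inj₁ p) = inj₂ (inj₂ p)
      ...     | inj₂ (refl , refl) | inj₂ (inj₂ p) = inj₂ (inj₁ p)

    tripod : Tripod R (suc ℓ) W
    tripod = record
      { A = arcs
      ; S = leg
      ; X = exceptions
      ; ∣S∣≤ = size
      ; ∣X∣≤ = ≤-trans (∣∣-∪ (at a) (at b)) (+-mono-≤ (∣at∣≤1 a) (∣at∣≤1 b))
      ; balanced = bal
      ; disjoint = disj
      ; opposite = λ i z a s → not-elim (proj₂ (∧-elim {at (point i u v w) z ∨ picks i z} s)) a
      ; exhaust = λ z → exh z (arc-or-point u v w (pos z))
      ; separates = sep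
      }
      where
      size : ∀ i → ∣ leg i ∣ᵇ ≤ suc ℓ
      size i = ≤-trans
        (∣∣-mono {f = leg i} {g = λ z → at (point i u v w) z ∨ picks i z} λ z → proj₁ ∘ ∧-elim)
        (≤-trans (∣∣-∪ (at (point i u v w)) (picks i)) (+-mono-≤ (∣at∣≤1 _)
          (≤-trans (∣elem∣≤length (map (pick i) F)) (≤-trans (≤-reflexive (length-map (pick i) F))
            (proj₁ (proj₂ (legs i)))))))
        where F = proj₁ (legs i)
      exh : ∀ z → (∃[ i ] T (arcs i z)) ⊎ (∃[ i ] pos z ≡ point i u v w) → (∃[ i ] T (arcs i z)) ⊎ (∃[ i ] T (leg i z))
      exh z (inj₁ h) = inj₁ h
      exh z (inj₂ (i , eq)) = inj₂ (i , at-leg i z eq)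

  -- Light sides of chords, modulo 2

  module _ (W : Fin n → Bool) where

    weight : ℕ → ℕ → ℕ
    weight p q = ∣ W ∩ (between p q ∘ pos) ∣ᵇ

    -- φ p q says that the lighter side of the chord pq is the one containing
    -- the point 0.

    φ : ℕ → ℕ → Bool
    φ p q = ∣ W ∣ᵇ <ᵇ weight p q + weight p q

    weight-sym : ∀ p q → weight p q ≡ weight q p
    weight-sym p q = ∣∣-cong λ z → cong (W z ∧_) (∨-comm ((p <ᵇ pos z) ∧ (pos z <ᵇ q)) _)

    φ-sym : ∀ p q → φ p q ≡ φ q p
    φ-sym p q = cong (λ c → ∣ W ∣ᵇ <ᵇ c + c) (weight-sym p q)

    weight-empty : ∀ p q → (∀ z → ¬ T (between p q z)) → φ p q ≡ false
    weight-empty p q h rewrite ∣∣-empty {f = W ∩ (between p q ∘ pos)} (λ z t → h (pos z) (proj₂ (∧-elim {W z} t))) = refl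

    φ-refl : ∀ p → φ p p ≡ false
    φ-refl p = weight-empty p p λ z → not-elim (by-order [] (¬ᶠ betweenᶠ ⟨0⟩ ⟨0⟩ ⟨1⟩) (p ∷ z ∷ []))

    φ-suc : ∀ p → φ p (suc p) ≡ false
    φ-suc p = weight-empty p (suc p) λ z t → case ∨-elim {(p <ᵇ z) ∧ (z <ᵇ suc p)} t of λ where
      (inj₁ t) → let a , b = ∧-elim {p <ᵇ z} t in <⇒≱ (<ᵇ⇒< p z a) (≤-pred (<ᵇ⇒< z (suc p) b))
      (inj₂ t) → let a , b = ∧-elim {suc p <ᵇ z} t in <⇒≱ (<-trans (n<1+n p) (<ᵇ⇒< (suc p) z a)) (<⇒≤ (<ᵇ⇒< z p b))

    -- The position `n` is virtual and marks a full turn from 0. Only position 0 is not strictly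
    -- between the two, so the weight is at least `∣ W ∣ᵇ − 1`, and three elements are needed for
    -- its double to exceed `∣ W ∣ᵇ`.
    φ-full : 3 ≤ ∣ W ∣ᵇ → φ 0 n ≡ true
    φ-full 3≤ = Equivalence.to T-≡ (<⇒<ᵇ (half<full (≤-trans (∣∣-mono split) (≤-trans (∣∣-∪ (W ∩ (between 0 n ∘ pos)) (at 0))
      (+-monoʳ-≤ (weight 0 n) (∣at∣≤1 0)))) 3≤))
      where
      split : ∀ z → T (W z) → T ((W ∩ (between 0 n ∘ pos)) z ∨ at 0 z)
      split z wz with pos z in eq
      ... | zero  = ∨-introʳ {W z ∧ _} tt
      ... | suc p = ∨-introˡ (∧-intro wz (∨-introˡ (<⇒<ᵇ (subst (_< n) eq (pos<n z)))))
      half<full : ∀ {m c} → m ≤ c + 1 → 3 ≤ m → m < c + c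
      half<full {m} {c} m≤ 3≤ = ≤-trans (s≤s m≤) (≤-trans (≤-reflexive (trans (cong suc (+-comm c 1)) (+-comm 2 c)))
        (+-monoʳ-≤ c (+-cancelʳ-≤ 1 2 c (≤-trans 3≤ m≤))))

    φ-true : ∀ {p q} → φ p q ≡ true → ∣ W ∣ᵇ < weight p q + weight p q
    φ-true {p} {q} eq = <ᵇ⇒< (∣ W ∣ᵇ) (weight p q + weight p q) (Equivalence.from T-≡ eq)

    φ-false : ∀ {p q} → φ p q ≡ false → weight p q + weight p q ≤ ∣ W ∣ᵇ
    φ-false eq = ≮⇒≥ λ lt → subst T eq (<⇒<ᵇ lt)

    -- Unless the three points are the feet of a balanced tripod, the light
    -- sides of the three chords between them do not wind around the circle.

    Even : ℕ → ℕ → ℕ → Set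
    Even u v w = φ u v xor φ v w xor φ u w ≡ false

    module _ (flag : E → Bool) (a b : ℕ) where

      -- Of the four odd patterns, two contradict that the span of `u` and `w` contains the shorter
      -- spans, and one would put more than half of `W` into each of two disjoint arcs. In the last
      -- one the two inner arcs are light by assumption, and the outer arc is light because the span
      -- of `u` and `w` is heavy.
      sorted : ∀ u v w → u < v → v < w → Leg flag a b u → Leg flag a b v → Leg flag a b w →
               Tripod R (suc ℓ) W ⊎ Even u v w
      sorted u v w u<v v<w lu lv lw with φ u v in e₁ | φ v w in e₂ | φ u w in e₃
      ... | false | false | false = inj₂ refl
      ... | true  | false | true  = inj₂ refl
      ... | false | true  | true  = inj₂ refl
      ... | true  | true  | false = inj₂ refl
      ... | true  | false | false = ⊥-elim (<⇒≱ (φ-true e₁) (≤-trans (+-mono-≤ le le) (φ-false e₃)))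
        where
        le : weight u v ≤ weight u w
        le = ∣∣-mono λ z t → let wz , h = ∧-elim {W z} t in ∧-intro wz
          (by-order (⟨0⟩ ≺ ⟨1⟩ ∷ ⟨1⟩ ≺ ⟨2⟩ ∷ betweenᶠ ⟨0⟩ ⟨1⟩ ⟨3⟩ ∷ [])
            (betweenᶠ ⟨0⟩ ⟨2⟩ ⟨3⟩) (u ∷ v ∷ w ∷ pos z ∷ []) (<⇒<ᵇ u<v) (<⇒<ᵇ v<w) h)
      ... | false | true  | false = ⊥-elim (<⇒≱ (φ-true e₂) (≤-trans (+-mono-≤ le le) (φ-false e₃)))
        where
        le : weight v w ≤ weight u w
        le = ∣∣-mono λ z t → let wz , h = ∧-elim {W z} t in ∧-intro wz
          (by-order (⟨0⟩ ≺ ⟨1⟩ ∷ ⟨1⟩ ≺ ⟨2⟩ ∷ betweenᶠ ⟨1⟩ ⟨2⟩ ⟨3⟩ ∷ [])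
            (betweenᶠ ⟨0⟩ ⟨2⟩ ⟨3⟩) (u ∷ v ∷ w ∷ pos z ∷ []) (<⇒<ᵇ u<v) (<⇒<ᵇ v<w) h)
      ... | true  | true  | true  = ⊥-elim (<⇒≱ (+-mono-< (φ-true e₁) (φ-true e₂))
        (≤-trans (≤-reflexive (interchange (weight u v) (weight u v) (weight v w) (weight v w))) (+-mono-≤ le le)))
        where
        le : weight u v + weight v w ≤ ∣ W ∣ᵇ
        le = ∣∣-disjoint (λ z → proj₁ ∘ ∧-elim) (λ z → proj₁ ∘ ∧-elim) λ z s t → not-elim
          (by-order (⟨0⟩ ≺ ⟨1⟩ ∷ ⟨1⟩ ≺ ⟨2⟩ ∷ betweenᶠ ⟨0⟩ ⟨1⟩ ⟨3⟩ ∷ [])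
            (¬ᶠ (betweenᶠ ⟨1⟩ ⟨2⟩ ⟨3⟩)) (u ∷ v ∷ w ∷ pos z ∷ []) (<⇒<ᵇ u<v) (<⇒<ᵇ v<w)
            (proj₂ (∧-elim {W z} s))) (proj₂ (∧-elim {W z} t))
      ... | false | false | true  = inj₁ (tripod W flag a b u v w (<⇒<ᵇ u<v) (<⇒<ᵇ v<w)
        (λ { ⟨0⟩ → lu ; ⟨1⟩ → lv ; ⟨2⟩ → lw })
        λ { ⟨0⟩ → ≤-trans (+-mono-≤ le₀ le₀) (φ-false e₂)
          ; ⟨1⟩ → +-cancelʳ-≤ (weight u w + weight u w) _ _ (≤-trans
              (≤-trans (≤-reflexive (interchange out out (weight u w) (weight u w))) (+-mono-≤ le₁ le₁))
              (+-monoʳ-≤ (∣ W ∣ᵇ) (<⇒≤ (φ-true e₃))))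
          ; ⟨2⟩ → ≤-trans (+-mono-≤ le₂ le₂) (φ-false e₁) })
        where
        out = ∣ W ∩ (arcOf ⟨1⟩ u v w ∘ pos) ∣ᵇ
        le₀ : ∣ W ∩ (arcOf ⟨0⟩ u v w ∘ pos) ∣ᵇ ≤ weight v w
        le₀ = ∣∣-mono λ z t → let wz , h = ∧-elim {W z} t in ∧-intro wz (∨-introˡ h)
        le₂ : ∣ W ∩ (arcOf ⟨2⟩ u v w ∘ pos) ∣ᵇ ≤ weight u v
        le₂ = ∣∣-mono λ z t → let wz , h = ∧-elim {W z} t in ∧-intro wz (∨-introˡ h)
        le₁ : out + weight u w ≤ ∣ W ∣ᵇ
        le₁ = ∣∣-disjoint (λ z → proj₁ ∘ ∧-elim) (λ z → proj₁ ∘ ∧-elim) λ z s t → not-elim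
          (by-order (⟨0⟩ ≺ ⟨1⟩ ∷ ⟨1⟩ ≺ ⟨2⟩ ∷ (⟨3⟩ ≺ ⟨0⟩ ∨ᶠ ⟨2⟩ ≺ ⟨3⟩) ∷ [])
            (¬ᶠ (betweenᶠ ⟨0⟩ ⟨2⟩ ⟨3⟩)) (u ∷ v ∷ w ∷ pos z ∷ []) (<⇒<ᵇ u<v) (<⇒<ᵇ v<w)
            (proj₂ (∧-elim {W z} s))) (proj₂ (∧-elim {W z} t))

      even-swap₁₂ : ∀ u v w → Even u v w → Even v u w
      even-swap₁₂ u v w e rewrite φ-sym v u with φ u v | φ v w | φ u w
      ... | false | false | false = refl
      ... | false | true  | true  = refl
      ... | true  | false | true  = refl
      ... | true  | true  | false = refl

      even-swap₂₃ : ∀ u v w → Even u v w → Even u w v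
      even-swap₂₃ u v w e rewrite φ-sym w v with φ u v | φ v w | φ u w
      ... | false | false | false = refl
      ... | false | true  | true  = refl
      ... | true  | false | true  = refl
      ... | true  | true  | false = refl

      even-double : ∀ u w → Even u u w
      even-double u w rewrite φ-refl u = xor-same (φ u w)

      even : ∀ u v w → Leg flag a b u → Leg flag a b v → Leg flag a b w → Tripod R (suc ℓ) W ⊎ Even u v w
      even u v w lu lv lw with <-cmp u v | <-cmp v w | <-cmp u w
      ... | tri≈ _ refl _ | _ | _ = inj₂ (even-double u w)
      ... | _ | tri≈ _ refl _ | _ = inj₂ (even-swap₁₂ v u v (even-swap₂₃ v v u (even-double v u)))
      ... | _ | _ | tri≈ _ refl _ = inj₂ (even-swap₂₃ u u v (even-double u v))
      ... | tri< u<v _ _ | tri< v<w _ _ | _ = sorted u v w u<v v<w lu lv lw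
      ... | tri< u<v _ _ | tri> _ _ w<v | tri< u<w _ _ = ⊎-map₂ (even-swap₂₃ u w v) (sorted u w v u<w w<v lu lw lv)
      ... | tri< u<v _ _ | tri> _ _ w<v | tri> _ _ w<u =
        ⊎-map₂ (even-swap₂₃ u w v ∘ even-swap₁₂ w u v) (sorted w u v w<u u<v lw lu lv)
      ... | tri> _ _ v<u | tri< v<w _ _ | tri< u<w _ _ = ⊎-map₂ (even-swap₁₂ v u w) (sorted v u w v<u u<w lv lu lw)
      ... | tri> _ _ v<u | tri< v<w _ _ | tri> _ _ w<u =
        ⊎-map₂ (even-swap₁₂ v u w ∘ even-swap₂₃ v w u) (sorted v w u v<w w<u lv lw lu)
      ... | tri> _ _ v<u | tri> _ _ w<v | _ =
        ⊎-map₂ (even-swap₁₂ v u w ∘ even-swap₂₃ v w u ∘ even-swap₁₂ w v u) (sorted w v u w<v v<u lw lv lu)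

  -- Cells and the vertices near them

  -- Cells of the drawing are indexed by y ≤ x: the cell (y , x) lies inside
  -- (on the side away from the point 0 of) the chords with lo < y and
  -- x ≤ hi.  The cells (x , x) are those at the circle, while (0 , x) and
  -- (y , n) all stand for the cell at the point 0.

  inside : ℕ → ℕ → E → Bool
  inside y x e = (lo e <ᵇ y) ∧ not (hi e <ᵇ x)

  inside-⊆ : ∀ {y x} e f → inside y x e ≡ true → inside y x f ≡ false →
             T ((lo e <ᵇ lo f) ∨ (hi f <ᵇ hi e))
  inside-⊆ {y} {x} e f p q = by-order (⟨0⟩ ≺ ⟨4⟩ ∧ᶠ ¬ᶠ (⟨1⟩ ≺ ⟨5⟩) ∷ ¬ᶠ (⟨2⟩ ≺ ⟨4⟩ ∧ᶠ ¬ᶠ (⟨3⟩ ≺ ⟨5⟩)) ∷ [])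
    (⟨0⟩ ≺ ⟨2⟩ ∨ᶠ ⟨3⟩ ≺ ⟨1⟩) (lo e ∷ hi e ∷ lo f ∷ hi f ∷ y ∷ x ∷ [])
    (Equivalence.from T-≡ p) (not-intro (λ t → subst T q t))

  inside-meet : ∀ {y x} → y ≤ x → ∀ e f → inside y x e ≡ true → inside y x f ≡ true → T (lo f <ᵇ hi e)
  inside-meet {y} {x} y≤x e f p q = <⇒<ᵇ (<-≤-trans (<ᵇ⇒< (lo f) y (proj₁ (∧-elim (Equivalence.from T-≡ q))))
    (≤-trans y≤x (≮⇒≥ λ h → not-elim (proj₂ (∧-elim {lo e <ᵇ y} (Equivalence.from T-≡ p))) (<⇒<ᵇ h))))

  -- Both spans around a cell contain the interval from `y` to `x`, so `y ≤ x` makes them overlap.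
  -- If only one chord is around the cell, its span cannot be contained in the other.
  inside-coherent : ∀ {y x} → y ≤ x → ∀ e f →
    T (coherent (inside y x e) (inside y x f) (lo e) (hi e) (lo f) (hi f))
  inside-coherent {y} {x} y≤x e f with inside y x e in p | inside y x f in q
  ... | false | false = tt
  ... | true  | true  = ∧-intro (inside-meet y≤x e f p q) (inside-meet y≤x f e q p)
  ... | true  | false = inside-⊆ {y} {x} e f p q
  ... | false | true  = inside-⊆ {y} {x} f e q p

  inside-step-y : ∀ y x e → inside y x e ≡ inside (suc y) x e ⊎ Touches e y
  inside-step-y y x e with lo e ≟ y
  ... | yes eq = inj₂ (inj₁ eq)
  ... | no ne  = inj₁ (cong (_∧ not (hi e <ᵇ x)) (T-ext
    (λ t → <⇒<ᵇ (m<n⇒m<1+n (<ᵇ⇒< (lo e) y t)))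
    (λ t → <⇒<ᵇ (≤∧≢⇒< (≤-pred (<ᵇ⇒< (lo e) (suc y) t)) ne))))

  inside-step-x : ∀ y x e → inside y x e ≡ inside y (suc x) e ⊎ Touches e x
  inside-step-x y x e with hi e ≟ x
  ... | yes eq = inj₂ (inj₂ eq)
  ... | no ne  = inj₁ (cong (λ c → (lo e <ᵇ y) ∧ not c) (T-ext
    (λ t → <⇒<ᵇ (m<n⇒m<1+n (<ᵇ⇒< (hi e) x t)))
    (λ t → <⇒<ᵇ (≤∧≢⇒< (≤-pred (<ᵇ⇒< (hi e) (suc x) t)) ne))))

  inside-n : ∀ y e → inside y n e ≡ false
  inside-n y e rewrite Equivalence.to T-≡ (<⇒<ᵇ (pos<n (hiᵥ e))) = ∧-zeroʳ (lo e <ᵇ y)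

  Near : (E → Bool) → ℕ → Set
  Near flag p = ∃[ F ] length F ≤ ℓ × (∀ e → T (cap (flag e) (lo e) (hi e) p) → e ∈ F)

  near⇒leg : ∀ flag flag′ {a b p} → (∀ e → flag e ≡ flag′ e ⊎ (Touches e a ⊎ Touches e b)) →
             Near flag p → Leg flag′ a b p
  near⇒leg flag flag′ {a} {b} {p} same (F , F≤ , h) = F , F≤ , h′
    where
    h′ : ∀ e → T (cap (flag′ e) (lo e) (hi e) p) → e ∈ F ⊎ (Touches e a ⊎ Touches e b)
    h′ e t with same e
    ... | inj₂ ts = inj₂ ts
    ... | inj₁ eq = inj₁ (h e (subst (λ o → T (cap o (lo e) (hi e) p)) (sym eq) t))

  near-free : ∀ flag p → (∀ e → ¬ T (cap (flag e) (lo e) (hi e) p)) → Near flag p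
  near-free flag p h = [] , z≤n , λ e t → ⊥-elim (h e t)

  -- The bounds say that `y` and `x` are each `p` or `suc p`: these are the cells around the point
  -- `p` of the circle, which no chord separates from it.
  near-corner : ∀ {y x} p → y ≤ suc p → p ≤ x → p ≤ y → x ≤ suc p → Near (inside y x) p
  near-corner {y} {x} p y≤1+p p≤x p≤y x≤1+p = near-free (inside y x) p λ e → free e (inside y x e) refl
    where
    free : ∀ e o → inside y x e ≡ o → ¬ T (cap o (lo e) (hi e) p)
    free e true eq t with ∧-elim {lo e <ᵇ y} (Equivalence.from T-≡ eq) | ∨-elim {p <ᵇ lo e} t
    ... | l , h | inj₁ p<l = <⇒≱ (<ᵇ⇒< p (lo e) p<l) (≤-pred (<-≤-trans (<ᵇ⇒< (lo e) y l) y≤1+p))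
    ... | l , h | inj₂ h<p = not-elim h (<⇒<ᵇ (<-≤-trans (<ᵇ⇒< (hi e) p h<p) p≤x))
    free e false eq t with ∧-elim {lo e <ᵇ p} t
    ... | l<p , p<h = subst T eq (∧-intro (<⇒<ᵇ (<-≤-trans (<ᵇ⇒< (lo e) p l<p) p≤y))
      (not-intro λ h<x → <⇒≱ (<ᵇ⇒< p (hi e) p<h) (≤-pred (≤-trans (<ᵇ⇒< (hi e) x h<x) x≤1+p))))

  -- This serves both ends of the cut circle: position 0 and the virtual position `n`, neither of
  -- which is enclosed by a chord.
  near-base : ∀ {flag p} → (∀ e → flag e ≡ false) → (∀ e → ¬ (lo e < p × p < hi e)) → Near flag p
  near-base {flag} {p} out h = near-free flag p λ e t →
    let l<p , p<h = ∧-elim (subst (λ o → T (cap o (lo e) (hi e) p)) (out e) t)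
    in h e (<ᵇ⇒< (lo e) p l<p , <ᵇ⇒< p (hi e) p<h)

  -- Discrete Stokes: a potential H for φ along the labels of the cells would
  -- contradict that the boundary of the disk winds once around the circle.

  module _ (label : ℕ → ℕ → ℕ) (labelled : ∀ y x → y ≤ x → Near (inside y x) (label y x)) (W : Fin n → Bool) where

    open xor-∧-Solver using (solve; con; _:+_; _:=_)

    private
      Result : Set → Set
      Result A = Tripod R (suc ℓ) W ⊎ A

      _>>=_ : ∀ {A B : Set} → Result A → (A → Result B) → Result B
      inj₁ t >>= f = inj₁ t
      inj₂ a >>= f = f a

      ψ = φ W

    -- The integral of `ψ` modulo 2 from the point 0 through the labels of `(0 , x)`, `(1 , x)` and
    -- so on to `(y , x)`.
    H : ℕ → ℕ → Bool
    H zero    x = ψ (label 0 x) 0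
    H (suc y) x = H y x xor ψ (label y x) (label (suc y) x)

    near-0 : ∀ {flag} → (∀ e → flag e ≡ false) → Near flag 0
    near-0 out = near-base out λ { e (() , _) }

    leg-here : ∀ y x {a b p} → Near (inside y x) p → Leg (inside y x) a b p
    leg-here y x = near⇒leg (inside y x) (inside y x) λ _ → inj₁ refl

    leg-y↑ : ∀ y x {b p} → Near (inside y x) p → Leg (inside (suc y) x) y b p
    leg-y↑ y x = near⇒leg (inside y x) (inside (suc y) x) λ e → [ inj₁ , inj₂ ∘ inj₁ ]′ (inside-step-y y x e)

    leg-y↓ : ∀ y x {b p} → Near (inside (suc y) x) p → Leg (inside y x) y b p
    leg-y↓ y x = near⇒leg (inside (suc y) x) (inside y x) λ e → [ inj₁ ∘ sym , inj₂ ∘ inj₁ ]′ (inside-step-y y x e)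

    leg-x↑ : ∀ y x {a p} → Near (inside y x) p → Leg (inside y (suc x)) a x p
    leg-x↑ y x = near⇒leg (inside y x) (inside y (suc x)) λ e → [ inj₁ , inj₂ ∘ inj₂ ]′ (inside-step-x y x e)

    leg-x↓ : ∀ y x {a p} → Near (inside y (suc x)) p → Leg (inside y x) a x p
    leg-x↓ y x = near⇒leg (inside y (suc x)) (inside y x) λ e → [ inj₁ ∘ sym , inj₂ ∘ inj₂ ]′ (inside-step-x y x e)

    -- Path independence across a unit square, cut along its diagonal `A C`. In each of the two
    -- triangles the cell of the middle label is the reference; the other two cells differ from it
    -- by one step in `y` and one step in `x`, which is why exempting two positions is enough. For
    -- `y = 0` all labels are near the same cell.
    step-x : ∀ y x → y ≤ x → Result (H y x xor H y (suc x) ≡ ψ (label y x) (label y (suc x)))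
    step-x zero x _ = do
      e ← even W (inside 0 x) 0 0 A 0 D (leg-here 0 x (labelled 0 x z≤n)) (leg-here 0 x {p = 0} (near-0 {inside 0 x} λ _ → refl))
            (leg-here 0 x (labelled 0 (suc x) z≤n))
      inj₂ (algebra (ψ A 0) (ψ 0 D) (ψ A D) (ψ D 0) (φ-sym W D 0) e)
      where
      A = label 0 x
      D = label 0 (suc x)
      algebra : ∀ a b c d → d ≡ b → a xor b xor c ≡ false → a xor d ≡ c
      algebra a b c d refl e = even⇒xor a b e
    step-x (suc y) x y<x = do
      i  ← step-x y x y≤x
      e  ← even W (inside (suc y) x) y x A B C
             (leg-y↑ y x (labelled y x y≤x)) (leg-here (suc y) x (labelled (suc y) x y<x))
             (leg-x↓ (suc y) x (labelled (suc y) (suc x) y<1+x))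
      e′ ← even W (inside y (suc x)) y x A D C
             (leg-x↑ y x (labelled y x y≤x)) (leg-here y (suc x) (labelled y (suc x) (m≤n⇒m≤1+n y≤x)))
             (leg-y↓ y (suc x) (labelled (suc y) (suc x) y<1+x))
      inj₂ (algebra (H y x) (H y (suc x)) (ψ A B) (ψ B C) (ψ A C) (ψ A D) (ψ D C) i e e′)
      where
      y≤x   = <⇒≤ y<x
      y<1+x = m≤n⇒m≤1+n y<x
      A = label y x
      B = label (suc y) x
      C = label (suc y) (suc x)
      D = label y (suc x)
      algebra : ∀ h k ab bc ac ad dc → h xor k ≡ ad → ab xor bc xor ac ≡ false → ad xor dc xor ac ≡ false →
                (h xor ab) xor (k xor dc) ≡ bc
      algebra h k ab bc ac ad dc refl e e′ = trans
        (solve 4 (λ h k ab dc → (h :+ ab) :+ (k :+ dc) := ((h :+ k) :+ dc) :+ ab) refl h k ab dc)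
        (trans (cong (_xor ab) (trans (even⇒xor (h xor k) dc e′) (sym (even⇒xor ab bc e))))
          (solve 2 (λ ab bc → (ab :+ bc) :+ ab := bc) refl ab bc))

    -- The point `x` is near all cells on the way from `(x , x)` through `(x , suc x)` to
    -- `(suc x , suc x)`, so triangles with tip `x` carry the identity along. At the last cell the
    -- tip moves on to `suc x` at no cost, since `φ` is false for neighbouring positions.
    diagonal : ∀ x → Result (H x x ≡ ψ (label x x) x)
    diagonal zero    = inj₂ refl
    diagonal (suc x) = do
      i  ← diagonal x
      j  ← step-x x x ≤-refl
      e₁ ← even W (inside x (suc x)) x x A D x (leg-x↑ x x (labelled x x ≤-refl)) lD lx
      e₂ ← even W (inside x (suc x)) x x D C x lD (leg-y↓ x (suc x) (labelled (suc x) (suc x) ≤-refl)) lx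
      e₃ ← even W (inside (suc x) (suc x)) x x C x (suc x) (leg-here (suc x) (suc x) (labelled (suc x) (suc x) ≤-refl))
             (leg-here (suc x) (suc x) (near-corner x ≤-refl (n≤1+n x) (n≤1+n x) ≤-refl))
             (leg-here (suc x) (suc x) (near-corner (suc x) (n≤1+n _) ≤-refl ≤-refl (n≤1+n _)))
      inj₂ (algebra (H x x) (H x (suc x)) (ψ A D) (ψ D x) (ψ A x) (ψ D C) (ψ C x) (ψ C (suc x)) i j e₁ e₂
        (subst (λ b → ψ C x xor b xor ψ C (suc x) ≡ false) (φ-suc W x) e₃))
      where
      A = label x x
      D = label x (suc x)
      C = label (suc x) (suc x)
      lx : Leg (inside x (suc x)) x x x
      lx = leg-here x (suc x) (near-corner x (n≤1+n x) (n≤1+n x) ≤-refl ≤-refl)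
      lD : Leg (inside x (suc x)) x x D
      lD = leg-here x (suc x) (labelled x (suc x) (n≤1+n x))
      algebra : ∀ h k ad dx ax dc cx cs → h ≡ ax → h xor k ≡ ad → ad xor dx xor ax ≡ false →
                dc xor cx xor dx ≡ false → cx xor false xor cs ≡ false → k xor dc ≡ cs
      algebra h k ad dx ax dc cx cs refl refl e₁ e₂ e₃ = trans
        (solve 4 (λ h k dx dc → k :+ dc := (((h :+ k) :+ dx) :+ h) :+ (dx :+ dc)) refl h k dx dc)
        (trans (cong₂ (λ p q → (p xor h) xor q) (even⇒xor (h xor k) dx e₁)
          (trans (solve 3 (λ dx dc cx → dx :+ dc := (dc :+ (cx :+ dx)) :+ cx) refl dx dc cx) (cong (_xor cx) e₂)))
          (trans (solve 2 (λ h cx → (h :+ h) :+ cx := cx :+ con false) refl h cx) (even⇒xor cx false e₃)))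

    -- All cells `(y , n)` have the same orientation, so the labels and the point 0 are near a
    -- single cell.
    side-n : ∀ y → y ≤ n → Result (H y n ≡ ψ (label y n) 0)
    side-n zero    _   = inj₂ refl
    side-n (suc y) y<n = do
      i ← side-n y (<⇒≤ y<n)
      e ← even W (inside y n) 0 0 (label y n) (label (suc y) n) 0 (leg-here y n (labelled y n (<⇒≤ y<n)))
            (near⇒leg (inside (suc y) n) (inside y n)
              (λ e → inj₁ (trans (inside-n (suc y) e) (sym (inside-n y e)))) (labelled (suc y) n y<n))
            (leg-here y n (near-0 (inside-n y)))
      inj₂ (algebra (H y n) (ψ (label y n) (label (suc y) n)) (ψ (label (suc y) n) 0) (ψ (label y n) 0) i e)
      where
      algebra : ∀ h a b c → h ≡ c → a xor b xor c ≡ false → h xor a ≡ b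
      algebra h a b c refl e = trans (cong (_xor a) (sym (even⇒xor a b e)))
        (solve 2 (λ a b → (a :+ b) :+ a := b) refl a b)

    -- Evaluating `H n n` along the circle and along the side `x = n` gives the same `φ` from the
    -- last label to `n` and to 0. An even triangle would then make `φ 0 n` false.
    balanced-tripod : 3 ≤ ∣ W ∣ᵇ → Tripod R (suc ℓ) W
    balanced-tripod 3≤ = [ id , ⊥-elim ]′ (do
      i ← diagonal n
      j ← side-n n ≤-refl
      e ← even W (inside n n) 0 0 (label n n) 0 n (leg-here n n (labelled n n ≤-refl)) (leg-here n n (near-0 (inside-n n)))
            (leg-here n n (near-base (inside-n n) λ { e (_ , n<h) → <⇒≱ n<h (<⇒≤ (pos<n (hiᵥ e))) }))
      inj₂ (absurd (ψ (label n n) n) (ψ (label n n) 0) (trans (sym i) j)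
        (subst (λ b → ψ (label n n) 0 xor b xor ψ (label n n) n ≡ false) (φ-full W 3≤) e)))
      where
      absurd : ∀ a b → a ≡ b → b xor true xor a ≡ false → ⊥
      absurd true  _ refl ()
      absurd false _ refl ()

-- Growing tree decompositions

module _ {A B : Set} {R : A → A → Set} {P : A → Set} {R′ : B → B → Set} {P′ : B → Set} where

  walk-map : (f : A → B) → (∀ {x y} → R x y → R′ (f x) (f y)) → (∀ {x} → P x → P′ (f x)) →
             ∀ {x y} → WalkIn R P x y → WalkIn R′ P′ (f x) (f y)
  walk-map f r p (here px)      = here (p px)
  walk-map f r p (step px rx w) = step (p px) (r rx) (walk-map f r p w)

module _ {A : Set} {R : A → A → Set} {P : A → Set} where

  walk-snoc : ∀ {x y z} → WalkIn R P x y → R y z → P z → WalkIn R P x z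
  walk-snoc (here px)     r pz = step px r (here pz)
  walk-snoc (step px s w) r pz = step px s (walk-snoc w r pz)

module _ {A : Set} {R : A → A → Set} where

  linked-last : ∀ {a c rest} l → Linked R (a ∷ l ++ c ∷ rest) → ∃[ z ] z ∈ a ∷ l × R z c
  linked-last {a} []      (r ∷ _) = a , here refl , r
  linked-last     (b ∷ l) (_ ∷ h) = let z , z∈ , r = linked-last l h in z , there z∈ , r

  linked-drop : ∀ l {l′} → Linked R (l ++ l′) → Linked R l′
  linked-drop []          h = h
  linked-drop (a ∷ l) {l′} h = linked-drop l (Linked.tail h)

unique-++ : ∀ {A : Set} {a b : A} l {l′} → Unique (l ++ l′) → a ∈ l → b ∈ l′ → a ≢ b
unique-++ (x ∷ l) (x∉ ∷ u) (here refl) b∈ = All.lookup x∉ (∈-++⁺ʳ l b∈)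
unique-++ (x ∷ l) (_ ∷ u) (there a∈) b∈ = unique-++ l u a∈ b∈

-- Attaching makes zero a new leaf and renames the old nodes by suc.

data Growth : ℕ → Set where
  root   : Growth 1
  attach : ∀ {m} → Growth m → Fin m → Growth (suc m)

Link : ∀ {m} → Growth m → Fin m → Fin m → Set
Link root         _       _       = ⊥
Link (attach g i) zero    zero    = ⊥
Link (attach g i) zero    (suc k) = i ≡ k
Link (attach g i) (suc j) zero    = i ≡ j
Link (attach g i) (suc j) (suc k) = Link g j k

link-sym : ∀ {m} (g : Growth m) {x y} → Link g x y → Link g y x
link-sym (attach g i) {zero}  {suc k} l = l
link-sym (attach g i) {suc j} {zero}  l = l
link-sym (attach g i) {suc j} {suc k} l = link-sym g l

link-irrefl : ∀ {m} (g : Growth m) x → ¬ Link g x x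
link-irrefl (attach g i) (suc x) = link-irrefl g x

link-connected : ∀ {m} (g : Growth m) x y → WalkIn (Link g) (λ _ → ⊤) x y
link-connected root         zero    zero    = here tt
link-connected (attach g i) zero    zero    = here tt
link-connected (attach g i) zero    (suc k) = step tt refl (walk-map suc id id (link-connected g i k))
link-connected (attach g i) (suc j) zero    = walk-snoc (walk-map suc id id (link-connected g j i)) refl tt
link-connected (attach g i) (suc j) (suc k) = walk-map suc id id (link-connected g j k)

link-zero : ∀ {m} (g : Growth m) i x → Link (attach g i) zero x → x ≡ suc i
link-zero g i (suc k) refl = refl

all-suc : ∀ {m} (l : List (Fin (suc m))) → zero ∉ l → ∃[ l′ ] l ≡ map suc l′
all-suc []          _  = [] , refl
all-suc (zero  ∷ l) ∉  = ⊥-elim (∉ (here refl))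
all-suc (suc x ∷ l) ∉  = let l′ , eq = all-suc l (∉ ∘ there) in x ∷ l′ , cong (suc x ∷_) eq

linked-unmap : ∀ {m} (g : Growth m) i l → Linked (Link (attach g i)) (map suc l) → Linked (Link g) l
linked-unmap g i []          _       = []
linked-unmap g i (x ∷ [])    _       = [-]
linked-unmap g i (x ∷ y ∷ l) (r ∷ h) = r ∷ linked-unmap g i (y ∷ l) h

unique-unmap : ∀ {m} (l : List (Fin m)) → Unique (map (Fin.suc {m}) l) → Unique l
unique-unmap []      _        = []
unique-unmap (x ∷ l) (x∉ ∷ u) = All.tabulate (λ y∈ eq → All.lookup x∉ (∈-map⁺ suc y∈) (cong suc eq)) ∷ unique-unmap l u

-- A cycle through the newest leaf would need two distinct neighbours of it, but there is only one;
-- any other cycle already lies in the older tree.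
link-acyclic : ∀ {m} (g : Growth m) x ys → 2 ≤ length ys → Unique (x ∷ ys) → ¬ Linked (Link g) (x ∷ ys ++ [ x ])
link-acyclic root x (y ∷ ys) _ _ (() ∷ _)
link-acyclic (attach g i) zero (y ∷ []) (s≤s ()) _ _
link-acyclic (attach g i) zero (y ∷ y′ ∷ ys) _ (_ ∷ y∉ ∷ _) (r ∷ _ ∷ h)
  with linked-last ys h
... | z , z∈ , s = All.lookup y∉ z∈
  (trans (link-zero g i y r) (sym (link-zero g i z (link-sym (attach g i) {z} {zero} s))))
link-acyclic (attach g i) (suc x) ys 2≤ u h with DecMembership._∈?_ Fin._≟_ zero ys
... | no ∉ with all-suc ys ∉
...   | ys′ , refl = link-acyclic g x ys′ (subst (2 ≤_) (length-map suc ys′) 2≤) (unique-unmap (x ∷ ys′) u)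
  (linked-unmap g i (x ∷ ys′ ++ [ x ]) (subst (Linked (Link (attach g i)))
    (cong (suc x ∷_) (sym (map-++ suc ys′ [ x ]))) h))
link-acyclic (attach g i) (suc x) ys 2≤ u h | yes ∈ with ∈-∃++ ∈
... | as , bs , refl = around as bs 2≤ u
  (subst (Linked (Link (attach g i))) (cong (suc x ∷_) (++-assoc as (zero ∷ bs) [ suc x ])) h)
  where
  before : ∀ {z} → Link (attach g i) z zero → z ≡ suc i
  before {z} r = link-zero g i z (link-sym (attach g i) {z} {zero} r)
  around : ∀ as bs → 2 ≤ length (as ++ zero ∷ bs) → Unique (suc x ∷ as ++ zero ∷ bs) →
           ¬ Linked (Link (attach g i)) (suc x ∷ as ++ zero ∷ bs ++ [ suc x ])
  around []       []       (s≤s ()) _ _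
  around (a ∷ as) []       _ (x∉ ∷ _) h with linked-last as (Linked.tail h) | linked-drop (suc x ∷ a ∷ as) h
  ... | z , z∈ , r | s ∷ _ = All.lookup x∉ (∈-++⁺ˡ z∈) (trans (link-zero g i (suc x) s) (sym (before r)))
  around as       (b ∷ bs) _ u        h with linked-last as h | linked-drop (suc x ∷ as) h
  ... | z , z∈ , r | s ∷ _ = unique-++ (suc x ∷ as) u z∈ (there (here refl)) (trans (before r) (sym (link-zero g i b s)))

growthTree : ∀ {m} → Growth m → Tree
growthTree {m} g = record
  { m = m ; _~ₜ_ = Link g ; symₜ = link-sym g ; irrefₜ = link-irrefl g
  ; connected = link-connected g ; acyclic = link-acyclic g }

module Build {n : ℕ} (R : Fin n → Fin n → Set) (R-sym : ∀ {x y} → R x y → R y x) where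

  -- A tree decomposition of the subgraph induced by U.

  record Partial (K : ℕ) : Set where
    field
      U       : Fin n → Bool
      m       : ℕ
      growth  : Growth m
      bag     : Fin m → Fin n → Bool
      bag⊆U   : ∀ i {z} → T (bag i z) → T (U z)
      covers₁ : ∀ z → T (U z) → ∃[ i ] T (bag i z)
      covers₂ : ∀ y z → T (U y) → T (U z) → R y z → ∃[ i ] T (bag i y) × T (bag i z)
      subtree : ∀ z i j → T (bag i z) → T (bag j z) → WalkIn (Link growth) (λ k → T (bag k z)) i j
      small   : ∀ i → ∣ bag i ∣ᵇ ≤ K

  module _ {K : ℕ} where

    initial : Partial K
    initial = record
      { U = λ _ → false ; m = 1 ; growth = root ; bag = λ _ _ → false
      ; bag⊆U = λ _ () ; covers₁ = λ _ () ; covers₂ = λ _ _ () ; subtree = λ _ _ _ ()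
      ; small = λ _ → ≤-trans (≤-reflexive (∣∣-empty {n} {λ _ → false} (λ _ ()))) z≤n }

    record _⊑_ (P Q : Partial K) : Set where
      private
        module P = Partial P
        module Q = Partial Q
      field
        embed     : Fin P.m → Fin Q.m
        embed-bag : ∀ i {z} → T (P.bag i z) → T (Q.bag (embed i) z)

    ⊑-refl : ∀ {P} → P ⊑ P
    ⊑-refl = record { embed = id ; embed-bag = λ _ → id }

    ⊑-trans : ∀ {P Q S} → P ⊑ Q → Q ⊑ S → P ⊑ S
    ⊑-trans p q = record
      { embed = _⊑_.embed q ∘ _⊑_.embed p
      ; embed-bag = λ i → _⊑_.embed-bag q (_⊑_.embed p i) ∘ _⊑_.embed-bag p i }

    -- `old` keeps the nodes of every old vertex connected, and `closed` ensures that each edge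
    -- between a new vertex and `U` has both ends in the new bag.
    module AddBag (P : Partial K) (i : Fin (Partial.m P)) (B : Fin n → Bool)
      (old : ∀ {z} → T (B z) → T (Partial.U P z) → T (Partial.bag P i z))
      (closed : ∀ {y z} → T (B z) → ¬ T (Partial.U P z) → T (Partial.U P y) → R z y → T (B y))
      (∣B∣≤K : ∣ B ∣ᵇ ≤ K) where

      open Partial P

      bag′ : Fin (suc m) → Fin n → Bool
      bag′ zero    = B
      bag′ (suc j) = bag j

      edges : ∀ y z → T (U y ∨ B y) → T (U z ∨ B z) → R y z → ∃[ j ] T (bag′ j y) × T (bag′ j z)
      edges y z py pz r with T-dec (B y) | T-dec (B z) | T-dec (U y) | T-dec (U z)
      ... | inj₁ by | inj₁ bz | _ | _ = zero , by , bz
      ... | _ | _ | inj₁ uy | inj₁ uz = let j , a , b = covers₂ y z uy uz r in suc j , a , b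
      ... | inj₁ by | inj₂ ¬bz | inj₂ ¬uy | _ =
        ⊥-elim (not-elim ¬bz (closed by (not-elim ¬uy) ([ id , ⊥-elim ∘ not-elim ¬bz ]′ (∨-elim pz)) r))
      ... | inj₂ ¬by | inj₁ bz | _ | inj₂ ¬uz =
        ⊥-elim (not-elim ¬by (closed bz (not-elim ¬uz) ([ id , ⊥-elim ∘ not-elim ¬by ]′ (∨-elim py)) (R-sym r)))
      ... | inj₂ ¬by | _ | inj₂ ¬uy | _ = ⊥-elim ([ not-elim ¬uy , not-elim ¬by ]′ (∨-elim py))
      ... | _ | inj₂ ¬bz | _ | inj₂ ¬uz = ⊥-elim ([ not-elim ¬uz , not-elim ¬bz ]′ (∨-elim pz))

      walk : ∀ z j k → T (bag′ j z) → T (bag′ k z) → WalkIn (Link (attach growth i)) (λ l → T (bag′ l z)) j k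
      walk z zero    zero    p q = here p
      walk z zero    (suc k) p q = step p refl (walk-map suc id id (subtree z i k (old p (bag⊆U k q)) q))
      walk z (suc j) zero    p q = walk-snoc (walk-map suc id id (subtree z j i p (old q (bag⊆U j p)))) refl q
      walk z (suc j) (suc k) p q = walk-map suc id id (subtree z j k p q)

      result : Partial K
      result = record
        { U = λ z → U z ∨ B z ; m = suc m ; growth = attach growth i ; bag = bag′
        ; bag⊆U = λ { zero {z} b → ∨-introʳ {U z} b ; (suc j) b → ∨-introˡ (bag⊆U j b) }
        ; covers₁ = λ z p → [ (λ u → let j , b = covers₁ z u in suc j , b) , (zero ,_) ]′ (∨-elim p)
        ; covers₂ = edges
        ; subtree = walk
        ; small = λ { zero → ∣B∣≤K ; (suc j) → small j } }

      grown : P ⊑ result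
      grown = record { embed = suc ; embed-bag = λ _ → id }

  next-cases : ∀ i j → j ≢ i → j ≡ next i ⊎ j ≡ next (next i)
  next-cases ⟨0⟩ ⟨0⟩ ne = ⊥-elim (ne refl)
  next-cases ⟨0⟩ ⟨1⟩ ne = inj₁ refl
  next-cases ⟨0⟩ ⟨2⟩ ne = inj₂ refl
  next-cases ⟨1⟩ ⟨0⟩ ne = inj₂ refl
  next-cases ⟨1⟩ ⟨1⟩ ne = ⊥-elim (ne refl)
  next-cases ⟨1⟩ ⟨2⟩ ne = inj₁ refl
  next-cases ⟨2⟩ ⟨0⟩ ne = inj₁ refl
  next-cases ⟨2⟩ ⟨1⟩ ne = inj₂ refl
  next-cases ⟨2⟩ ⟨2⟩ ne = ⊥-elim (ne refl)

  index-cases : ∀ i m → m ≡ i ⊎ m ≡ next i ⊎ m ≡ next (next i)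
  index-cases i m with m Fin.≟ i
  ... | yes eq = inj₁ eq
  ... | no ne  = inj₂ (next-cases i m ne)

  ∣∪₄∣≤ : ∀ (f g h k : Fin n → Bool) {a b c d} → ∣ f ∣ᵇ ≤ a → ∣ g ∣ᵇ ≤ b → ∣ h ∣ᵇ ≤ c → ∣ k ∣ᵇ ≤ d →
          ∣ (λ z → f z ∨ g z ∨ h z ∨ k z) ∣ᵇ ≤ a + (b + (c + d))
  ∣∪₄∣≤ f g h k p q r t = ≤-trans (∣∣-∪ f (λ z → g z ∨ h z ∨ k z)) (+-mono-≤ p
    (≤-trans (∣∣-∪ g (λ z → h z ∨ k z)) (+-mono-≤ q (≤-trans (∣∣-∪ h k) (+-mono-≤ r t)))))

  ∣∪₆∣≤ : ∀ (f g h k l m : Fin n → Bool) {b c d e} → ∣ h ∣ᵇ ≤ b → ∣ k ∣ᵇ ≤ c → ∣ l ∣ᵇ ≤ d → ∣ m ∣ᵇ ≤ e →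
          ∣ (λ z → f z ∨ g z ∨ h z ∨ k z ∨ l z ∨ m z) ∣ᵇ ≤ ∣ f ∣ᵇ + (∣ g ∣ᵇ + (b + (c + (d + e))))
  ∣∪₆∣≤ f g h k l m p q r t = ≤-trans (∣∣-∪ f (λ z → g z ∨ h z ∨ k z ∨ l z ∨ m z))
    (+-monoʳ-≤ (∣ f ∣ᵇ) (≤-trans (∣∣-∪ g (λ z → h z ∨ k z ∨ l z ∨ m z))
      (+-monoʳ-≤ (∣ g ∣ᵇ) (∣∪₄∣≤ h k l m p q r t))))

  ∣∩∣≤ : ∀ (f g : Fin n → Bool) → ∣ f ∩ g ∣ᵇ ≤ ∣ f ∣ᵇ
  ∣∩∣≤ f g = ∣∣-mono {f = f ∩ g} {g = f} λ z → proj₁ ∘ ∧-elim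

  -- The recursion along balanced tripods

  module Extend (s : ℕ) (tripods : ∀ W → 3 ≤ ∣ W ∣ᵇ → Tripod R s W) where

    open +-*-Solver using (solve; con; _:+_; _:*_; _:=_)

    ℓ K : ℕ
    ℓ = suc s
    K = 6 * ℓ + 1

    record Extension (P : Partial K) (Z : Fin n → Bool) : Set where
      constructor extension
      field
        Q     : Partial K
        P⊑Q   : P ⊑ Q
        sound : ∀ {z} → T (Partial.U Q z) → T (Partial.U P z) ⊎ T (Z z)
        old   : ∀ {z} → T (Partial.U P z) → T (Partial.U Q z)
        new   : ∀ {z} → T (Z z) → T (Partial.U Q z)

    -- W is the boundary towards U of the set Z still to be decomposed.

    record Task (P : Partial K) (i : Fin (Partial.m P)) (Z W : Fin n → Bool) : Set where
      open Partial P
      field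
        ∣W∣≤  : ∣ W ∣ᵇ ≤ 4 * ℓ
        W⊆bag : ∀ {z} → T (W z) → T (bag i z)
        fresh : ∀ {z} → T (Z z) → ¬ T (U z)
        bound : ∀ {x y} → T (Z x) → T (U y) → R x y → T (W y)

    Solvable : ℕ → Set
    Solvable d = ∀ P i Z W → ∣ Z ∣ᵇ < d → Task P i Z W → Extension P Z

    bag₁-bound : ∀ {w} → w ≤ 4 * ℓ + 1 → w + (s + (s + 2)) ≤ K
    bag₁-bound {w} h = ≤-trans (+-monoˡ-≤ (s + (s + 2)) h) (≤-reflexive
      (solve 1 (λ s → (con 4 :* (con 1 :+ s) :+ con 1) :+ (s :+ (s :+ con 2)) := con 6 :* (con 1 :+ s) :+ con 1) refl s))

    -- Half of `4 * ℓ + 1` rounds down to `2 * ℓ`, and two legs with the exceptions add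
    -- `s + (s + 2)`, which is `2 * ℓ`.
    boundary-bound : ∀ {a w} → a + a ≤ w → w ≤ 4 * ℓ + 1 → a + (s + (s + 2)) ≤ 4 * ℓ
    boundary-bound {a} {w} aa≤w w≤ = ≤-trans (+-monoˡ-≤ (s + (s + 2)) a≤) (≤-reflexive
      (solve 1 (λ s → con 2 :* (con 1 :+ s) :+ (s :+ (s :+ con 2)) := con 4 :* (con 1 :+ s)) refl s))
      where
      a≤ : a ≤ 2 * ℓ
      a≤ = ≮⇒≥ λ lt → <⇒≱ (≤-trans (≤-reflexive
        (solve 1 (λ s → con 2 :+ con 4 :* (con 1 :+ s) :=
          (con 1 :+ con 2 :* (con 1 :+ s)) :+ (con 1 :+ con 2 :* (con 1 :+ s))) refl s))
        (+-mono-≤ lt lt)) (≤-trans aa≤w (≤-trans w≤ (≤-reflexive (+-comm (4 * ℓ) 1))))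

    -- Three legs and the exceptions have at most `3 * s + 2`, that is `3 * ℓ − 1`, vertices, so
    -- `3 * ℓ + 1` vertices of `W⁺` still fit.
    bag₂-bound : ∀ a b → a + b ≤ 3 * ℓ + 1 → a + (b + (s + (s + (s + 2)))) ≤ K
    bag₂-bound a b h = ≤-trans (≤-reflexive (sym (+-assoc a b _))) (≤-trans (+-monoˡ-≤ (s + (s + (s + 2))) h)
      (≤-trans (n≤1+n _) (≤-reflexive
      (solve 1 (λ s → con 1 :+ ((con 3 :* (con 1 :+ s) :+ con 1) :+ (s :+ (s :+ (s :+ con 2)))) :=
        con 6 :* (con 1 :+ s) :+ con 1) refl s))))

    -- The bag with three legs has no room for all of `W⁺`. Splitting off an arc that holds at least
    -- `ℓ` vertices of `W⁺`, if there is one, leaves few enough in the other two.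
    heavy-arc : ∀ {a b w} → ℓ ≤ a → a + b ≤ w → w ≤ 4 * ℓ + 1 → b ≤ 3 * ℓ + 1
    heavy-arc {a} {b} ℓ≤a ab≤w w≤ = +-cancelˡ-≤ ℓ b _ (≤-trans (+-monoˡ-≤ b ℓ≤a) (≤-trans ab≤w (≤-trans w≤ (≤-reflexive
      (solve 1 (λ l → con 4 :* l :+ con 1 := l :+ (con 3 :* l :+ con 1)) refl ℓ)))))

    light-arcs : ∀ {a b} → a < ℓ → b < ℓ → a + b ≤ 3 * ℓ + 1
    light-arcs {a} {b} a< b< = ≤-trans (+-mono-≤ (<⇒≤ a<) (<⇒≤ b<)) (≤-trans (m≤m+n (ℓ + ℓ) (ℓ + 1)) (≤-reflexive
      (solve 1 (λ l → (l :+ l) :+ (l :+ con 1) := con 3 :* l :+ con 1) refl ℓ)))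

    module Step (d : ℕ) (rec : Solvable d) (P : Partial K) (i₀ : Fin (Partial.m P)) (Z W : Fin n → Bool)
                (∣Z∣≤ : ∣ Z ∣ᵇ ≤ d) (task : Task P i₀ Z W) (r : Fin n) (Zr : T (Z r)) where

      open Partial P using (U)
      open Task task

      -- The vertex `r` guarantees progress: it enters the first new bag, so the remaining sets are
      -- proper subsets of `Z` whatever the tripod separates.
      W⁺ : Fin n → Bool
      W⁺ z = W z ∨ ⌊ z Fin.≟ r ⌋

      W⁺-W : ∀ {z} → T (W z) → T (W⁺ z)
      W⁺-W = ∨-introˡ

      W⁺-r : T (W⁺ r)
      W⁺-r = ∨-introʳ {W r} (fromWitness {a? = r Fin.≟ r} refl)

      W⊆U : ∀ {z} → T (W z) → T (U z)
      W⊆U w = Partial.bag⊆U P i₀ (W⊆bag w)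

      ∣W⁺∣≤ : ∣ W⁺ ∣ᵇ ≤ 4 * ℓ + 1
      ∣W⁺∣≤ = ≤-trans (∣∣-∪ W (λ z → ⌊ z Fin.≟ r ⌋)) (+-mono-≤ ∣W∣≤
        (∣∣-subsingleton {f = λ z → ⌊ z Fin.≟ r ⌋} λ x y p q →
          trans (toWitness {a? = x Fin.≟ r} p) (sym (toWitness {a? = y Fin.≟ r} q))))

      shrink : ∀ (Z′ : Fin n → Bool) → (∀ {z} → T (Z′ z) → T (Z z)) → ¬ T (Z′ r) → ∣ Z′ ∣ᵇ < d
      shrink Z′ sub ∉ = <-≤-trans (∣∣-strict (λ z → sub) r Zr ∉) ∣Z∣≤

      V : Fin n → Bool
      V z = Z z ∨ W z

      V∩U : ∀ {z} → T (V z) → T (U z) → T (W z)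
      V∩U v u = [ (λ z → ⊥-elim (fresh z u)) , id ]′ (∨-elim v)

      V∖U : ∀ {z} → T (V z) → ¬ T (U z) → T (Z z)
      V∖U v ¬u = [ id , (λ w → ⊥-elim (¬u (W⊆U w))) ]′ (∨-elim v)

      W⁺⊆V : ∀ {z} → T (W⁺ z) → T (V z)
      W⁺⊆V {z} w = [ ∨-introʳ {Z z} , (λ p → ∨-introˡ (subst (T ∘ Z) (sym (toWitness {a? = z Fin.≟ r} p)) Zr)) ]′ (∨-elim w)

      -- A tripod needs three vertices. Here `W⁺` itself serves as the new bag and as the next
      -- boundary.
      small-case : ∣ W⁺ ∣ᵇ ≤ 2 → Extension P Z
      small-case ≤2 = extension (E.Q) (⊑-trans B.grown E.P⊑Q)
        (λ u → [ [ inj₁ , inV ]′ ∘ ∨-elim , inj₂ ∘ proj₁ ∘ ∧-elim ]′ (E.sound u))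
        (λ u → E.old (∨-introˡ u))
        new
        where
        module B = AddBag P i₀ W⁺
          (λ w u → W⊆bag (V∩U (W⁺⊆V w) u))
          (λ w ¬u uy r → W⁺-W (bound (V∖U (W⁺⊆V w) ¬u) uy r))
          (≤-trans (m≤m+n _ (s + (s + 2))) (bag₁-bound ∣W⁺∣≤))
        inV : ∀ {z} → T (W⁺ z) → T (U z) ⊎ T (Z z)
        inV w = [ inj₂ , inj₁ ∘ W⊆U ]′ (∨-elim (W⁺⊆V w))
        Z′ : Fin n → Bool
        Z′ z = Z z ∧ not (W⁺ z)
        E : Extension B.result Z′
        E = rec B.result zero Z′ W⁺ (shrink Z′ (proj₁ ∘ ∧-elim) (λ t → not-elim (proj₂ (∧-elim {Z r} t)) W⁺-r)) record
          { ∣W∣≤  = ≤-trans ≤2 (≤-trans (s≤s (s≤s z≤n)) (*-monoʳ-≤ 4 (s≤s z≤n)))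
          ; W⊆bag = id
          ; fresh = λ {z} t u → let Zz , ¬w = ∧-elim {Z z} t in
              [ fresh Zz , not-elim ¬w ]′ (∨-elim u)
          ; bound = λ {x} t u r → [ (λ uy → W⁺-W (bound (proj₁ (∧-elim {Z x} t)) uy r)) , id ]′ (∨-elim u) }
        module E = Extension E
        new : ∀ {z} → T (Z z) → T (Partial.U E.Q z)
        new {z} Zz = [ (λ w → E.old (∨-introʳ {U z} w)) , (λ ¬w → E.new (∧-intro Zz ¬w)) ]′ (T-dec (W⁺ z))

      module Split (tripod : Tripod R s W⁺) (i : Fin 3)
        (light : ∣ W⁺ ∩ Tripod.A tripod (next i) ∣ᵇ + ∣ W⁺ ∩ Tripod.A tripod (next (next i)) ∣ᵇ ≤ 3 * ℓ + 1) where

        open Tripod tripod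

        j k : Fin 3
        j = next i
        k = next (next i)

        OnLeg : (Fin 3 → Set) → Fin n → Set
        OnLeg M z = (∃[ m ] M m × T (S m z)) ⊎ T (X z)

        abstract
          -- A single bag with `W⁺` and all three legs would be too large. `B₁` contains the
          -- boundary of arc `i`; `B₂` gives up the part of `W⁺` inside this arc in exchange for the
          -- third leg and contains the boundaries of the other two arcs. Intersecting with `V`
          -- keeps both bags within `Z` and its old boundary.
          B₁ B₂ : Fin n → Bool
          B₁ z = (W⁺ z ∨ S j z ∨ S k z ∨ X z) ∧ V z
          B₂ z = ((W⁺ ∩ A j) z ∨ (W⁺ ∩ A k) z ∨ S i z ∨ S j z ∨ S k z ∨ X z) ∧ V z

          Wₘ Zₘ : Fin 3 → Fin n → Bool
          Wₘ m z = ((W⁺ ∩ A m) z ∨ S (next m) z ∨ S (next (next m)) z ∨ X z) ∧ V z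
          Zₘ m z = Z z ∧ A m z ∧ not (B₁ z) ∧ not (B₂ z)

          ∣B₁∣≤ : ∣ B₁ ∣ᵇ ≤ K
          ∣B₁∣≤ = ≤-trans (∣∩∣≤ (λ z → W⁺ z ∨ S j z ∨ S k z ∨ X z) V)
            (≤-trans (∣∪₄∣≤ W⁺ (S j) (S k) X ≤-refl (∣S∣≤ j) (∣S∣≤ k) ∣X∣≤) (bag₁-bound ∣W⁺∣≤))

          ∣B₂∣≤ : ∣ B₂ ∣ᵇ ≤ K
          ∣B₂∣≤ = ≤-trans (∣∩∣≤ (λ z → (W⁺ ∩ A j) z ∨ (W⁺ ∩ A k) z ∨ S i z ∨ S j z ∨ S k z ∨ X z) V)
            (≤-trans (∣∪₆∣≤ (W⁺ ∩ A j) (W⁺ ∩ A k) (S i) (S j) (S k) X (∣S∣≤ i) (∣S∣≤ j) (∣S∣≤ k) ∣X∣≤)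
              (bag₂-bound (∣ W⁺ ∩ A j ∣ᵇ) (∣ W⁺ ∩ A k ∣ᵇ) light))

          ∣Wₘ∣≤ : ∀ m → ∣ Wₘ m ∣ᵇ ≤ 4 * ℓ
          ∣Wₘ∣≤ m = ≤-trans (∣∩∣≤ (λ z → (W⁺ ∩ A m) z ∨ S (next m) z ∨ S (next (next m)) z ∨ X z) V)
            (≤-trans (∣∪₄∣≤ (W⁺ ∩ A m) (S (next m)) (S (next (next m))) X ≤-refl (∣S∣≤ (next m)) (∣S∣≤ (next (next m))) ∣X∣≤)
              (boundary-bound {∣ W⁺ ∩ A m ∣ᵇ} {∣ W⁺ ∣ᵇ} (balanced m) ∣W⁺∣≤))

          B₁-W⁺ : ∀ {z} → T (W⁺ z) → T (B₁ z)
          B₁-W⁺ w = ∧-intro (∨-introˡ w) (W⁺⊆V w)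

          B₁-leg : ∀ {z} → T (V z) → OnLeg (_≢ i) z → T (B₁ z)
          B₁-leg {z} v (inj₂ x) = ∧-intro (∨-introʳ {W⁺ z} (∨-introʳ {S j z} (∨-introʳ {S k z} x))) v
          B₁-leg {z} v (inj₁ (m , m≢i , p)) with next-cases i m m≢i
          ... | inj₁ refl = ∧-intro (∨-introʳ {W⁺ z} (∨-introˡ p)) v
          ... | inj₂ refl = ∧-intro (∨-introʳ {W⁺ z} (∨-introʳ {S j z} (∨-introˡ p))) v

          B₁-cases : ∀ {z} → T (B₁ z) → T (V z) × (T (W⁺ z) ⊎ OnLeg (_≢ i) z)
          B₁-cases {z} b with ∧-elim {W⁺ z ∨ S j z ∨ S k z ∨ X z} b
          ... | h , v with ∨-elim {W⁺ z} h
          ...   | inj₁ w = v , inj₁ w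
          ...   | inj₂ h with ∨-elim {S j z} h
          ...     | inj₁ p = v , inj₂ (inj₁ (j , next≢ i , p))
          ...     | inj₂ h with ∨-elim {S k z} h
          ...       | inj₁ p = v , inj₂ (inj₁ (k , next²≢ i , p))
          ...       | inj₂ x = v , inj₂ (inj₂ x)

          B₂-arc : ∀ {z} m → m ≢ i → T (W⁺ z) → T (A m z) → T (B₂ z)
          B₂-arc {z} m m≢i w a with next-cases i m m≢i
          ... | inj₁ refl = ∧-intro (∨-introˡ (∧-intro w a)) (W⁺⊆V w)
          ... | inj₂ refl = ∧-intro (∨-introʳ {(W⁺ ∩ A j) z} (∨-introˡ (∧-intro w a))) (W⁺⊆V w)

          B₂-leg : ∀ {z} → T (V z) → OnLeg (λ _ → ⊤) z → T (B₂ z)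
          B₂-leg {z} v l = ∧-intro (∨-introʳ {(W⁺ ∩ A j) z} (∨-introʳ {(W⁺ ∩ A k) z} (legs l))) v
            where
            legs : OnLeg (λ _ → ⊤) z → T (S i z ∨ S j z ∨ S k z ∨ X z)
            legs (inj₂ x) = ∨-introʳ {S i z} (∨-introʳ {S j z} (∨-introʳ {S k z} x))
            legs (inj₁ (m , _ , p)) with m Fin.≟ i
            ... | yes refl = ∨-introˡ p
            ... | no m≢i with next-cases i m m≢i
            ...   | inj₁ refl = ∨-introʳ {S i z} (∨-introˡ p)
            ...   | inj₂ refl = ∨-introʳ {S i z} (∨-introʳ {S j z} (∨-introˡ p))

          B₂-cases : ∀ {z} → T (B₂ z) → T (V z) × (T (W⁺ z) ⊎ OnLeg (λ _ → ⊤) z)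
          B₂-cases {z} b = proj₂ both , cases (proj₁ both)
            where
            both : T ((W⁺ ∩ A j) z ∨ (W⁺ ∩ A k) z ∨ S i z ∨ S j z ∨ S k z ∨ X z) × T (V z)
            both = ∧-elim b
            leg : ∀ m → T (S m z) → T (W⁺ z) ⊎ OnLeg (λ _ → ⊤) z
            leg m p = inj₂ (inj₁ (m , tt , p))
            cases : T ((W⁺ ∩ A j) z ∨ (W⁺ ∩ A k) z ∨ S i z ∨ S j z ∨ S k z ∨ X z) → T (W⁺ z) ⊎ OnLeg (λ _ → ⊤) z
            cases h = [ inj₁ ∘ proj₁ ∘ ∧-elim {W⁺ z} , (λ h → [ inj₁ ∘ proj₁ ∘ ∧-elim {W⁺ z} , (λ h →
              [ leg i , (λ h → [ leg j , (λ h → [ leg k , inj₂ ∘ inj₂ ]′ (∨-elim {S k z} h)) ]′ (∨-elim {S j z} h)) ]′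
              (∨-elim {S i z} h)) ]′ (∨-elim {(W⁺ ∩ A k) z} h)) ]′ (∨-elim {(W⁺ ∩ A j) z} h)

          Wₘ-arc : ∀ {z} m → T (W⁺ z) → T (A m z) → T (Wₘ m z)
          Wₘ-arc m w a = ∧-intro (∨-introˡ (∧-intro w a)) (W⁺⊆V w)

          Wₘ-leg : ∀ {z} m → T (V z) → OnLeg (_≢ m) z → T (Wₘ m z)
          Wₘ-leg {z} m v (inj₂ x) =
            ∧-intro (∨-introʳ {(W⁺ ∩ A m) z} (∨-introʳ {S (next m) z} (∨-introʳ {S (next (next m)) z} x))) v
          Wₘ-leg {z} m v (inj₁ (l , l≢m , p)) with next-cases m l l≢m
          ... | inj₁ refl = ∧-intro (∨-introʳ {(W⁺ ∩ A m) z} (∨-introˡ p)) v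
          ... | inj₂ refl = ∧-intro (∨-introʳ {(W⁺ ∩ A m) z} (∨-introʳ {S (next m) z} (∨-introˡ p))) v

          Wₘ-cases : ∀ {z} m → T (Wₘ m z) → T (V z) × ((T (W⁺ z) × T (A m z)) ⊎ OnLeg (_≢ m) z)
          Wₘ-cases {z} m b with ∧-elim {(W⁺ ∩ A m) z ∨ S (next m) z ∨ S (next (next m)) z ∨ X z} b
          ... | h , v with ∨-elim {(W⁺ ∩ A m) z} h
          ...   | inj₁ w = v , inj₁ (∧-elim w)
          ...   | inj₂ h with ∨-elim {S (next m) z} h
          ...     | inj₁ p = v , inj₂ (inj₁ (next m , next≢ m , p))
          ...     | inj₂ h with ∨-elim {S (next (next m)) z} h
          ...       | inj₁ p = v , inj₂ (inj₁ (next (next m) , next²≢ m , p))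
          ...       | inj₂ x = v , inj₂ (inj₂ x)

          Zₘ-elim : ∀ {z} m → T (Zₘ m z) → T (Z z) × T (A m z) × ¬ T (B₁ z) × ¬ T (B₂ z)
          Zₘ-elim {z} m t = let Zz , h = ∧-elim {Z z} t
                                a , h′ = ∧-elim {A m z} h
                                p , q = ∧-elim {not (B₁ z)} h′
                            in Zz , a , not-elim p , not-elim q

          Zₘ-intro : ∀ {z} m → T (Z z) → T (A m z) → T (not (B₁ z)) → T (not (B₂ z)) → T (Zₘ m z)
          Zₘ-intro m Zz a ¬b₁ ¬b₂ = ∧-intro Zz (∧-intro a (∧-intro ¬b₁ ¬b₂))

        any-leg : ∀ {M z} → OnLeg M z → OnLeg (λ _ → ⊤) z
        any-leg (inj₁ (m , _ , p)) = inj₁ (m , tt , p)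
        any-leg (inj₂ x)           = inj₂ x

        separated : ∀ m {x y} → T (A m x) → ¬ T (A m y) → R x y → OnLeg (_≢ m) x ⊎ OnLeg (_≢ m) y
        separated m ax ¬ay r with separates m ax ¬ay r
        ... | inj₁ (l , l≢m , inj₁ p) = inj₁ (inj₁ (l , l≢m , p))
        ... | inj₁ (l , l≢m , inj₂ p) = inj₂ (inj₁ (l , l≢m , p))
        ... | inj₂ (inj₁ x)           = inj₁ (inj₂ x)
        ... | inj₂ (inj₂ x)           = inj₂ (inj₂ x)

        module P₁ = AddBag P i₀ B₁
          (λ b u → W⊆bag (V∩U (proj₁ (B₁-cases b)) u))
          (λ b ¬u uy r → B₁-W⁺ (W⁺-W (bound (V∖U (proj₁ (B₁-cases b)) ¬u) uy r)))
          ∣B₁∣≤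

        -- A new vertex `z` of `B₂` lies on leg `i`, hence outside arc `i`. A neighbour in `W⁺`
        -- could be missing from `B₂` only inside arc `i`; but then the edge leaves this arc, so one
        -- of its ends lies on another leg or is exceptional. For the neighbour this means
        -- membership in `B₂`, for `z` that it was in `B₁` already.
        closed₂ : ∀ {y z} → T (B₂ z) → ¬ T (U z ∨ B₁ z) → T (U y ∨ B₁ y) → R z y → T (B₂ y)
        closed₂ {y} {z} b ¬old known r with B₂-cases b
        ... | v , inj₁ w = ⊥-elim (¬old (∨-introʳ {U z} (B₁-W⁺ w)))
        ... | v , inj₂ (inj₂ x) = ⊥-elim (¬old (∨-introʳ {U z} (B₁-leg v (inj₂ x))))
        ... | v , inj₂ (inj₁ (m , _ , p)) with m Fin.≟ i
        ...   | no m≢i = ⊥-elim (¬old (∨-introʳ {U z} (B₁-leg v (inj₁ (m , m≢i , p)))))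
        ...   | yes refl = by-kind (kind (∨-elim known))
          where
          kind : T (U y) ⊎ T (B₁ y) → T (V y) × (T (W⁺ y) ⊎ OnLeg (_≢ i) y)
          kind (inj₁ u) = let w = W⁺-W (bound (V∖U v (¬old ∘ ∨-introˡ)) u r) in W⁺⊆V w , inj₁ w
          kind (inj₂ b) = B₁-cases b
          by-kind : T (V y) × (T (W⁺ y) ⊎ OnLeg (_≢ i) y) → T (B₂ y)
          by-kind (vy , inj₂ l) = B₂-leg vy (any-leg l)
          by-kind (vy , inj₁ w) with exhaust y
          ... | inj₂ (l , q) = B₂-leg vy (inj₁ (l , tt , q))
          ... | inj₁ (l , a) with l Fin.≟ i
          ...   | no l≢i = B₂-arc l l≢i w a
          ...   | yes refl with separated i a (λ az → opposite i z az p) (R-sym r)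
          ...     | inj₁ ly = B₂-leg vy (any-leg ly)
          ...     | inj₂ lz = ⊥-elim (¬old (∨-introʳ {U z} (B₁-leg v lz)))

        module P₂ = AddBag P₁.result zero B₂
          (λ {z} b known → [ (λ u → B₁-W⁺ (W⁺-W (V∩U (proj₁ (B₂-cases b)) u))) , id ]′ (∨-elim {U z} known))
          closed₂ ∣B₂∣≤

        Known : Fin 3 → Fin n → Set
        Known m z = T (U z ∨ B₁ z) ⊎ T (B₂ z) ⊎ (∃[ l ] l ≢ m × T (Zₘ l z))

        -- A vertex of `Zₘ m` avoids `B₂` and hence all legs and exceptions, so an edge from it out
        -- of arc `m` must have its other end on one of the two legs beside the arc or among the
        -- exceptions. Inside the arc, the known vertices come from `W⁺` or from those same sets, by
        -- `opposite`.
        taskₘ : ∀ m Q q → (∀ {z} → T (Partial.U Q z) → Known m z) →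
                (∀ {z} → T (Wₘ m z) → T (Partial.bag Q q z)) → Task Q q (Zₘ m) (Wₘ m)
        taskₘ m Q q known W⊆ = record { ∣W∣≤ = ∣Wₘ∣≤ m ; W⊆bag = W⊆ ; fresh = fresh′ ; bound = bound′ }
          where
          fresh′ : ∀ {z} → T (Zₘ m z) → ¬ T (Partial.U Q z)
          fresh′ {z} t u with Zₘ-elim m t | known u
          ... | Zz , a , ¬b₁ , ¬b₂ | inj₁ h = [ fresh Zz , ¬b₁ ]′ (∨-elim h)
          ... | Zz , a , ¬b₁ , ¬b₂ | inj₂ (inj₁ b₂) = ¬b₂ b₂
          ... | Zz , a , ¬b₁ , ¬b₂ | inj₂ (inj₂ (l , l≢m , t′)) =
            disjoint (l≢m ∘ sym) z a (proj₁ (proj₂ (Zₘ-elim l t′)))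
          bound′ : ∀ {x y} → T (Zₘ m x) → T (Partial.U Q y) → R x y → T (Wₘ m y)
          bound′ {x} {y} t u r with Zₘ-elim m t
          ... | Zx , ax , ¬b₁ , ¬b₂ = by-known (known u)
            where
            vx : T (V x)
            vx = ∨-introˡ Zx
            cross : T (V y) → ¬ T (A m y) → T (Wₘ m y)
            cross vy ¬ay with separated m ax ¬ay r
            ... | inj₁ lx = ⊥-elim (¬b₂ (B₂-leg vx (any-leg lx)))
            ... | inj₂ ly = Wₘ-leg m vy ly
            by-kind : T (V y) × (T (W⁺ y) ⊎ OnLeg (λ _ → ⊤) y) → T (Wₘ m y)
            by-kind (vy , kind) with T-dec (A m y)
            ... | inj₂ ¬ay = cross vy (not-elim ¬ay)
            ... | inj₁ ay with kind
            ...   | inj₁ w = Wₘ-arc m w ay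
            ...   | inj₂ (inj₂ x) = Wₘ-leg m vy (inj₂ x)
            ...   | inj₂ (inj₁ (l , _ , p)) = Wₘ-leg m vy (inj₁ (l , (λ { refl → opposite m y ay p }) , p))
            by-known : Known m y → T (Wₘ m y)
            by-known (inj₁ h) = by-kind ([ (λ u → let w = W⁺-W (bound Zx u r) in W⁺⊆V w , inj₁ w) ,
              (λ b → let v , c = B₁-cases b in v , [ inj₁ , inj₂ ∘ any-leg ]′ c) ]′ (∨-elim h))
            by-known (inj₂ (inj₁ b)) = by-kind (B₂-cases b)
            by-known (inj₂ (inj₂ (l , l≢m , t′))) = let Zy , ay , _ = Zₘ-elim l t′ in
              cross (∨-introˡ Zy) (disjoint l≢m y ay)

        Zₘ-size : ∀ m → ∣ Zₘ m ∣ᵇ < d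
        Zₘ-size m = shrink (Zₘ m) (λ t → proj₁ (Zₘ-elim m t)) λ t → proj₁ (proj₂ (proj₂ (Zₘ-elim m t))) (B₁-W⁺ W⁺-r)

        W⊆B₁ : ∀ {z} → T (Wₘ i z) → T (B₁ z)
        W⊆B₁ t with Wₘ-cases i t
        ... | v , inj₁ (w , _) = B₁-W⁺ w
        ... | v , inj₂ l       = B₁-leg v l

        W⊆B₂ : ∀ {z} m → m ≢ i → T (Wₘ m z) → T (B₂ z)
        W⊆B₂ m m≢i t with Wₘ-cases m t
        ... | v , inj₁ (w , a) = B₂-arc m m≢i w a
        ... | v , inj₂ l       = B₂-leg v (any-leg l)

        E₁ : Extension P₂.result (Zₘ i)
        -- The newest node `zero` carries `B₂`; `suc zero` carries `B₁`, the bag that contains the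
        -- boundary of arc `i`. The other two arcs are attached at `B₂`.
        E₁ = rec P₂.result (suc zero) (Zₘ i) (Wₘ i) (Zₘ-size i)
          (taskₘ i P₂.result (suc zero) (λ {z} u → [ inj₁ , inj₂ ∘ inj₁ ]′ (∨-elim {U z ∨ B₁ z} u)) W⊆B₁)
        module E₁ = Extension E₁

        E₂ : Extension E₁.Q (Zₘ j)
        E₂ = rec E₁.Q (_⊑_.embed E₁.P⊑Q zero) (Zₘ j) (Wₘ j) (Zₘ-size j)
          (taskₘ j E₁.Q _ (λ u → known (E₁.sound u)) (λ w → _⊑_.embed-bag E₁.P⊑Q zero (W⊆B₂ j (next≢ i) w)))
          where
          known : ∀ {z} → T ((U z ∨ B₁ z) ∨ B₂ z) ⊎ T (Zₘ i z) → Known j z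
          known (inj₂ t) = inj₂ (inj₂ (i , next≢ i ∘ sym , t))
          known {z} (inj₁ u) = [ inj₁ , inj₂ ∘ inj₁ ]′ (∨-elim {U z ∨ B₁ z} u)
        module E₂ = Extension E₂

        E₃ : Extension E₂.Q (Zₘ k)
        E₃ = rec E₂.Q (_⊑_.embed E₂.P⊑Q (_⊑_.embed E₁.P⊑Q zero)) (Zₘ k) (Wₘ k) (Zₘ-size k)
          (taskₘ k E₂.Q _ (λ u → known (E₂.sound u))
            (λ w → _⊑_.embed-bag E₂.P⊑Q _ (_⊑_.embed-bag E₁.P⊑Q zero (W⊆B₂ k (next²≢ i) w))))
          where
          known′ : ∀ {z} → T ((U z ∨ B₁ z) ∨ B₂ z) ⊎ T (Zₘ i z) → Known k z
          known′ (inj₂ t) = inj₂ (inj₂ (i , next²≢ i ∘ sym , t))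
          known′ {z} (inj₁ u) = [ inj₁ , inj₂ ∘ inj₁ ]′ (∨-elim {U z ∨ B₁ z} u)
          known : ∀ {z} → T (Partial.U E₁.Q z) ⊎ T (Zₘ j z) → Known k z
          known (inj₂ t) = inj₂ (inj₂ (j , next≢ j ∘ sym , t))
          known (inj₁ u) = known′ (E₁.sound u)
        module E₃ = Extension E₃

        split : Extension P Z
        split = extension E₃.Q (⊑-trans P₁.grown (⊑-trans P₂.grown (⊑-trans E₁.P⊑Q (⊑-trans E₂.P⊑Q E₃.P⊑Q))))
          sound₃ old₃ new₃
          where
          fromV : ∀ {z} → T (V z) → T (U z) ⊎ T (Z z)
          fromV v = [ inj₂ , inj₁ ∘ W⊆U ]′ (∨-elim v)
          sound₀ : ∀ {z} → T ((U z ∨ B₁ z) ∨ B₂ z) → T (U z) ⊎ T (Z z)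
          sound₀ {z} u = [ [ inj₁ , fromV ∘ proj₁ ∘ B₁-cases ]′ ∘ ∨-elim {U z} , fromV ∘ proj₁ ∘ B₂-cases ]′ (∨-elim {U z ∨ B₁ z} u)
          part : ∀ {z} m → T (Zₘ m z) → T (U z) ⊎ T (Z z)
          part m t = inj₂ (proj₁ (Zₘ-elim m t))
          sound₃ : ∀ {z} → T (Partial.U E₃.Q z) → T (U z) ⊎ T (Z z)
          sound₃ u = [ (λ u → [ (λ u → [ sound₀ , part i ]′ (E₁.sound u)) , part j ]′ (E₂.sound u)) , part k ]′ (E₃.sound u)
          old₂ : ∀ {z} → T ((U z ∨ B₁ z) ∨ B₂ z) → T (Partial.U E₃.Q z)
          old₂ = E₃.old ∘ E₂.old ∘ E₁.old
          old₃ : ∀ {z} → T (U z) → T (Partial.U E₃.Q z)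
          old₃ u = old₂ (∨-introˡ (∨-introˡ u))
          newₘ : ∀ {z} m → m ≡ i ⊎ m ≡ j ⊎ m ≡ k → T (Zₘ m z) → T (Partial.U E₃.Q z)
          newₘ _ (inj₁ refl)        t = E₃.old (E₂.old (E₁.new t))
          newₘ _ (inj₂ (inj₁ refl)) t = E₃.old (E₂.new t)
          newₘ _ (inj₂ (inj₂ refl)) t = E₃.new t
          new₃ : ∀ {z} → T (Z z) → T (Partial.U E₃.Q z)
          new₃ {z} Zz = [ (λ b → old₂ (∨-introˡ (∨-introʳ {U z} b))) , (λ ¬b₁ →
            [ (λ b → old₂ (∨-introʳ {U z ∨ B₁ z} b)) , (λ ¬b₂ →
            [ (λ { (m , a) → newₘ m (index-cases i m) (Zₘ-intro m Zz a ¬b₁ ¬b₂) }) ,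
              (λ { (m , p) → ⊥-elim (not-elim ¬b₂ (B₂-leg (∨-introˡ Zz) (inj₁ (m , tt , p)))) })
            ]′ (exhaust z)) ]′ (T-dec (B₂ z))) ]′ (T-dec (B₁ z))

      extend-nonempty : Extension P Z
      extend-nonempty with 3 ≤? ∣ W⁺ ∣ᵇ
      ... | no ¬3≤ = small-case (≤-pred (≰⇒> ¬3≤))
      ... | yes 3≤ = [ (λ { (i , ℓ≤) → Split.split t i (heavy-arc ℓ≤ (total i) ∣W⁺∣≤) }) ,
        (λ few → Split.split t zero (light-arcs (few (next zero)) (few (next (next zero))))) ]′
        (search heavy?)
        where
        t = tripods W⁺ 3≤
        open Tripod t
        heavy? : ∀ i → ℓ ≤ ∣ W⁺ ∩ A i ∣ᵇ ⊎ ∣ W⁺ ∩ A i ∣ᵇ < ℓ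
        heavy? i with ℓ ≤? ∣ W⁺ ∩ A i ∣ᵇ
        ... | yes p = inj₁ p
        ... | no ¬p = inj₂ (≰⇒> ¬p)
        W∩∪ : ∀ i z → T ((W⁺ ∩ A (next i)) z ∨ (W⁺ ∩ A (next (next i))) z) → T (W⁺ z)
        W∩∪ i z p = [ proj₁ ∘ ∧-elim , proj₁ ∘ ∧-elim ]′ (∨-elim {(W⁺ ∩ A (next i)) z} p)
        pair : ∀ i → ∣ W⁺ ∩ A (next i) ∣ᵇ + ∣ W⁺ ∩ A (next (next i)) ∣ᵇ ≤
                     ∣ (λ z → (W⁺ ∩ A (next i)) z ∨ (W⁺ ∩ A (next (next i))) z) ∣ᵇ
        pair i = ∣∣-disjoint {f = W⁺ ∩ A (next i)} {g = W⁺ ∩ A (next (next i))} (λ z → ∨-introˡ)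
          (λ z → ∨-introʳ {(W⁺ ∩ A (next i)) z})
          λ z p q → disjoint (next≢ (next i) ∘ sym) z (proj₂ (∧-elim {W⁺ z} p)) (proj₂ (∧-elim {W⁺ z} q))
        total : ∀ i → ∣ W⁺ ∩ A i ∣ᵇ + (∣ W⁺ ∩ A (next i) ∣ᵇ + ∣ W⁺ ∩ A (next (next i)) ∣ᵇ) ≤ ∣ W⁺ ∣ᵇ
        total i = ≤-trans (+-monoʳ-≤ (∣ W⁺ ∩ A i ∣ᵇ) (pair i))
          (∣∣-disjoint {f = W⁺ ∩ A i} {g = λ z → (W⁺ ∩ A (next i)) z ∨ (W⁺ ∩ A (next (next i))) z} {h = W⁺}
            (λ z → proj₁ ∘ ∧-elim) (W∩∪ i)
            λ z p q → [ (λ q → disjoint (next≢ i ∘ sym) z (proj₂ (∧-elim {W⁺ z} p)) (proj₂ (∧-elim {W⁺ z} q))) ,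
                        (λ q → disjoint (next²≢ i ∘ sym) z (proj₂ (∧-elim {W⁺ z} p)) (proj₂ (∧-elim {W⁺ z} q))) ]′
                      (∨-elim {(W⁺ ∩ A (next i)) z} q))

    extend : ∀ d → Solvable d
    extend (suc d) P i Z W (s≤s ∣Z∣≤) task with search (λ z → T-dec (Z z))
    ... | inj₁ (r , Zr) = Step.extend-nonempty d (extend d) P i Z W ∣Z∣≤ task r Zr
    ... | inj₂ none     = extension P ⊑-refl inj₁ id (λ {z} Zz → ⊥-elim (not-elim (none z) Zz))

    whole : Extension initial (λ _ → true)
    whole = extend (suc n) initial zero (λ _ → true) (λ _ → false) (s≤s (∣∣-≤ {n} (λ _ → true))) record
      { ∣W∣≤ = ≤-trans (≤-reflexive (∣∣-empty {n} {λ _ → false} (λ _ ()))) z≤n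
      ; W⊆bag = λ () ; fresh = λ _ () ; bound = λ _ () }

    decomposition : ∃[ P ] (∀ z → T (Partial.U {K} P z))
    decomposition = Extension.Q whole , λ z → Extension.new whole tt

-- From the drawn graph to its tree decomposition

∣tabulate∣ : ∀ {n} (f : Fin n → Bool) → ∣ tabulate f ∣ ≡ ∣ f ∣ᵇ
∣tabulate∣ {zero}  f = refl
∣tabulate∣ {suc n} f with f zero
... | true  = cong suc (∣tabulate∣ (f ∘ suc))
... | false = ∣tabulate∣ (f ∘ suc)

∈-tabulate : ∀ {n} (f : Fin n → Bool) {z} → T (f z) → z ∈ₛ tabulate f
∈-tabulate f {z} p = lookup⇒[]= z (tabulate f) (trans (lookup∘tabulate f z) (Equivalence.to T-≡ p))

∈-tabulate⁻¹ : ∀ {n} (f : Fin n → Bool) {z} → z ∈ₛ tabulate f → T (f z)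
∈-tabulate⁻¹ f {z} p = Equivalence.from T-≡ (trans (sym (lookup∘tabulate f z)) ([]=⇒lookup p))

length-filter : ∀ {A : Set} (q : A → Bool) xs → length (filter (T? ∘ q) xs) ≡ count q xs
length-filter q []       = refl
length-filter q (x ∷ xs) with q x
... | true  = cong suc (length-filter q xs)
... | false = length-filter q xs

-- An edge lists its ends by vertex index, whereas `interleave` takes them sorted by position: each
-- of the two edges may be reversed, which gives four disjuncts.
crossing-order : ∀ a b c d →
  T (interleave a b c d ∨ interleave b a c d ∨ interleave a b d c ∨ interleave b a d c) →
  (a ≢ c × a ≢ d × b ≢ c × b ≢ d) ×
  T ((between a b c ∧ not (between a b d)) ∨ (not (between a b c) ∧ between a b d))
crossing-order a b c d h =
  (≢-from (by-order hyps (≢ᶠ ⟨0⟩ ⟨2⟩) ρ h) , ≢-from (by-order hyps (≢ᶠ ⟨0⟩ ⟨3⟩) ρ h) ,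
   ≢-from (by-order hyps (≢ᶠ ⟨1⟩ ⟨2⟩) ρ h) , ≢-from (by-order hyps (≢ᶠ ⟨1⟩ ⟨3⟩) ρ h)) ,
  by-order hyps ((bt ⟨2⟩ ∧ᶠ ¬ᶠ bt ⟨3⟩) ∨ᶠ (¬ᶠ bt ⟨2⟩ ∧ᶠ bt ⟨3⟩)) ρ h
  where
  ρ = a ∷ b ∷ c ∷ d ∷ []
  hyps : List (Formula 4)
  hyps = (interleaveᶠ ⟨0⟩ ⟨1⟩ ⟨2⟩ ⟨3⟩ ∨ᶠ interleaveᶠ ⟨1⟩ ⟨0⟩ ⟨2⟩ ⟨3⟩ ∨ᶠ
          interleaveᶠ ⟨0⟩ ⟨1⟩ ⟨3⟩ ⟨2⟩ ∨ᶠ interleaveᶠ ⟨1⟩ ⟨0⟩ ⟨3⟩ ⟨2⟩) ∷ []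
  ≢ᶠ : Fin 4 → Fin 4 → Formula 4
  ≢ᶠ i j = i ≺ j ∨ᶠ j ≺ i
  bt : Fin 4 → Formula 4
  bt = betweenᶠ ⟨0⟩ ⟨1⟩
  ≢-from : ∀ {x y} → T ((x <ᵇ y) ∨ (y <ᵇ x)) → x ≢ y
  ≢-from {x} {y} p refl = [ (λ q → <-irrefl refl (<ᵇ⇒< x x q)) , (λ q → <-irrefl refl (<ᵇ⇒< x x q)) ]′ (∨-elim {x <ᵇ y} p)

-- The left side is 2N for the N layers used by the minor; this is the origin of `t * t + t` in the
-- bound.
tri-double : ∀ t → (t + tri t) + (t + tri t) ≡ t * t + t
tri-double zero    = refl
tri-double (suc t) = trans
  (solve 2 (λ t x → ((con 1 :+ t) :+ x) :+ ((con 1 :+ t) :+ x) := (con 2 :+ (t :+ t)) :+ (x :+ x)) refl t (t + tri t))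
  (trans (cong ((2 + (t + t)) +_) (tri-double t))
    (solve 1 (λ t → (con 2 :+ (t :+ t)) :+ (t :* t :+ t) := (con 1 :+ t) :* (con 1 :+ t) :+ (con 1 :+ t)) refl t))
  where open +-*-Solver

module _ (G : FinGraph) (D : CircularDrawing G) where

  N : ℕ
  N = n G

  pos : Fin N → ℕ
  pos v = toℕ (proj₁ D v)

  pos-injective : ∀ {x y} → pos x ≡ pos y → x ≡ y
  pos-injective eq = proj₂ D (toℕ-injective eq)

  pos<n : ∀ x → pos x < N
  pos<n x = toℕ<n (proj₁ D x)

  lower upper : Fin N → Fin N → Fin N
  lower a b with pos a <? pos b
  ... | yes _ = a
  ... | no _  = b
  upper a b with pos a <? pos b
  ... | yes _ = b
  ... | no _  = a

  loᵥ hiᵥ : Edge G → Fin N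
  loᵥ ((a , b) , _) = lower a b
  hiᵥ ((a , b) , _) = upper a b

  ends : ∀ a b → (lower a b ≡ a × upper a b ≡ b) ⊎ (lower a b ≡ b × upper a b ≡ a)
  ends a b with pos a <? pos b
  ... | yes _ = inj₁ (refl , refl)
  ... | no _  = inj₂ (refl , refl)

  lo<hi : ∀ e → T (pos (loᵥ e) <ᵇ pos (hiᵥ e))
  lo<hi ((a , b) , a<b , _) with pos a <? pos b
  ... | yes lt = <⇒<ᵇ lt
  ... | no ¬lt = <⇒<ᵇ (≤∧≢⇒< (≮⇒≥ ¬lt) λ eq → <⇒≢ a<b (cong toℕ (sym (pos-injective eq))))

  edge : ∀ {x y} → Adj G x y → ∃[ e ] ((loᵥ e ≡ x × hiᵥ e ≡ y) ⊎ (loᵥ e ≡ y × hiᵥ e ≡ x))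
  edge {x} {y} r with <-cmp (toℕ x) (toℕ y)
  ... | tri< x<y _ _ = ((x , y) , x<y , r) , ends x y
  ... | tri> _ _ y<x = ((y , x) , y<x , subst T (FinGraph.sym G x y) r) , [ inj₂ , inj₁ ]′ (ends y x)
  ... | tri≈ _ x≡y _ = ⊥-elim (subst T (trans (cong (adj G x) (sym (toℕ-injective x≡y))) (irref G x)) r)

  edge-≡ : ∀ {e f : Edge G} → proj₁ e ≡ proj₁ f → e ≡ f
  edge-≡ {p , a<b , r} {.p , c<d , s} refl = cong (p ,_) (cong₂ _,_ (<-irrelevant a<b c<d) (T-irrelevant r s))

  _≟ₑ_ : DecidableEquality (Edge G)
  e ≟ₑ f with ≡-dec Fin._≟_ Fin._≟_ (proj₁ e) (proj₁ f)
  ... | yes eq = yes (edge-≡ eq)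
  ... | no ne  = no (ne ∘ cong proj₁)

  isEdge? : ∀ p → Dec ((toℕ (proj₁ p) < toℕ (proj₂ p)) × Adj G (proj₁ p) (proj₂ p))
  isEdge? (a , b) = (toℕ a <? toℕ b) ×-dec T? (adj G a b)

  edgesAmong : List (Fin N × Fin N) → List (Edge G)
  edgesAmong []       = []
  edgesAmong (p ∷ ps) with isEdge? p
  ... | yes q = (p , q) ∷ edgesAmong ps
  ... | no _  = edgesAmong ps

  edgesAmong⁻ : ∀ ps {e} → e ∈ edgesAmong ps → proj₁ e ∈ ps
  edgesAmong⁻ (p ∷ ps) e∈ with isEdge? p
  edgesAmong⁻ (p ∷ ps) (here refl) | yes _ = here refl
  edgesAmong⁻ (p ∷ ps) (there e∈)  | yes _ = there (edgesAmong⁻ ps e∈)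
  edgesAmong⁻ (p ∷ ps) e∈          | no _  = there (edgesAmong⁻ ps e∈)

  edgesAmong⁺ : ∀ ps e → proj₁ e ∈ ps → e ∈ edgesAmong ps
  edgesAmong⁺ (p ∷ ps) e e∈ with isEdge? p
  edgesAmong⁺ (p ∷ ps) e       (here refl) | yes q = here (edge-≡ refl)
  edgesAmong⁺ (p ∷ ps) e       (there e∈)  | yes q = there (edgesAmong⁺ ps e e∈)
  edgesAmong⁺ (p ∷ ps) (_ , q) (here refl) | no ¬q = ⊥-elim (¬q q)
  edgesAmong⁺ (p ∷ ps) e       (there e∈)  | no _  = edgesAmong⁺ ps e e∈

  edgesAmong-unique : ∀ {ps} → Unique ps → Unique (edgesAmong ps)
  edgesAmong-unique {[]}     []        = []
  edgesAmong-unique {p ∷ ps} (p∉ ∷ u) with isEdge? p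
  ... | yes q = All.tabulate (λ e∈ eq → All.lookup p∉ (edgesAmong⁻ ps e∈) (cong proj₁ eq)) ∷ edgesAmong-unique u
  ... | no _  = edgesAmong-unique u

  edges : List (Edge G)
  edges = edgesAmong (cartesianProduct (allFin N) (allFin N))

  edges-unique : Unique edges
  edges-unique = edgesAmong-unique (Uniq.cartesianProduct⁺ (Uniq.allFin⁺ N) (Uniq.allFin⁺ N))

  ∈-edges : ∀ e → e ∈ edges
  ∈-edges e@((a , b) , _) = edgesAmong⁺ _ e (∈-cartesianProduct⁺ (∈-allFin a) (∈-allFin b))

  Between⇒ : ∀ a b x → StrictlyBetween G D a b x → T (between (pos a) (pos b) (pos x))
  Between⇒ a b x (inj₁ (p , q)) = ∨-introˡ (∧-intro (<⇒<ᵇ p) (<⇒<ᵇ q))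
  Between⇒ a b x (inj₂ (p , q)) = ∨-introʳ {(pos a <ᵇ pos x) ∧ (pos x <ᵇ pos b)} (∧-intro (<⇒<ᵇ p) (<⇒<ᵇ q))

  Between⇐ : ∀ a b x → T (between (pos a) (pos b) (pos x)) →
             StrictlyBetween G D a b x
  Between⇐ a b x t with ∨-elim {(pos a <ᵇ pos x) ∧ (pos x <ᵇ pos b)} t
  ... | inj₁ h = let p , q = ∧-elim {pos a <ᵇ pos x} h in inj₁ (<ᵇ⇒< (pos a) (pos x) p , <ᵇ⇒< (pos x) (pos b) q)
  ... | inj₂ h = let p , q = ∧-elim {pos b <ᵇ pos x} h in inj₂ (<ᵇ⇒< (pos b) (pos x) p , <ᵇ⇒< (pos x) (pos a) q)

  interleave⇒Cross : ∀ e f → T (interleave (pos (loᵥ e)) (pos (hiᵥ e)) (pos (loᵥ f)) (pos (hiᵥ f))) → Cross G D e f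
  interleave⇒Cross ((a , b) , _) ((c , d) , _) t with crossing-order (pos a) (pos b) (pos c) (pos d) (cases (ends a b) (ends c d))
    where
    il : Fin N → Fin N → Fin N → Fin N → Bool
    il a b c d = interleave (pos a) (pos b) (pos c) (pos d)
    il-cong : ∀ {a a′ b b′ c c′ d d′} → a ≡ a′ → b ≡ b′ → c ≡ c′ → d ≡ d′ → T (il a b c d) → T (il a′ b′ c′ d′)
    il-cong refl refl refl refl = id
    cases : (lower a b ≡ a × upper a b ≡ b) ⊎ (lower a b ≡ b × upper a b ≡ a) →
            (lower c d ≡ c × upper c d ≡ d) ⊎ (lower c d ≡ d × upper c d ≡ c) →
            T (il a b c d ∨ il b a c d ∨ il a b d c ∨ il b a d c)
    cases (inj₁ (p , q)) (inj₁ (r , s)) = ∨-introˡ (il-cong p q r s t)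
    cases (inj₂ (p , q)) (inj₁ (r , s)) = ∨-introʳ {il a b c d} (∨-introˡ (il-cong p q r s t))
    cases (inj₁ (p , q)) (inj₂ (r , s)) = ∨-introʳ {il a b c d} (∨-introʳ {il b a c d} (∨-introˡ (il-cong p q r s t)))
    cases (inj₂ (p , q)) (inj₂ (r , s)) =
      ∨-introʳ {il a b c d} (∨-introʳ {il b a c d} (∨-introʳ {il a b d c} (il-cong p q r s t)))
  ... | (ac , ad , bc , bd) , sb =
    ac ∘ cong pos , ad ∘ cong pos , bc ∘ cong pos , bd ∘ cong pos , sides
    where
    bt : Fin N → Bool
    bt x = between (pos a) (pos b) (pos x)
    sides : (StrictlyBetween G D a b c × ¬ StrictlyBetween G D a b d) ⊎
            (¬ StrictlyBetween G D a b c × StrictlyBetween G D a b d)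
    sides with ∨-elim {bt c ∧ not (bt d)} sb
    ... | inj₁ h = let p , q = ∧-elim {bt c} h in inj₁ (Between⇐ a b c p , not-elim q ∘ Between⇒ a b d)
    ... | inj₂ h = let p , q = ∧-elim {not (bt c)} h in inj₂ (not-elim p ∘ Between⇒ a b c , Between⇐ a b d q)

  module _ (M t : ℕ) (1+M : suc M ≡ t + tri t) (no-minor : ¬ HasTopologicalMinor (CrossingGraph G D) t) where

    open Drawn pos pos-injective pos<n loᵥ hiᵥ lo<hi (Adj G) edge (M + M) hiding (lo; hi)

    shallow : Fin N → ∀ y x → y ≤ x → ∃[ p ] Near (inside y x) p
    shallow z₀ y x y≤x with search count?
      where
      open Layers _≟ₑ_ pos loᵥ hiᵥ (inside y x) lo<hi (inside-coherent y≤x)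
      count? : ∀ z → count (λ e → covers e z) edges ≤ M + M ⊎ suc (M + M) ≤ count (λ e → covers e z) edges
      count? z with count (λ e → covers e z) edges ≤? M + M
      ... | yes le = inj₁ le
      ... | no ¬le = inj₂ (≰⇒> ¬le)
    ... | inj₁ (z , le) = pos z , filter (T? ∘ q) edges , ≤-trans (≤-reflexive (length-filter q edges)) le ,
      λ e c → ∈-filter⁺ (T? ∘ q) (∈-edges e) c
      where
      open Layers _≟ₑ_ pos loᵥ hiᵥ (inside y x) lo<hi (inside-coherent y≤x)
      q : Edge G → Bool
      q e = covers e z
    ... | inj₂ deep = ⊥-elim (no-minor (Minor.minor (Cross G D) (λ {e} {f} → interleave⇒Cross e f)
      (subst (λ N → Nested N edges) 1+M (nested M edges edges-unique deep)) z₀))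
      where
      open Layers _≟ₑ_ pos loᵥ hiᵥ (inside y x) lo<hi (inside-coherent y≤x)

    label : Fin N → ℕ → ℕ → ℕ
    label z₀ y x with y ≤? x
    ... | yes y≤x = proj₁ (shallow z₀ y x y≤x)
    ... | no _    = 0

    labelled : ∀ z₀ y x → y ≤ x → Near (inside y x) (label z₀ y x)
    labelled z₀ y x y≤x with y ≤? x
    ... | yes y≤x′ = proj₂ (shallow z₀ y x y≤x′)
    ... | no ¬y≤x  = ⊥-elim (¬y≤x y≤x)

    tripods : ∀ W → 3 ≤ ∣ W ∣ᵇ → Tripod (Adj G) (suc (M + M)) W
    tripods W 3≤ = balanced-tripod (label z₀) (labelled z₀) W 3≤
      where
      z₀ : Fin N
      z₀ = fromℕ< (≤-trans (s≤s z≤n) (≤-trans 3≤ (∣∣-≤ W)))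

    treewidth : ∀ {k} → 6 * suc (suc (M + M)) ≤ k → TreewidthAtMost G k
    treewidth {k} le = record
      { tree = growthTree growth
      ; bag = λ i → tabulate (bag i)
      ; covers-vertices = λ v → let i , p = covers₁ v (all v) in i , ∈-tabulate (bag i) p
      ; covers-edges = λ u v r → let i , p , q = covers₂ u v (all u) (all v) r in
          i , ∈-tabulate (bag i) p , ∈-tabulate (bag i) q
      ; subtree = λ v i j p q → walk-map id id (λ {l} → ∈-tabulate (bag l))
          (subtree v i j (∈-tabulate⁻¹ (bag i) p) (∈-tabulate⁻¹ (bag j) q))
      } , λ i → ≤-trans (≤-reflexive (∣tabulate∣ (bag i))) (≤-trans (small i)
        (≤-trans (≤-reflexive (+-comm _ 1)) (s≤s le)))
      where
      open Build (Adj G) (λ {x} {y} → subst T (FinGraph.sym G x y))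
      open Extend (suc (M + M)) tripods
      all = proj₂ decomposition
      open Partial (proj₁ decomposition)

theorem10 : (t : ℕ) → 1 ≤ t → (G : FinGraph) →
    Σ (CircularDrawing G) (λ D → ¬ HasTopologicalMinor (CrossingGraph G D) t) →
    TreewidthAtMost G (6 * t * t + 6 * t + 1)
-- The number of layers is `suc M`, so that `suc (suc (M + M))` is its double. Bags of 6(t² + t) + 1
-- vertices give width 6t² + 6t, and `m≤m+n` adds the remaining 1.
theorem10 (suc t) 1≤t G (D , no-minor) = treewidth G D M (suc t) refl no-minor (≤-trans (≤-reflexive eq) (m≤m+n _ 1))
  where
  open +-*-Solver
  M : ℕ
  M = t + tri (suc t)
  eq : 6 * suc (suc (M + M)) ≡ 6 * suc t * suc t + 6 * suc t
  eq = trans (cong (6 *_) (trans (cong suc (sym (+-suc M M))) (tri-double (suc t))))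
    (solve 1 (λ t → con 6 :* (t :* t :+ t) := con 6 :* t :* t :+ con 6 :* t) refl (suc t))
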